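{- Let $p$ be an odd prime and $g\ge 1$. Let $G$ be a finite abelian $p$-group of $p$-class $c$ and generator rank $g$. Then $$\mathrm{Meas}_c^{\mathrm{ab}}(G)=\frac{1}{|\mathrm{Aut}(G)|\,|G|}\,p^{g(g+1)}\prod_{k=1}^{g}(1-p^{ -k})\prod_{k=g+2-u}^{g+1}(1-p^{ -k}),$$ where $u$ is the number of cyclic groups of order strictly less than $p^c$ in the direct product decomposition of $G$ into cyclic groups. Moreover, for every $c'>c$, $$\mathrm{Meas}_{c'}^{\mathrm{ab}}(G)=\frac{1}{|\mathrm{Aut}(G)|\,|G|}\,p^{g(g+1)}\prod_{k=1}^{g}(1-p^{ -k})\prod_{k=2}^{g+1}(1-p^{ -k}).$$
   Context: Let $F$ be the free pro-$p$ group on $g$ generators and $F^{\mathrm{ab}}$ its abelianization. For a pro-$p$ group $H$, the lower $p$-central series is $P_0(H)=H$, $P_{n+1}(H)=[H,P_n(H)]P_n(H)^p$ (closed subgroups); $H$ has $p$-class $c$ if $P_c(H)=1$ but $P_n(H)\neq 1$ for $n<c$. Put $F_{c'}^{\mathrm{ab}}=F^{\mathrm{ab}}/P_{c'}(F^{\mathrm{ab}})$, and let $\Phi(\cdot)$ denote the Frattini subgroup. For a finite abelian $p$-group $G$ of $p$-class $c$ and generator rank $g$ and $c'\ge c$, a tuple $v=(t_1,\dots,t_{g+1})\in\Phi(F_{c'}^{\mathrm{ab}})^{g+1}$ presents $G$ if $F_{c'}^{\mathrm{ab}}/\langle t_1,\dots,t_{g+1}\rangle\cong G$; let $S_{c'}^{\mathrm{ab}}(G)$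 be the set of such tuples. The abelian$+1$ $c'$-measure is $\mathrm{Meas}_{c'}^{\mathrm{ab}}(G)=|S_{c'}^{\mathrm{ab}}(G)|/|\Phi(F_{c'}^{\mathrm{ab}})|^{g+1}$. -}

module Defs where

open import Algebra.Bundles using (Group; AbelianGroup)
open import Algebra.Definitions.RawMonoid using (_×_)
open import Algebra.Morphism.Structures using (IsGroupHomomorphism; IsGroupIsomorphism)
import Algebra.Properties.Group as GroupProperties
open import Data.Fin.Base using (Fin)
open import Data.Fin.Properties using (nonZeroIndex)
open import Data.Integer.Base as ℤ using (+_)
import Data.Integer.Properties as ℤ
import Data.Integer.Divisibility.Signed as ℤ
open import Data.List.Base using (foldr; map; upTo)
open import Data.Nat.Base as ℕ using (ℕ; zero; suc; _^_; _∸_; _≤_; _<_; NonZero)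
open import Data.Nat.Primality using (Prime; prime⇒nonZero)
open import Data.Nat.Properties using (m^n≢0; m*n≢0)
open import Data.Product.Base using (Σ; Σ-syntax; ∃; _,_; proj₁; proj₂) renaming (_×_ to _∧_)
open import Data.Rational.Base using (ℚ; 1ℚ; _/_; _-_; _*_)
open import Data.Sum.Base using (_⊎_; inj₁; inj₂)
open import Data.Unit.Base using (⊤; tt)
open import Data.Vec.Base using (Vec; lookup)
open import Data.Vec.Relation.Unary.All using (All)
open import Function.Bundles using (Inverse)
open import Level using (Level; 0ℓ)
open import Relation.Binary.Bundles using (Setoid)
import Relation.Binary.Construct.On as On
open import Relation.Binary.PropositionalEquality as ≡ using (_≡_)
import Relation.Binary.Reasoning.Setoid as SetoidReasoning
open import Relation.Nullary.Negation using (¬_)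
open import Relation.Unary using (Pred; _∈_; _⊆_; _∪_; U; Decidable)

private
  variable
    a ℓ : Level

Grp : Set₁
Grp = Group 0ℓ 0ℓ

record Finite (S : Setoid a ℓ) : Set (a Level.⊔ ℓ) where
  field
    size : ℕ
    enum : Inverse (≡.setoid (Fin size)) S

open Finite public using (size)

size-nonZero : {S : Setoid a ℓ} (fin : Finite S) → Setoid.Carrier S → NonZero (size fin)
size-nonZero fin x = nonZeroIndex (Inverse.from (Finite.enum fin) x)

infix 4 _≅_

_≅_ : Grp → Grp → Set
G ≅ H = Σ[ f ∈ (Group.Carrier G → Group.Carrier H) ]
          IsGroupIsomorphism (Group.rawGroup G) (Group.rawGroup H) f

Aut : Grp → Setoid 0ℓ 0ℓ
Aut G = record
  { Carrier       = G ≅ G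
  ; _≈_           = λ f h → ∀ x → proj₁ f x ≈ proj₁ h x
  ; isEquivalence = record
    { refl  = λ x → refl
    ; sym   = λ f≈h x → sym (f≈h x)
    ; trans = λ f≈h h≈k x → trans (f≈h x) (h≈k x)
    }
  }
  where open Group G

idAut : (G : Grp) → G ≅ G
idAut G = (λ x → x) , record
  { isGroupMonomorphism = record
    { isGroupHomomorphism = record
      { isMonoidHomomorphism = record
        { isMagmaHomomorphism = record
          { isRelHomomorphism = record { cong = λ eq → eq }
          ; homo              = λ _ _ → refl
          }
        ; ε-homo = refl
        }
      ; ⁻¹-homo = λ _ → refl
      }
    ; injective = λ eq → eq
    }
  ; surjective = λ y → y , λ eq → eq
  }
  where open Group G

module _ (G : Grp) where
  open Group G

  record IsSubgroup (H : Pred Carrier 0ℓ) : Set where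
    field
      resp : ∀ {x y} → x ≈ y → x ∈ H → y ∈ H
      ε∈   : ε ∈ H
      ∙∈   : ∀ {x y} → x ∈ H → y ∈ H → (x ∙ y) ∈ H
      ⁻¹∈  : ∀ {x} → x ∈ H → (x ⁻¹) ∈ H

  conj : Carrier → Carrier → Carrier
  conj g x = g ∙ x ∙ g ⁻¹

  record IsNormalSubgroup (N : Pred Carrier 0ℓ) : Set where
    field
      isSubgroup : IsSubgroup N
      conj∈      : ∀ g {x} → x ∈ N → conj g x ∈ N

    open IsSubgroup isSubgroup public

  data ⟨_⟩ (S : Pred Carrier 0ℓ) : Pred Carrier 0ℓ where
    gen      : ∀ {x} → x ∈ S → x ∈ ⟨ S ⟩
    gen-resp : ∀ {x y} → x ≈ y → x ∈ ⟨ S ⟩ → y ∈ ⟨ S ⟩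
    gen-ε    : ε ∈ ⟨ S ⟩
    gen-∙    : ∀ {x y} → x ∈ ⟨ S ⟩ → y ∈ ⟨ S ⟩ → (x ∙ y) ∈ ⟨ S ⟩
    gen-⁻¹   : ∀ {x} → x ∈ ⟨ S ⟩ → (x ⁻¹) ∈ ⟨ S ⟩

  Image : ∀ {n} → (Fin n → Carrier) → Pred Carrier 0ℓ
  Image t x = ∃ λ k → t k ≈ x

  Generates : ∀ {n} → (Fin n → Carrier) → Set
  Generates t = ∀ x → x ∈ ⟨ Image t ⟩

  record HasRank (g : ℕ) : Set where
    field
      generators : Fin g → Carrier
      generates  : Generates generators
      minimal    : ∀ {m} (t : Fin m → Carrier) → Generates t → g ≤ m

  -- Only decidable subgroups are considered.  These definitions are meant for
  -- finite groups, where classically this is no restriction.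
  record IsMaximalSubgroup (M : Pred Carrier 0ℓ) : Set₁ where
    field
      isSubgroup : IsSubgroup M
      decidable  : Decidable M
      proper     : ¬ (∀ x → x ∈ M)
      maximal    : ∀ (K : Pred Carrier 0ℓ) → IsSubgroup K → Decidable K →
                   M ⊆ K → K ⊆ M ⊎ (∀ x → x ∈ K)

  Frattini : Pred Carrier (Level.suc 0ℓ)
  Frattini x = ∀ (M : Pred Carrier 0ℓ) → IsMaximalSubgroup M → x ∈ M

  FrattiniSetoid : Setoid (Level.suc 0ℓ) 0ℓ
  FrattiniSetoid = On.setoid {B = Σ Carrier Frattini} setoid proj₁

  ε∈Frattini : ε ∈ Frattini
  ε∈Frattini M max = IsSubgroup.ε∈ (IsMaximalSubgroup.isSubgroup max)

  CommutatorsWith : Pred Carrier 0ℓ → Pred Carrier 0ℓ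
  CommutatorsWith S z = Σ[ x ∈ Carrier ] Σ[ y ∈ Carrier ] (y ∈ S ∧ z ≈ x ∙ y ∙ x ⁻¹ ∙ y ⁻¹)

  -- In the library's additive notation p × x is the p-th power of x.
  Powers : ℕ → Pred Carrier 0ℓ → Pred Carrier 0ℓ
  Powers p S z = Σ[ x ∈ Carrier ] (x ∈ S ∧ z ≈ _×_ rawMonoid p x)

  ConjClosed : Pred Carrier 0ℓ → Set
  ConjClosed S = ∀ g {x} → x ∈ S → conj g x ∈ S

  private
    open GroupProperties G
    open SetoidReasoning setoid

    conj-cong : ∀ g {x y} → x ≈ y → conj g x ≈ conj g y
    conj-cong g eq = ∙-congʳ (∙-congˡ eq)

    conj-ε : ∀ g → conj g ε ≈ ε
    conj-ε g = trans (∙-congʳ (identityʳ g)) (inverseʳ g)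

    conj-∙ : ∀ g x y → conj g (x ∙ y) ≈ conj g x ∙ conj g y
    conj-∙ g x y = begin
      g ∙ (x ∙ y) ∙ g ⁻¹                ≈⟨ ∙-congʳ (assoc g x y) ⟨
      g ∙ x ∙ y ∙ g ⁻¹                  ≈⟨ assoc (g ∙ x) y (g ⁻¹) ⟩
      g ∙ x ∙ (y ∙ g ⁻¹)                ≈⟨ ∙-congˡ (\\-leftDividesʳ g (y ∙ g ⁻¹)) ⟨
      g ∙ x ∙ (g ⁻¹ ∙ (g ∙ (y ∙ g ⁻¹))) ≈⟨ assoc (g ∙ x) (g ⁻¹) _ ⟨
      g ∙ x ∙ g ⁻¹ ∙ (g ∙ (y ∙ g ⁻¹))   ≈⟨ ∙-congˡ (assoc g y (g ⁻¹)) ⟨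
      g ∙ x ∙ g ⁻¹ ∙ (g ∙ y ∙ g ⁻¹)     ∎

    conj-⁻¹ : ∀ g x → conj g (x ⁻¹) ≈ conj g x ⁻¹
    conj-⁻¹ g x = inverseˡ-unique _ _ (begin
      conj g (x ⁻¹) ∙ conj g x ≈⟨ conj-∙ g (x ⁻¹) x ⟨
      conj g (x ⁻¹ ∙ x)        ≈⟨ conj-cong g (inverseˡ x) ⟩
      conj g ε                 ≈⟨ conj-ε g ⟩
      ε                        ∎)

    conj-× : ∀ g n x → conj g (_×_ rawMonoid n x) ≈ _×_ rawMonoid n (conj g x)
    conj-× g zero    x = conj-ε g
    conj-× g (suc n) x = trans (conj-∙ g x _) (∙-congˡ (conj-× g n x))

    //-product : ∀ x y x' y' → (x // y) ∙ conj y (x' // y') ≈ (x ∙ x') // (y ∙ y')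
    //-product x y x' y' = begin
      (x // y) ∙ (y ∙ (x' // y') ∙ y ⁻¹)   ≈⟨ assoc (x // y) _ _ ⟨
      (x // y) ∙ (y ∙ (x' // y')) ∙ y ⁻¹   ≈⟨ ∙-congʳ (assoc (x // y) y _) ⟨
      (x // y) ∙ y ∙ (x' // y') ∙ y ⁻¹     ≈⟨ ∙-congʳ (∙-congʳ (//-rightDividesˡ y x)) ⟩
      x ∙ (x' ∙ y' ⁻¹) ∙ y ⁻¹              ≈⟨ ∙-congʳ (assoc x x' (y' ⁻¹)) ⟨
      x ∙ x' ∙ y' ⁻¹ ∙ y ⁻¹                ≈⟨ assoc (x ∙ x') (y' ⁻¹) (y ⁻¹) ⟩
      x ∙ x' ∙ (y' ⁻¹ ∙ y ⁻¹)              ≈⟨ ∙-congˡ (⁻¹-anti-homo-∙ y y') ⟨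
      (x ∙ x') // (y ∙ y')                 ∎

    //-inverse : ∀ x y → conj (y ⁻¹) ((x // y) ⁻¹) ≈ x ⁻¹ // y ⁻¹
    //-inverse x y = ∙-congʳ (begin
      y ⁻¹ ∙ (x // y) ⁻¹ ≈⟨ ∙-congˡ (⁻¹-anti-homo-// x y) ⟩
      y ⁻¹ ∙ (y ∙ x ⁻¹)  ≈⟨ \\-leftDividesʳ y (x ⁻¹) ⟩
      x ⁻¹               ∎)

  commutators-conj : ∀ {S} → ConjClosed S → ConjClosed (CommutatorsWith S)
  commutators-conj cl g {z} (x , y , y∈S , z≈) =
    conj g x , conj g y , cl g y∈S , (begin
      conj g z                                             ≈⟨ conj-cong g z≈ ⟩
      conj g (x ∙ y ∙ x ⁻¹ ∙ y ⁻¹)                         ≈⟨ conj-∙ g _ _ ⟩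
      conj g (x ∙ y ∙ x ⁻¹) ∙ conj g (y ⁻¹)                ≈⟨ ∙-cong (conj-∙ g _ _) (conj-⁻¹ g y) ⟩
      conj g (x ∙ y) ∙ conj g (x ⁻¹) ∙ conj g y ⁻¹         ≈⟨ ∙-congʳ (∙-cong (conj-∙ g x y) (conj-⁻¹ g x)) ⟩
      conj g x ∙ conj g y ∙ conj g x ⁻¹ ∙ conj g y ⁻¹      ∎)

  powers-conj : ∀ p {S} → ConjClosed S → ConjClosed (Powers p S)
  powers-conj p cl g (x , x∈S , z≈) =
    conj g x , cl g x∈S , trans (conj-cong g z≈) (conj-× g p x)

  ∪-conj : ∀ {S T} → ConjClosed S → ConjClosed T → ConjClosed (S ∪ T)
  ∪-conj clS clT g (inj₁ x∈S) = inj₁ (clS g x∈S)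
  ∪-conj clS clT g (inj₂ x∈T) = inj₂ (clT g x∈T)

  ⟨⟩-isSubgroup : ∀ S → IsSubgroup ⟨ S ⟩
  ⟨⟩-isSubgroup S = record { resp = gen-resp ; ε∈ = gen-ε ; ∙∈ = gen-∙ ; ⁻¹∈ = gen-⁻¹ }

  ⟨⟩-conj : ∀ {S} → ConjClosed S → ConjClosed ⟨ S ⟩
  ⟨⟩-conj cl g (gen x∈S)        = gen (cl g x∈S)
  ⟨⟩-conj cl g (gen-resp eq x∈) = gen-resp (conj-cong g eq) (⟨⟩-conj cl g x∈)
  ⟨⟩-conj cl g gen-ε            = gen-resp (sym (conj-ε g)) gen-ε
  ⟨⟩-conj cl g (gen-∙ x∈ y∈)    =
    gen-resp (sym (conj-∙ g _ _)) (gen-∙ (⟨⟩-conj cl g x∈) (⟨⟩-conj cl g y∈))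
  ⟨⟩-conj cl g (gen-⁻¹ x∈)      = gen-resp (sym (conj-⁻¹ g _)) (gen-⁻¹ (⟨⟩-conj cl g x∈))

  ⟨⟩-isNormal : ∀ {S} → ConjClosed S → IsNormalSubgroup ⟨ S ⟩
  ⟨⟩-isNormal cl = record { isSubgroup = ⟨⟩-isSubgroup _ ; conj∈ = ⟨⟩-conj cl }

  U-isNormal : IsNormalSubgroup U
  U-isNormal = record
    { isSubgroup = record { resp = λ _ _ → tt ; ε∈ = tt ; ∙∈ = λ _ _ → tt ; ⁻¹∈ = λ _ → tt }
    ; conj∈ = λ _ _ → tt
    }

  trivial-isNormal : IsNormalSubgroup (_≈ ε)
  trivial-isNormal = record
    { isSubgroup = record
      { resp = λ x≈y x≈ε → trans (sym x≈y) x≈ε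
      ; ε∈   = refl
      ; ∙∈   = λ x≈ε y≈ε → trans (∙-cong x≈ε y≈ε) (identityˡ ε)
      ; ⁻¹∈  = λ x≈ε → trans (⁻¹-cong x≈ε) ε⁻¹≈ε
      }
    ; conj∈ = λ g x≈ε → trans (conj-cong g x≈ε) (conj-ε g)
    }

  -- The product of two normal subgroups.
  _·_ : Pred Carrier 0ℓ → Pred Carrier 0ℓ → Pred Carrier 0ℓ
  (M · N) x = Σ[ y ∈ Carrier ] (y ∈ M ∧ (x // y) ∈ N)

  ·-isNormal : ∀ {M N} → IsNormalSubgroup M → IsNormalSubgroup N → IsNormalSubgroup (M · N)
  ·-isNormal {M} {N} nM nN = record
    { isSubgroup = record
      { resp = λ x≈x' (y , y∈ , q∈) → y , y∈ , N.resp (∙-congʳ x≈x') q∈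
      ; ε∈   = ε , M.ε∈ , N.resp (sym (inverseʳ ε)) N.ε∈
      ; ∙∈   = λ {x} {x'} (y , y∈ , q∈) (y' , y'∈ , q'∈) →
                 y ∙ y' , M.∙∈ y∈ y'∈ ,
                 N.resp (//-product x y x' y') (N.∙∈ q∈ (N.conj∈ y q'∈))
      ; ⁻¹∈  = λ {x} (y , y∈ , q∈) →
                 y ⁻¹ , M.⁻¹∈ y∈ , N.resp (//-inverse x y) (N.conj∈ (y ⁻¹) (N.⁻¹∈ q∈))
      }
    ; conj∈ = λ g {x} (y , y∈ , q∈) →
        conj g y , M.conj∈ g y∈ ,
        N.resp (trans (conj-∙ g x (y ⁻¹)) (∙-congˡ (conj-⁻¹ g y))) (N.conj∈ g q∈)
    }
    where
    module M = IsNormalSubgroup nM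
    module N = IsNormalSubgroup nN

  Quotient : (N : Pred Carrier 0ℓ) → IsNormalSubgroup N → Grp
  Quotient N nN = record
    { Carrier = Carrier
    ; _≈_     = λ x y → (x // y) ∈ N
    ; _∙_     = _∙_
    ; ε       = ε
    ; _⁻¹     = _⁻¹
    ; isGroup = record
      { isMonoid = record
        { isSemigroup = record
          { isMagma = record
            { isEquivalence = record
              { refl  = embed refl
              ; sym   = λ {x} {y} q → N.resp (⁻¹-anti-homo-// x y) (N.⁻¹∈ q)
              ; trans = λ {x} {y} {z} q r → N.resp (transitive x y z) (N.∙∈ q r)
              }
            ; ∙-cong = λ {x} {y} {x'} {y'} q q' →
                N.resp (//-product x y x' y') (N.∙∈ q (N.conj∈ y q'))
            }
          ; assoc = λ x y z → embed (assoc x y z)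
          }
        ; identity = (λ x → embed (identityˡ x)) , (λ x → embed (identityʳ x))
        }
      ; inverse = (λ x → embed (inverseˡ x)) , (λ x → embed (inverseʳ x))
      ; ⁻¹-cong = λ {x} {y} q → N.resp (//-inverse x y) (N.conj∈ (y ⁻¹) (N.⁻¹∈ q))
      }
    }
    where
    module N = IsNormalSubgroup nN

    embed : ∀ {x y} → x ≈ y → (x // y) ∈ N
    embed x≈y = N.resp (sym (x≈y⇒x∙y⁻¹≈ε x≈y)) N.ε∈

    transitive : ∀ x y z → (x // y) ∙ (y // z) ≈ x // z
    transitive x y z = begin
      (x // y) ∙ (y // z)   ≈⟨ assoc (x // y) y (z ⁻¹) ⟨
      (x // y) ∙ y ∙ z ⁻¹   ≈⟨ ∙-congʳ (//-rightDividesˡ y x) ⟩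
      x // z                ∎

abelian-isNormal : (A : AbelianGroup 0ℓ 0ℓ) → let G = AbelianGroup.group A in
  ∀ {N} → IsSubgroup G N → IsNormalSubgroup G N
abelian-isNormal A sub = record
  { isSubgroup = sub
  ; conj∈      = λ g {x} → IsSubgroup.resp sub (sym (begin
      g ∙ x ∙ g ⁻¹   ≈⟨ ∙-congʳ (comm g x) ⟩
      x ∙ g ∙ g ⁻¹   ≈⟨ //-rightDividesʳ g x ⟩
      x              ∎))
  }
  where
  open AbelianGroup A
  open GroupProperties group
  open SetoidReasoning setoid

abelianQuotient : (A : AbelianGroup 0ℓ 0ℓ) → ∀ {N} → IsSubgroup (AbelianGroup.group A) N →
                  AbelianGroup 0ℓ 0ℓ
abelianQuotient A {N} sub = record
  { isAbelianGroup = record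
    { isGroup = Group.isGroup (Quotient group N (abelian-isNormal A sub))
    ; comm    = λ x y → resp (sym (x≈y⇒x∙y⁻¹≈ε (comm x y))) ε∈
    }
  }
  where
  open AbelianGroup A
  open GroupProperties group
  open IsSubgroup sub

-- A topological group presented by a filter basis of open normal subgroups
-- at the identity.
record TopGroup : Set₁ where
  field
    group        : Grp
    Index        : Set
    index        : Index
    basis        : Index → Pred (Group.Carrier group) 0ℓ
    basis-normal : ∀ i → IsNormalSubgroup group (basis i)
    directed     : ∀ i j → Σ[ k ∈ Index ] (basis k ⊆ basis i ∧ basis k ⊆ basis j)

  open Group group public

  Closure : Pred Carrier 0ℓ → Pred Carrier 0ℓ
  Closure S x = ∀ i → x ∈ _·_ group S (basis i)

  Closure-isNormal : ∀ {S} → IsNormalSubgroup group S → IsNormalSubgroup group (Closure S)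
  Closure-isNormal nS = record
    { isSubgroup = record
      { resp = λ x≈y x∈ i → B.resp i x≈y (x∈ i)
      ; ε∈   = λ i → B.ε∈ i
      ; ∙∈   = λ x∈ y∈ i → B.∙∈ i (x∈ i) (y∈ i)
      ; ⁻¹∈  = λ x∈ i → B.⁻¹∈ i (x∈ i)
      }
    ; conj∈ = λ g x∈ i → B.conj∈ i g (x∈ i)
    }
    where module B i = IsNormalSubgroup (·-isNormal group nS (basis-normal i))

  ⊆Closure : ∀ {S} → S ⊆ Closure S
  ⊆Closure {_} {x} x∈S i = x , x∈S , resp (sym (inverseʳ x)) ε∈
    where open IsNormalSubgroup (basis-normal i) using (resp; ε∈)

discrete : Grp → TopGroup
discrete G = record
  { group        = G
  ; Index        = ⊤
  ; index        = tt
  ; basis        = λ _ → _≈ ε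
  ; basis-normal = λ _ → trivial-isNormal G
  ; directed     = λ _ _ → tt , (λ x → x) , (λ x → x)
  }
  where open Group G

record IsContinuousHom (T V : TopGroup) (f : TopGroup.Carrier T → TopGroup.Carrier V) : Set where
  field
    isGroupHomomorphism : IsGroupHomomorphism (TopGroup.rawGroup T) (TopGroup.rawGroup V) f
    continuous          : ∀ j → Σ[ i ∈ TopGroup.Index T ]
                            (∀ {x} → x ∈ TopGroup.basis T i → f x ∈ TopGroup.basis V j)

-- The inverse limit of its quotients by the basic open subgroups, all of
-- which are finite p-groups.
record IsProP (p : ℕ) (T : TopGroup) : Set where
  open TopGroup T
  field
    finite    : ∀ i → Finite (Group.setoid (Quotient group (basis i) (basis-normal i)))
    p-power   : ∀ i → ∃ λ k → size (finite i) ≡ p ^ k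
    separated : ∀ {x} → (∀ i → x ∈ basis i) → x ≈ ε
    complete  : (x : Index → Carrier) →
                (∀ i j → basis j ⊆ basis i → (x i // x j) ∈ basis i) →
                Σ[ y ∈ Carrier ] (∀ i → (x i // y) ∈ basis i)

-- The extension of φ is unique because the ι k generate a dense subgroup.
record IsFreeProP (p g : ℕ) (F : TopGroup) : Set₁ where
  open TopGroup F
  field
    isProP    : IsProP p F
    ι         : Fin g → Carrier
    generates : ∀ x → x ∈ Closure (⟨_⟩ group (Image group ι))
    extend    : (H : TopGroup) → IsProP p H → (φ : Fin g → TopGroup.Carrier H) →
                Σ[ f ∈ (Carrier → TopGroup.Carrier H) ]
                  (IsContinuousHom F H f ∧ (∀ k → TopGroup._≈_ H (f (ι k)) (φ k)))

P : (p : ℕ) (T : TopGroup) → ℕ → Pred (TopGroup.Carrier T) 0ℓ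
P p T zero    = U
P p T (suc n) = TopGroup.Closure T (⟨_⟩ G (CommutatorsWith G (P p T n) ∪ Powers G p (P p T n)))
  where G = TopGroup.group T

P-isNormal : ∀ p T n → IsNormalSubgroup (TopGroup.group T) (P p T n)
P-isNormal p T zero    = U-isNormal (TopGroup.group T)
P-isNormal p T (suc n) =
  TopGroup.Closure-isNormal T (⟨⟩-isNormal G (∪-conj G (commutators-conj G cl) (powers-conj G p cl)))
  where
  G  = TopGroup.group T
  cl = IsNormalSubgroup.conj∈ (P-isNormal p T n)

record HasPClass (p : ℕ) (T : TopGroup) (c : ℕ) : Set where
  open TopGroup T
  field
    trivial    : P p T c ⊆ (_≈ ε)
    nontrivial : ∀ {n} → n < c → ¬ (P p T n ⊆ (_≈ ε))

module _ (T : TopGroup) where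
  open TopGroup T
  open GroupProperties group
  open SetoidReasoning setoid

  Derived : Pred Carrier 0ℓ
  Derived = Closure (⟨_⟩ group (CommutatorsWith group U))

  Derived-isNormal : IsNormalSubgroup group Derived
  Derived-isNormal = Closure-isNormal (⟨⟩-isNormal group (commutators-conj group (λ _ _ → tt)))

  abGroup : AbelianGroup 0ℓ 0ℓ
  abGroup = record
    { isAbelianGroup = record
      { isGroup = Group.isGroup (Quotient group Derived Derived-isNormal)
      ; comm    = λ x y → ⊆Closure (gen (x , y , tt , (begin
          (x ∙ y) // (y ∙ x)      ≈⟨ ∙-congˡ (⁻¹-anti-homo-∙ y x) ⟩
          x ∙ y ∙ (x ⁻¹ ∙ y ⁻¹)   ≈⟨ assoc (x ∙ y) (x ⁻¹) (y ⁻¹) ⟨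
          x ∙ y ∙ x ⁻¹ ∙ y ⁻¹     ∎)))
      }
    }

  -- With the quotient topology.
  ab : TopGroup
  ab = record
    { group        = AbelianGroup.group abGroup
    ; Index        = Index
    ; index        = index
    ; basis        = λ i → _·_ group (basis i) Derived
    ; basis-normal = λ i → descend (·-isNormal group (basis-normal i) Derived-isNormal)
                                   (λ {x} x∈ → ε , IsNormalSubgroup.ε∈ (basis-normal i) , x∈)
    ; directed     = λ i j → let (k , k⊆i , k⊆j) = directed i j in
                       k , (λ (y , y∈ , q) → y , k⊆i y∈ , q) , (λ (y , y∈ , q) → y , k⊆j y∈ , q)
    }
    where
    descend : ∀ {N} → IsNormalSubgroup group N → (∀ {x} → (x // ε) ∈ Derived → x ∈ N) →
              IsNormalSubgroup (AbelianGroup.group abGroup) N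
    descend nN Derived⊆N = record
      { isSubgroup = record
        { resp = λ {x} {y} x≈y x∈ → N.resp (//-rightDividesˡ x y)
                   (N.∙∈ (Derived⊆N (D.resp (trans (⁻¹-anti-homo-// x y) (sym (trans (∙-congˡ ε⁻¹≈ε) (identityʳ _))))
                                            (D.⁻¹∈ x≈y))) x∈)
        ; ε∈   = N.ε∈
        ; ∙∈   = N.∙∈
        ; ⁻¹∈  = N.⁻¹∈
        }
      ; conj∈ = N.conj∈
      }
      where
      module N = IsNormalSubgroup nN
      module D = IsNormalSubgroup Derived-isNormal

-- F_c^ab = F^ab / P_c(F^ab).
abQuotient : (p : ℕ) (F : TopGroup) (c : ℕ) → AbelianGroup 0ℓ 0ℓ
abQuotient p F c =
  abelianQuotient (abGroup F) (IsNormalSubgroup.isSubgroup (P-isNormal p (ab F) c))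

ℤmod : ℕ → Grp
ℤmod m = AbelianGroup.group (abelianQuotient ℤ.+-0-abelianGroup {N = (+ m) ℤ.∣_} (record
  { resp = λ { ≡.refl m∣x → m∣x }
  ; ε∈   = ℤ.divides ℤ.0ℤ ≡.refl
  ; ∙∈   = ℤ.∣m∣n⇒∣m+n
  ; ⁻¹∈  = ℤ.∣m⇒∣-m
  }))

∏ : ∀ {r} → (Fin r → Grp) → Grp
∏ {r} H = record
  { Carrier = ∀ i → Carrier (H i)
  ; _≈_     = λ x y → ∀ i → _≈_ (H i) (x i) (y i)
  ; _∙_     = λ x y i → _∙_ (H i) (x i) (y i)
  ; ε       = λ i → ε (H i)
  ; _⁻¹     = λ x i → _⁻¹ (H i) (x i)
  ; isGroup = record
    { isMonoid = record
      { isSemigroup = record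
        { isMagma = record
          { isEquivalence = record
            { refl  = λ i → refl (H i)
            ; sym   = λ p i → sym (H i) (p i)
            ; trans = λ p q i → trans (H i) (p i) (q i)
            }
          ; ∙-cong = λ p q i → ∙-cong (H i) (p i) (q i)
          }
        ; assoc = λ x y z i → assoc (H i) (x i) (y i) (z i)
        }
      ; identity = (λ x i → identityˡ (H i) (x i)) , (λ x i → identityʳ (H i) (x i))
      }
    ; inverse = (λ x i → inverseˡ (H i) (x i)) , (λ x i → inverseʳ (H i) (x i))
    ; ⁻¹-cong = λ p i → ⁻¹-cong (H i) (p i)
    }
  }
  where open Group

-- ms lists the orders of the nontrivial cyclic factors.
record IsCyclicDecomposition (G : Grp) {r : ℕ} (ms : Vec ℕ r) : Set where
  field
    nontrivial : All (1 <_) ms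
    iso        : G ≅ ∏ (λ i → ℤmod (lookup ms i))

module _ (p g : ℕ) (F : TopGroup) (c : ℕ) where
  private
    A = abQuotient p F c
    module A = AbelianGroup A
    Φ = FrattiniSetoid A.group
    module Φ = Setoid Φ

  Presents : (Fin (suc g) → A.Carrier) → Grp → Set
  Presents t G =
    AbelianGroup.group (abelianQuotient A (⟨⟩-isSubgroup A.group (Image A.group t))) ≅ G

  Presentations : Grp → Setoid (Level.suc 0ℓ) 0ℓ
  Presentations G = record
    { Carrier       = Σ[ v ∈ (Fin (suc g) → Φ.Carrier) ] Presents (λ k → proj₁ (v k)) G
    ; _≈_           = λ v w → ∀ k → proj₁ v k Φ.≈ proj₁ w k
    ; isEquivalence = record
      { refl  = λ {v} k → Φ.refl {proj₁ v k}
      ; sym   = λ {v} {w} v≈w k → Φ.sym {proj₁ v k} {proj₁ w k} (v≈w k)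
      ; trans = λ {v} {w} {z} v≈w w≈z k →
                  Φ.trans {proj₁ v k} {proj₁ w k} {proj₁ z k} (v≈w k) (w≈z k)
      }
    }

  record HasMeas (G : Grp) (μ : ℚ) : Set₁ where
    field
      presentations : Finite (Presentations G)
      frattini      : Finite Φ

    private
      instance
        Φ-nonZero : NonZero (size frattini)
        Φ-nonZero = size-nonZero frattini (A.ε , ε∈Frattini A.group)

        Φ^-nonZero : NonZero (size frattini ^ suc g)
        Φ^-nonZero = m^n≢0 (size frattini) (suc g)

    field
      ratio : μ ≡ + size presentations / (size frattini ^ suc g)

∏[_⋯_] : ℕ → ℕ → (ℕ → ℚ) → ℚ
∏[ lo ⋯ hi ] f = foldr _*_ 1ℚ (map (λ i → f (lo ℕ.+ i)) (upTo (suc hi ∸ lo)))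

1-p^- : ∀ {p} → Prime p → ℕ → ℚ
1-p^- {p} pr k = 1ℚ - (+ 1 / (p ^ k))
  where instance
    p-nonZero : NonZero p
    p-nonZero = prime⇒nonZero pr

    p^k-nonZero : NonZero (p ^ k)
    p^k-nonZero = m^n≢0 p k

1/∣Aut∣∣G∣ : (G : Grp) → Finite (Aut G) → Finite (Group.setoid G) → ℚ
1/∣Aut∣∣G∣ G finAut finG = + 1 / (size finAut ℕ.* size finG)
  where instance
    aut-nonZero : NonZero (size finAut)
    aut-nonZero = size-nonZero finAut (idAut G)

    G-nonZero : NonZero (size finG)
    G-nonZero = size-nonZero finG (Group.ε G)

    product-nonZero : NonZero (size finAut ℕ.* size finG)
    product-nonZero = m*n≢0 (size finAut) (size finG)

-- Let 𝔸 = F^ab / P_c'(F^ab) ≅ (ℤ/p^c')^g, and let φ_y : 𝔸 → G send the basis to y ∈ G^g.  Counting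
-- the pairs (t, y) such that y generates G and ⟨t⟩ = ker φ_y in two ways gives
--   #{t presenting G} · |Aut G| = Σ_{y generating G} #{t ∈ 𝔸^(g+1) generating ker φ_y}.
-- By Nakayama's lemma, a tuple generates a finite abelian p-group H iff it does so modulo pH, hence
-- H has |pH|^n ∏_{i<d} (p^n - p^i) generating n-tuples, where p^d = |H/pH| = |H[p]|.  For H = G one
-- has d = g.  For H = ker φ_y the exact sequence 0 → H[p] → 𝔸[p] → p^(c'-1) G → 0 shows that
-- |H[p]| = p^g / |p^(c'-1) G|, so that d = u if c' = c and d = g if c' > c.  Moreover ker φ_y is
-- contained in p𝔸 = Φ(𝔸), because 𝔸/p𝔸 and G/pG have the same order.

module Submission where

open import Defs
open import Algebra.Bundles using (Group; AbelianGroup)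
open import Algebra.Morphism.Structures using (IsGroupHomomorphism; IsGroupIsomorphism)
import Algebra.Properties.AbelianGroup as AbelianGroupProperties
import Algebra.Properties.CommutativeMonoid.Mult as Mult
import Algebra.Properties.CommutativeMonoid.Sum as Sum
import Algebra.Properties.Group as GroupProperties
import Algebra.Properties.Monoid.Mult as MonoidMult
open import Data.Bool.Base as Bool using (if_then_else_)
open import Data.Fin.Base as Fin using (Fin; zero; suc; toℕ; fromℕ<)
import Data.Fin.Properties as Fin
open import Data.Integer.Base as ℤ using (ℤ; +_; 0ℤ; 1ℤ)
import Data.Integer.DivMod as ℤ
import Data.Integer.Divisibility.Signed as ℤ
import Data.Integer.Properties as ℤ
open import Data.Integer.Tactic.RingSolver using () renaming (solve-∀ to solve-∀ℤ)
open import Data.List.Base as List using (List; []; _∷_; _++_; length; foldr; applyUpTo)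
open import Data.List.Properties using (map-applyUpTo)
open import Data.List.Relation.Unary.Any as Any using (Any; here; there)
open import Data.Nat.Base using (ℕ; zero; suc; pred; _+_; _*_; _∸_; _^_; _≤_; _<_; z≤n; s≤s; NonZero; >-nonZero; ≢-nonZero; ≢-nonZero⁻¹; nonTrivial⇒n>1)
open import Data.Nat.Coprimality using (Coprime; coprime-Bézout; coprime-divisor; prime⇒coprime)
open import Data.Nat.DivMod using (_%_; m≡m%n+[m/n]*n; m%n<n) renaming (_/_ to _/ℕ_)
open import Data.Nat.Divisibility as ℕ using (_∣_; divides; ∣⇒≤; ∣1⇒≡1)
open import Data.Nat.GCD as GCD using ()
open import Data.Nat.Primality using (Prime; prime⇒nonZero; prime⇒nonTrivial; prime⇒irreducible)
open import Data.Nat.Properties hiding (_≟_)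
open import Data.Nat.Tactic.RingSolver using (solve-∀)
open import Data.Product.Base using (Σ-syntax; ∃; _,_; proj₁; proj₂) renaming (_×_ to _∧_)
open import Data.Rational.Base using (ℚ; 1ℚ; _/_; _-_; toℚᵘ) renaming (_*_ to _*ℚ_)
import Data.Rational.Base as ℚ
import Data.Rational.Properties as ℚ
open import Data.Rational.Unnormalised.Base as ℚᵘ using (mkℚᵘ; *≡*)
import Data.Rational.Unnormalised.Properties as ℚᵘ
open import Data.Sum.Base using (_⊎_; inj₁; inj₂)
open import Data.Unit.Base using (⊤; tt)
open import Data.Vec.Base as Vec using (Vec; []; _∷_; lookup)
open import Data.Vec.Membership.Propositional.Properties using (∈-lookup)
open import Data.Vec.Relation.Unary.All as All using (All)
open import Function.Base using (_∘_; id; case_of_)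
open import Function.Bundles using (Inverse)
open import Level as Level using (Level; 0ℓ; _⊔_)
open import Relation.Binary.Bundles using (Setoid)
open import Relation.Binary.Core using (_Preserves_⟶_)
open import Relation.Binary.Definitions using (_Respects_; tri<; tri≈; tri>)
open import Relation.Binary.PropositionalEquality as ≡ using (_≡_; _≢_; cong; cong₂; subst; module ≡-Reasoning)
import Relation.Binary.Reasoning.Setoid as SetoidReasoning
open import Relation.Nullary.Decidable using (Dec; yes; no; does; map′; ¬?; _×-dec_; _→-dec_)
open import Relation.Nullary.Negation using (¬_; contradiction)
open import Relation.Unary using (Pred; _∈_; _⊆_)

open GCD.Bézout.Identity using (+-; -+)

-- The theorem asks for `Finite` data, so each counted set needs a list and decidable conditions;
-- sizes are sums of indicators `𝟙`, and double counting is an exchange of sums. The obstacle is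
-- `F`: it is known only by its universal property and has no decidable equality. Extending its
-- generators to a map into the discrete group (ℤ/p^c')^g provides coordinates. They become
-- injective on 𝔸 because the generators are dense and P_c' is closed, and only then is 𝔸
-- enumerable. The sequence for H[p] is exact on the right because 𝔸[p] = p^(c'-1) 𝔸. The sum over y
-- has equal terms: |H| = |𝔸| / |G| and |pH| = |H| / p^d hold for every epimorphism. The constants
-- of the formula: ∏_{i<d} (p^(g+1) - p^i) divided by p^((g+1)d) is the product of 1 - p^(-k) for
-- g+2-d ≤ k ≤ g+1. The count of t contributes |H|^(g+1), which is (|𝔸| / |G|)^(g+1), and the count
-- of y contributes |G|^g; this leaves 1/|G|, while p^(g(g+1)) is (|𝔸| / |Φ(𝔸)|)^(g+1).

private
  variable
    ℓᵃ ℓᵇ ℓ ℓ₁ ℓ₂ : Level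
    A B : Set ℓᵃ

-- Finite sums and counting

∑ : List A → (A → ℕ) → ℕ
∑ []       f = 0
∑ (x ∷ xs) f = f x + ∑ xs f

∑-cong : (xs : List A) {f g : A → ℕ} → (∀ x → f x ≡ g x) → ∑ xs f ≡ ∑ xs g
∑-cong []       eq = ≡.refl
∑-cong (x ∷ xs) eq = cong₂ _+_ (eq x) (∑-cong xs eq)

∑-zero : (xs : List A) → ∑ xs (λ _ → 0) ≡ 0
∑-zero []       = ≡.refl
∑-zero (x ∷ xs) = ∑-zero xs

+-interchange : ∀ k l m n → (k + l) + (m + n) ≡ (k + m) + (l + n)
+-interchange = solve-∀

∑-+ : (xs : List A) (f g : A → ℕ) → ∑ xs (λ x → f x + g x) ≡ ∑ xs f + ∑ xs g
∑-+ []       f g = ≡.refl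
∑-+ (x ∷ xs) f g = ≡.trans (cong (_+_ (f x + g x)) (∑-+ xs f g)) (+-interchange (f x) (g x) (∑ xs f) (∑ xs g))

∑-*ʳ : (xs : List A) (f : A → ℕ) (k : ℕ) → ∑ xs (λ x → f x * k) ≡ ∑ xs f * k
∑-*ʳ []       f k = ≡.refl
∑-*ʳ (x ∷ xs) f k = ≡.trans (cong (_+_ (f x * k)) (∑-*ʳ xs f k)) (≡.sym (*-distribʳ-+ k (f x) (∑ xs f)))

∑-swap : (xs : List A) (ys : List B) (f : A → B → ℕ) →
         ∑ xs (λ x → ∑ ys (f x)) ≡ ∑ ys (λ y → ∑ xs (λ x → f x y))
∑-swap []       ys f = ≡.sym (∑-zero ys)
∑-swap (x ∷ xs) ys f = ≡.trans (cong (_+_ (∑ ys (f x))) (∑-swap xs ys f)) (≡.sym (∑-+ ys (f x) _))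

∑-++ : (xs ys : List A) (f : A → ℕ) → ∑ (xs ++ ys) f ≡ ∑ xs f + ∑ ys f
∑-++ []       ys f = ≡.refl
∑-++ (x ∷ xs) ys f = ≡.trans (cong (_+_ (f x)) (∑-++ xs ys f)) (≡.sym (+-assoc (f x) _ _))

∑-map : (h : A → B) (xs : List A) (f : B → ℕ) → ∑ (List.map h xs) f ≡ ∑ xs (f ∘ h)
∑-map h []       f = ≡.refl
∑-map h (x ∷ xs) f = cong (_+_ (f (h x))) (∑-map h xs f)

∑-concatMap : (h : A → List B) (xs : List A) (f : B → ℕ) →
              ∑ (List.concatMap h xs) f ≡ ∑ xs (λ x → ∑ (h x) f)
∑-concatMap h []       f = ≡.refl
∑-concatMap h (x ∷ xs) f =
  ≡.trans (∑-++ (h x) (List.concatMap h xs) f) (cong (_+_ (∑ (h x) f)) (∑-concatMap h xs f))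

∑-length : (xs : List A) → ∑ xs (λ _ → 1) ≡ length xs
∑-length []       = ≡.refl
∑-length (x ∷ xs) = cong suc (∑-length xs)

𝟙 : {P : Set ℓ} → Dec P → ℕ
𝟙 (yes _) = 1
𝟙 (no  _) = 0

𝟙-cong : {P : Set ℓ₁} {Q : Set ℓ₂} → (P → Q) → (Q → P) → (p : Dec P) (q : Dec Q) → 𝟙 p ≡ 𝟙 q
𝟙-cong to from (yes p) (yes q) = ≡.refl
𝟙-cong to from (yes p) (no ¬q) = contradiction (to p) ¬q
𝟙-cong to from (no ¬p) (yes q) = contradiction (from q) ¬p
𝟙-cong to from (no ¬p) (no ¬q) = ≡.refl

𝟙-true : {P : Set ℓ} → P → (p : Dec P) → 𝟙 p ≡ 1
𝟙-true p (yes _) = ≡.refl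
𝟙-true p (no ¬p) = contradiction p ¬p

𝟙-false : {P : Set ℓ} → ¬ P → (p : Dec P) → 𝟙 p ≡ 0
𝟙-false ¬p (yes p) = contradiction p ¬p
𝟙-false ¬p (no _)  = ≡.refl

𝟙-*-cong : {P : Set ℓ} {m n : ℕ} → (P → m ≡ n) → (p : Dec P) → 𝟙 p * m ≡ 𝟙 p * n
𝟙-*-cong eq (yes p) = cong (1 *_) (eq p)
𝟙-*-cong eq (no _)  = ≡.refl

∑≢0⇒Any : {P : A → Set ℓ} (P? : ∀ x → Dec (P x)) (xs : List A) → ∑ xs (𝟙 ∘ P?) ≢ 0 → Any P xs
∑≢0⇒Any P? []       ≢0 = contradiction ≡.refl ≢0
∑≢0⇒Any P? (x ∷ xs) ≢0 with P? x
... | yes p = here p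
... | no _  = there (∑≢0⇒Any P? xs ≢0)

∑≡0⇒¬Any : {P : A → Set ℓ} (P? : ∀ x → Dec (P x)) (xs : List A) → ∑ xs (𝟙 ∘ P?) ≡ 0 → ¬ Any P xs
∑≡0⇒¬Any P? (x ∷ xs) eq any with P? x
∑≡0⇒¬Any P? (x ∷ xs) eq (here p)    | no ¬p = ¬p p
∑≡0⇒¬Any P? (x ∷ xs) eq (there any) | no _  = ∑≡0⇒¬Any P? xs eq any

-- Enumerated setoids and their cardinalities

record Enum (S : Setoid ℓᵃ ℓ) : Set (ℓᵃ ⊔ ℓ) where
  open Setoid S renaming (refl to ≈-refl; sym to ≈-sym; trans to ≈-trans; isEquivalence to ≈-isEquivalence)
  infix 4 _≟_
  field
    elems : List Carrier
    _≟_   : ∀ x y → Dec (x ≈ y)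
    -- A single equation expresses both that every class is listed and that none is listed twice, in
    -- a form that can be inserted into a sum.
    once  : ∀ s → ∑ elems (λ x → 𝟙 (x ≟ s)) ≡ 1

  card : ℕ
  card = length elems

  count : {P : Carrier → Set ℓ₁} → (∀ x → Dec (P x)) → ℕ
  count P? = ∑ elems (𝟙 ∘ P?)

  found : ∀ s → Any (_≈ s) elems
  found s = ∑≢0⇒Any (_≟ s) elems λ eq → case ≡.trans (≡.sym (once s)) eq of λ ()

  witness : {P : Carrier → Set ℓ₁} → P Respects _≈_ → ∃ P → Any P elems
  witness resp (s , p) = Any.map (λ x≈s → resp (≈-sym x≈s) p) (found s)

  any? : {P : Carrier → Set ℓ₁} → P Respects _≈_ → (∀ x → Dec (P x)) → Dec (∃ P)
  any? resp P? = map′ Any.satisfied (witness resp) (Any.any? P? elems)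

  all? : {P : Carrier → Set ℓ₁} → P Respects _≈_ → (∀ x → Dec (P x)) → Dec (∀ x → P x)
  all? resp P? with any? (λ x≈y ¬p p → ¬p (resp (≈-sym x≈y) p)) (¬? ∘ P?)
  ... | yes (x , ¬p) = no λ all → ¬p (all x)
  ... | no ¬any      = yes λ x → case P? x of λ
    { (yes p) → p
    ; (no ¬p) → contradiction (x , ¬p) ¬any
    }

  count-unique : {P : Carrier → Set ℓ₁} → P Respects _≈_ → (P? : ∀ x → Dec (P x)) →
                 ∀ s → P s → (∀ {x} → P x → x ≈ s) → count P? ≡ 1
  count-unique resp P? s p uniq =
    ≡.trans (∑-cong elems (λ x → 𝟙-cong uniq (λ x≈s → resp (≈-sym x≈s) p) (P? x) (x ≟ s))) (once s)

  count-cong : {P : Carrier → Set ℓ₁} {Q : Carrier → Set ℓ₂} →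
               (∀ {x} → P x → Q x) → (∀ {x} → Q x → P x) →
               (P? : ∀ x → Dec (P x)) (Q? : ∀ x → Dec (Q x)) → count P? ≡ count Q?
  count-cong to from P? Q? = ∑-cong elems (λ x → 𝟙-cong to from (P? x) (Q? x))

  count-none : {P : Carrier → Set ℓ₁} → (P? : ∀ x → Dec (P x)) → (∀ {x} → ¬ P x) → count P? ≡ 0
  count-none P? none = ≡.trans (∑-cong elems (λ x → 𝟙-false none (P? x))) (∑-zero elems)

  count-all : {P : Carrier → Set ℓ₁} → (P? : ∀ x → Dec (P x)) → (∀ x → P x) → count P? ≡ card
  count-all P? all = ≡.trans (∑-cong elems (λ x → 𝟙-true (all x) (P? x))) (∑-length elems)

  count≢0 : {P : Carrier → Set ℓ₁} → P Respects _≈_ → (P? : ∀ x → Dec (P x)) → ∃ P → count P? ≢ 0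
  count≢0 resp P? p eq = ∑≡0⇒¬Any P? elems eq (witness resp p)

  count-⊆ : {P : Carrier → Set ℓ₁} {Q : Carrier → Set ℓ₂} → (∀ {x} → P x → Q x) →
            (P? : ∀ x → Dec (P x)) (Q? : ∀ x → Dec (Q x)) →
            count Q? ≡ count P? + count (λ x → Q? x ×-dec ¬? (P? x))
  count-⊆ P⊆Q P? Q? = ≡.trans (∑-cong elems split) (∑-+ elems _ _)
    where
    split : ∀ x → 𝟙 (Q? x) ≡ 𝟙 (P? x) + 𝟙 (Q? x ×-dec ¬? (P? x))
    split x with P? x | Q? x
    ... | yes p | yes q = ≡.refl
    ... | yes p | no ¬q = contradiction (P⊆Q p) ¬q
    ... | no ¬p | yes q = ≡.refl
    ... | no ¬p | no ¬q = ≡.refl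

  count-≤ : {P : Carrier → Set ℓ₁} {Q : Carrier → Set ℓ₂} → (∀ {x} → P x → Q x) →
            (P? : ∀ x → Dec (P x)) (Q? : ∀ x → Dec (Q x)) → count P? ≤ count Q?
  count-≤ P⊆Q P? Q? = ≤-trans (m≤m+n (count P?) _) (≤-reflexive (≡.sym (count-⊆ P⊆Q P? Q?)))

  ⊆∧count≡⇒⊇ : {P : Carrier → Set ℓ₁} {Q : Carrier → Set ℓ₂} → P Respects _≈_ → Q Respects _≈_ →
               (∀ {x} → P x → Q x) →
               (P? : ∀ x → Dec (P x)) (Q? : ∀ x → Dec (Q x)) → count P? ≡ count Q? →
               ∀ {x} → Q x → P x
  ⊆∧count≡⇒⊇ {P = P} {Q = Q} respP respQ P⊆Q P? Q? eq {x} q with P? x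
  ... | yes p = p
  ... | no ¬p = contradiction none (count≢0 resp Q∖P? (x , q , ¬p))
    where
    Q∖P? : ∀ y → Dec (Q y ∧ ¬ P y)
    Q∖P? y = Q? y ×-dec ¬? (P? y)
    resp : (λ y → Q y ∧ ¬ P y) Respects _≈_
    resp y≈z (qy , ¬py) = respQ y≈z qy , λ pz → ¬py (respP (≈-sym y≈z) pz)
    none : count Q∖P? ≡ 0
    none = +-cancelˡ-≡ (count P?) _ _
      (≡.trans (≡.sym (count-⊆ P⊆Q P? Q?)) (≡.trans (≡.sym eq) (≡.sym (+-identityʳ _))))

  ∑-delta : (f : Carrier → ℕ) → f Preserves _≈_ ⟶ _≡_ → ∀ s → ∑ elems (λ x → 𝟙 (x ≟ s) * f x) ≡ f s
  ∑-delta f f-cong s = begin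
    ∑ elems (λ x → 𝟙 (x ≟ s) * f x) ≡⟨ ∑-cong elems (λ x → 𝟙-*-cong f-cong (x ≟ s)) ⟩
    ∑ elems (λ x → 𝟙 (x ≟ s) * f s) ≡⟨ ∑-*ʳ elems _ (f s) ⟩
    ∑ elems (λ x → 𝟙 (x ≟ s)) * f s ≡⟨ cong (_* f s) (once s) ⟩
    1 * f s                         ≡⟨ *-identityˡ (f s) ⟩
    f s                             ∎
    where open ≡-Reasoning

module _ {S : Setoid ℓᵃ ℓ} {T : Setoid ℓᵇ ℓ₁} (ES : Enum S) (ET : Enum T) where
  private
    module S = Setoid S
    module T = Setoid T
    module ES = Enum ES
    module ET = Enum ET
  open ≡-Reasoning

  -- Expanding f (h t) by `∑-delta` and exchanging the sums leaves the number of t with s ≈ h t as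
  -- the weight of f s. Bijectivity of `h` is therefore phrased as this number being 1.
  ∑-reindex : (h : T.Carrier → S.Carrier) → (∀ s → ET.count (λ t → s ES.≟ h t) ≡ 1) →
              (f : S.Carrier → ℕ) → f Preserves S._≈_ ⟶ _≡_ →
              ∑ ET.elems (f ∘ h) ≡ ∑ ES.elems f
  ∑-reindex h h-bij f f-cong = begin
    ∑ ET.elems (f ∘ h)
      ≡⟨ ∑-cong ET.elems (λ t → ≡.sym (ES.∑-delta f f-cong (h t))) ⟩
    ∑ ET.elems (λ t → ∑ ES.elems (λ s → 𝟙 (s ES.≟ h t) * f s))
      ≡⟨ ∑-swap ET.elems ES.elems _ ⟩
    ∑ ES.elems (λ s → ∑ ET.elems (λ t → 𝟙 (s ES.≟ h t) * f s))
      ≡⟨ ∑-cong ES.elems (λ s → ∑-*ʳ ET.elems _ (f s)) ⟩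
    ∑ ES.elems (λ s → ∑ ET.elems (λ t → 𝟙 (s ES.≟ h t)) * f s)
      ≡⟨ ∑-cong ES.elems (λ s → ≡.trans (cong (_* f s) (h-bij s)) (*-identityˡ (f s))) ⟩
    ∑ ES.elems f ∎

  -- Double count of the pairs with h t ≈ s: each s in `P` has exactly one t, each t exactly one s.
  -- Cardinalities of concrete sets are obtained from it by exhibiting a parametrisation `h`.
  count-image : (h : T.Carrier → S.Carrier) → h Preserves T._≈_ ⟶ S._≈_ →
                (∀ {t u} → h t S.≈ h u → t T.≈ u) →
                {P : S.Carrier → Set ℓ₂} (P? : ∀ s → Dec (P s)) → P Respects S._≈_ →
                (∀ {s} → P s → ∃ λ t → h t S.≈ s) → (∀ t → P (h t)) →
                ES.count P? ≡ ET.card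
  count-image h h-cong h-inj P? resp onto into = begin
    ES.count P?
      ≡⟨ ∑-cong ES.elems fiber ⟩
    ∑ ES.elems (λ s → ∑ ET.elems (λ t → 𝟙 (h t ES.≟ s)))
      ≡⟨ ∑-swap ES.elems ET.elems _ ⟩
    ∑ ET.elems (λ t → ∑ ES.elems (λ s → 𝟙 (h t ES.≟ s)))
      ≡⟨ ∑-cong ET.elems (λ t → ES.count-unique (λ x≈y ht≈x → S.trans ht≈x x≈y) (h t ES.≟_) (h t) S.refl S.sym) ⟩
    ∑ ET.elems (λ _ → 1)
      ≡⟨ ∑-length ET.elems ⟩
    ET.card ∎
    where
    fiber : ∀ s → 𝟙 (P? s) ≡ ET.count (λ t → h t ES.≟ s)
    fiber s with P? s
    ... | yes p = let (t , ht≈s) = onto p in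
      ≡.sym (ET.count-unique (λ t≈u ht → S.trans (S.sym (h-cong t≈u)) ht) (λ t → h t ES.≟ s) t ht≈s
             (λ hu≈s → h-inj (S.trans hu≈s (S.sym ht≈s))))
    ... | no ¬p = ≡.sym (ET.count-none (λ t → h t ES.≟ s) (λ {t} ht≈s → ¬p (resp ht≈s (into t))))

enumFin : ∀ n → Enum (≡.setoid (Fin n))
enumFin n = record { elems = fins n ; _≟_ = Fin._≟_ ; once = once n }
  where
  fins : ∀ n → List (Fin n)
  fins zero    = []
  fins (suc n) = zero ∷ List.map suc (fins n)

  once : ∀ n (s : Fin n) → ∑ (fins n) (λ x → 𝟙 (x Fin.≟ s)) ≡ 1
  once (suc n) zero    = cong suc (≡.trans (∑-map suc (fins n) _) (∑-zero (fins n)))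
  once (suc n) (suc s) = ≡.trans (∑-map suc (fins n) _)
    (≡.trans (∑-cong (fins n) (λ x → 𝟙-cong Fin.suc-injective (cong suc) (suc x Fin.≟ suc s) (x Fin.≟ s)))
           (once n s))

card-enumFin : ∀ n → Enum.card (enumFin n) ≡ n
card-enumFin zero    = ≡.refl
card-enumFin (suc n) = cong suc (≡.trans (lemma (Enum.elems (enumFin n))) (card-enumFin n))
  where
  lemma : (xs : List (Fin n)) → length (List.map Fin.suc xs) ≡ length xs
  lemma []       = ≡.refl
  lemma (x ∷ xs) = cong suc (lemma xs)

module _ {S : Setoid ℓᵃ ℓ} (ES : Enum S) where
  private
    module S = Setoid S
    module ES = Enum ES

    Index : List S.Carrier → S.Carrier → Set _
    Index xs s = Σ[ i ∈ Fin (length xs) ] (List.lookup xs i S.≈ s ∧ (∀ j → List.lookup xs j S.≈ s → j ≡ i))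

    absent : ∀ xs s → ∑ xs (λ x → 𝟙 (x ES.≟ s)) ≡ 0 → ∀ j → ¬ (List.lookup xs j S.≈ s)
    absent xs s eq j x≈s = ∑≡0⇒¬Any (ES._≟ s) xs eq (lookup⇒Any xs j x≈s)
      where
      lookup⇒Any : ∀ xs j → List.lookup xs j S.≈ s → Any (S._≈ s) xs
      lookup⇒Any (x ∷ xs) zero    x≈s = here x≈s
      lookup⇒Any (x ∷ xs) (suc j) x≈s = there (lookup⇒Any xs j x≈s)

    locate : ∀ xs s → ∑ xs (λ x → 𝟙 (x ES.≟ s)) ≡ 1 → Index xs s
    locate (x ∷ xs) s eq with x ES.≟ s
    ... | yes x≈s = zero , x≈s , λ
      { zero    _   → ≡.refl
      ; (suc j) j≈s → contradiction j≈s (absent xs s (suc-injective eq) j)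
      }
    ... | no x≉s = let (i , i≈s , uniq) = locate xs s eq in suc i , i≈s , λ
      { zero    x≈s → contradiction x≈s x≉s
      ; (suc j) j≈s → cong suc (uniq j j≈s)
      }

    index : ∀ s → Index ES.elems s
    index s = locate ES.elems s (ES.once s)

  finiteEnum : Finite S
  finiteEnum = record
    { size = ES.card
    ; enum = record
      { to        = List.lookup ES.elems
      ; from      = proj₁ ∘ index
      ; to-cong   = λ { ≡.refl → S.refl }
      ; from-cong = λ {x} {y} x≈y →
          proj₂ (proj₂ (index y)) _ (S.trans (proj₁ (proj₂ (index x))) x≈y)
      ; inverse   = (λ { {x} ≡.refl → proj₁ (proj₂ (index x)) })
                  , (λ {i} {x} x≈i → ≡.sym (proj₂ (proj₂ (index x)) i (S.sym x≈i)))
      }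
    }

module _ {S : Setoid ℓᵃ ℓ} (ES : Enum S) (X : Setoid ℓᵇ ℓ₁) where
  private
    module S = Setoid S
    module X = Setoid X
    module ES = Enum ES

  -- `X` is identified with the part `P` of an enumerated setoid by the embedding `from`, through
  -- which its equality is decided. The levels are independent because elements of `FrattiniSetoid`
  -- and `Presentations` carry proofs about all maximal subgroups and live one universe higher.
  module Subset {P : S.Carrier → Set ℓ₂} (P? : ∀ s → Dec (P s)) (P-resp : P Respects S._≈_)
    (to : ∀ s → P s → X.Carrier) (from : X.Carrier → S.Carrier) (from-P : ∀ x → P (from x))
    (from-cong : ∀ {x y} → x X.≈ y → from x S.≈ from y)
    (from-inj : ∀ {x y} → from x S.≈ from y → x X.≈ y)
    (from-to : ∀ s p → from (to s p) S.≈ s)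
    where

    private
      list : List S.Carrier → List X.Carrier
      list []       = []
      list (s ∷ ss) with P? s
      ... | yes p = to s p ∷ list ss
      ... | no _  = list ss

      _≟_ : ∀ x y → Dec (x X.≈ y)
      x ≟ y = map′ from-inj from-cong (from x ES.≟ from y)

      ∑-list : ∀ ss x → ∑ (list ss) (λ y → 𝟙 (y ≟ x)) ≡ ∑ ss (λ s → 𝟙 (s ES.≟ from x))
      ∑-list []       x = ≡.refl
      ∑-list (s ∷ ss) x with P? s
      ... | yes p = cong₂ _+_
        (𝟙-cong (λ y≈x → S.trans (S.sym (from-to s p)) (from-cong y≈x))
                (λ s≈x → from-inj (S.trans (from-to s p) s≈x)) (to s p ≟ x) (s ES.≟ from x))
        (∑-list ss x)
      ... | no ¬p = ≡.trans (∑-list ss x)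
        (cong (_+ _) (≡.sym (𝟙-false (λ s≈x → ¬p (P-resp (S.sym s≈x) (from-P x))) (s ES.≟ from x))))

      length-list : ∀ ss → length (list ss) ≡ ∑ ss (𝟙 ∘ P?)
      length-list []       = ≡.refl
      length-list (s ∷ ss) with P? s
      ... | yes p = cong suc (length-list ss)
      ... | no ¬p = length-list ss

    enum : Enum X
    enum = record
      { elems = list ES.elems
      ; _≟_   = _≟_
      ; once  = λ x → ≡.trans (∑-list ES.elems x) (ES.once (from x))
      }

    card-enum : Enum.card enum ≡ ES.count P?
    card-enum = length-list ES.elems

    abstract
      finite : Finite X
      finite = finiteEnum enum

      size-finite : size finite ≡ ES.count P?
      size-finite = card-enum

module _ {S : Setoid ℓᵃ ℓ} (fin : Finite S) where
  private
    module S = Setoid S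
    open Inverse (Finite.enum fin)

    to-injective : ∀ {x y} → from x ≡ from y → x S.≈ y
    to-injective {x} {y} eq = S.trans (S.sym (strictlyInverseˡ x)) (S.trans (to-cong eq) (strictlyInverseˡ y))

    module Sub = Subset (enumFin (size fin)) S {P = λ i → from (to i) ≡ i}
      (λ i → yes (strictlyInverseʳ i)) (λ {_} {j} _ _ → strictlyInverseʳ j)
      (λ i _ → to i) from (λ x → strictlyInverseʳ (from x)) from-cong to-injective
      (λ i _ → strictlyInverseʳ i)

  enumFinite : Enum S
  enumFinite = Sub.enum

  card-enumFinite : Enum.card enumFinite ≡ size fin
  card-enumFinite = ≡.trans Sub.card-enum
    (≡.trans (Enum.count-all (enumFin (size fin)) (λ i → yes (strictlyInverseʳ i)) strictlyInverseʳ) (card-enumFin (size fin)))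

-- Finite products of enumerated setoids

Π : ∀ {n} → (Fin n → Setoid ℓᵃ ℓ) → Setoid ℓᵃ ℓ
Π S = record
  { Carrier       = ∀ i → Setoid.Carrier (S i)
  ; _≈_           = λ x y → ∀ i → Setoid._≈_ (S i) (x i) (y i)
  ; isEquivalence = record
    { refl  = λ i → Setoid.refl (S i)
    ; sym   = λ p i → Setoid.sym (S i) (p i)
    ; trans = λ p q i → Setoid.trans (S i) (p i) (q i)
    }
  }

module _ {n} (S : Fin (suc n) → Setoid ℓᵃ ℓ)
         (E₀ : Enum (S zero)) (E₊ : Enum (Π (S ∘ suc))) where
  private
    module S i = Setoid (S i)
    module E₀ = Enum E₀
    module E₊ = Enum E₊

    list : List (∀ i → S.Carrier i)
    list = List.concatMap (λ x → List.map (Fin.∀-cons x) E₊.elems) E₀.elems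

    ∑-list : (f : (∀ i → S.Carrier i) → ℕ) →
             ∑ list f ≡ ∑ E₀.elems (λ x → ∑ E₊.elems (λ xs → f (Fin.∀-cons x xs)))
    ∑-list f = ≡.trans (∑-concatMap _ E₀.elems f)
                     (∑-cong E₀.elems (λ x → ∑-map (Fin.∀-cons x) E₊.elems f))

    _≟_ : ∀ x y → Dec (∀ i → S._≈_ i (x i) (y i))
    x ≟ y = map′ (λ (p , q) → Fin.∀-cons p q) (λ p → p zero , p ∘ suc)
                 (x zero E₀.≟ y zero ×-dec (x ∘ suc) E₊.≟ (y ∘ suc))

    once : ∀ s → ∑ list (λ x → 𝟙 (x ≟ s)) ≡ 1
    once s = begin
      ∑ list (λ x → 𝟙 (x ≟ s))
        ≡⟨ ∑-list _ ⟩
      ∑ E₀.elems (λ x → ∑ E₊.elems (λ xs → 𝟙 (Fin.∀-cons x xs ≟ s)))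
        ≡⟨ ∑-cong E₀.elems (λ x → ≡.trans (∑-cong E₊.elems (split x)) (∑-*ʳ E₊.elems _ _)) ⟩
      ∑ E₀.elems (λ x → E₊.count (E₊._≟ (s ∘ suc)) * 𝟙 (x E₀.≟ s zero))
        ≡⟨ ∑-cong E₀.elems (λ x → ≡.trans (cong (_* _) (E₊.once (s ∘ suc))) (*-identityˡ _)) ⟩
      E₀.count (E₀._≟ s zero)
        ≡⟨ E₀.once (s zero) ⟩
      1 ∎
      where
      open ≡-Reasoning
      split : ∀ x xs → 𝟙 (Fin.∀-cons x xs ≟ s) ≡ 𝟙 (xs E₊.≟ (s ∘ suc)) * 𝟙 (x E₀.≟ s zero)
      split x xs with x E₀.≟ s zero | xs E₊.≟ (s ∘ suc)
      ... | yes _ | yes _ = ≡.refl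
      ... | yes _ | no _  = ≡.refl
      ... | no _  | yes _ = ≡.refl
      ... | no _  | no _  = ≡.refl

  enumCons : Enum (Π S)
  enumCons = record { elems = list ; _≟_ = _≟_ ; once = once }

  ∑-enumCons : (f : (∀ i → S.Carrier i) → ℕ) →
    ∑ (Enum.elems enumCons) f ≡ ∑ E₀.elems (λ x → ∑ E₊.elems (λ xs → f (Fin.∀-cons x xs)))
  ∑-enumCons = ∑-list

enumΠ : ∀ {n} {S : Fin n → Setoid ℓᵃ ℓ} → (∀ i → Enum (S i)) → Enum (Π S)
enumΠ {n = zero}  E = record { elems = (λ ()) ∷ [] ; _≟_ = λ _ _ → yes λ () ; once = λ _ → ≡.refl }
enumΠ {n = suc n} {S} E = enumCons S (E zero) (enumΠ (E ∘ suc))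

∏ℕ : ∀ {n} → (Fin n → ℕ) → ℕ
∏ℕ {zero}  k = 1
∏ℕ {suc n} k = k zero * ∏ℕ (k ∘ suc)

card-enumΠ : ∀ {n} {S : Fin n → Setoid ℓᵃ ℓ} (E : ∀ i → Enum (S i)) →
             Enum.card (enumΠ E) ≡ ∏ℕ (λ i → Enum.card (E i))
card-enumΠ {n = zero}  E = ≡.refl
card-enumΠ {n = suc n} {S} E = begin
  Enum.card (enumΠ E)
    ≡⟨ ∑-length (Enum.elems (enumΠ E)) ⟨
  ∑ (Enum.elems (enumΠ E)) (λ _ → 1)
    ≡⟨ ∑-enumCons S (E zero) (enumΠ (E ∘ suc)) (λ _ → 1) ⟩
  ∑ E₀ (λ _ → ∑ E₊ (λ _ → 1))
    ≡⟨ ∑-cong E₀ (λ _ → ≡.sym (*-identityˡ _)) ⟩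
  ∑ E₀ (λ _ → 1 * ∑ E₊ (λ _ → 1))
    ≡⟨ ∑-*ʳ E₀ (λ _ → 1) _ ⟩
  ∑ E₀ (λ _ → 1) * ∑ E₊ (λ _ → 1)
    ≡⟨ cong₂ _*_ (∑-length E₀) (≡.trans (∑-length E₊) (card-enumΠ (E ∘ suc))) ⟩
  ∏ℕ (λ i → Enum.card (E i)) ∎
  where
  open ≡-Reasoning
  E₀ = Enum.elems (E zero)
  E₊ = Enum.elems (enumΠ (E ∘ suc))

∏ℕ-cong : ∀ {n} {k l : Fin n → ℕ} → (∀ i → k i ≡ l i) → ∏ℕ k ≡ ∏ℕ l
∏ℕ-cong {zero}  eq = ≡.refl
∏ℕ-cong {suc n} eq = cong₂ _*_ (eq zero) (∏ℕ-cong (eq ∘ suc))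

∏ℕ-const : ∀ n k → ∏ℕ {n} (λ _ → k) ≡ k ^ n
∏ℕ-const zero    k = ≡.refl
∏ℕ-const (suc n) k = cong (k *_) (∏ℕ-const n k)

-- Abelian groups

module Multiples (A : AbelianGroup 0ℓ 0ℓ) where
  open AbelianGroup A
  open Group group public using (_//_)
  open AbelianGroupProperties A public
  open Mult commutativeMonoid public
  open SetoidReasoning setoid

  ∙-interchange : ∀ w x y z → (w ∙ x) ∙ (y ∙ z) ≈ (w ∙ y) ∙ (x ∙ z)
  ∙-interchange w x y z = begin
    (w ∙ x) ∙ (y ∙ z) ≈⟨ assoc w x (y ∙ z) ⟩
    w ∙ (x ∙ (y ∙ z)) ≈⟨ ∙-congˡ (assoc x y z) ⟨
    w ∙ ((x ∙ y) ∙ z) ≈⟨ ∙-congˡ (∙-congʳ (comm x y)) ⟩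
    w ∙ ((y ∙ x) ∙ z) ≈⟨ ∙-congˡ (assoc y x z) ⟩
    w ∙ (y ∙ (x ∙ z)) ≈⟨ assoc w y (x ∙ z) ⟨
    (w ∙ y) ∙ (x ∙ z) ∎

  ∙-//-interchange : ∀ w x y z → (w ∙ x) // (y ∙ z) ≈ (w // y) ∙ (x // z)
  ∙-//-interchange w x y z = begin
    (w ∙ x) ∙ (y ∙ z) ⁻¹      ≈⟨ ∙-congˡ (⁻¹-∙-comm y z) ⟨
    (w ∙ x) ∙ (y ⁻¹ ∙ z ⁻¹)   ≈⟨ ∙-interchange w x (y ⁻¹) (z ⁻¹) ⟩
    (w // y) ∙ (x // z)       ∎

  ⁻¹-//-⁻¹ : ∀ x y → x ⁻¹ // y ⁻¹ ≈ (x // y) ⁻¹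
  ⁻¹-//-⁻¹ x y = ⁻¹-∙-comm x (y ⁻¹)

  x//ε≈x : ∀ x → x // ε ≈ x
  x//ε≈x x = trans (∙-congˡ ε⁻¹≈ε) (identityʳ x)

  x//y∙y : ∀ x y → (x // y) ∙ y ≈ x
  x//y∙y x y = //-rightDividesˡ y x

  [x∙y]//y : ∀ x y → (x ∙ y) // y ≈ x
  [x∙y]//y x y = //-rightDividesʳ y x

  //≈ε⇒≈ : ∀ {x y} → x // y ≈ ε → x ≈ y
  //≈ε⇒≈ = x∙y⁻¹≈ε⇒x≈y _ _

  ≈⇒//≈ε : ∀ {x y} → x ≈ y → x // y ≈ ε
  ≈⇒//≈ε = x≈y⇒x∙y⁻¹≈ε

  ×-ε : ∀ n → n × ε ≈ ε
  ×-ε zero    = refl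
  ×-ε (suc n) = trans (identityˡ _) (×-ε n)

  ×-⁻¹ : ∀ n x → n × (x ⁻¹) ≈ (n × x) ⁻¹
  ×-⁻¹ zero    x = sym ε⁻¹≈ε
  ×-⁻¹ (suc n) x = trans (∙-congˡ (×-⁻¹ n x)) (⁻¹-∙-comm x (n × x))

  ×-// : ∀ n x y → n × (x // y) ≈ n × x // n × y
  ×-// n x y = trans (×-distrib-+ x (y ⁻¹) n) (∙-congˡ (×-⁻¹ n y))

  ×-%-/ : ∀ n d .{{_ : NonZero d}} x → n × x ≈ (n % d) × x ∙ (n /ℕ d) × (d × x)
  ×-%-/ n d x = begin
    n × x                               ≈⟨ ×-congˡ (m≡m%n+[m/n]*n n d) ⟩
    (n % d + n /ℕ d * d) × x            ≈⟨ ×-homo-+ x (n % d) (n /ℕ d * d) ⟩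
    (n % d) × x ∙ (n /ℕ d * d) × x      ≈⟨ ∙-congˡ (×-assocˡ x (n /ℕ d) d) ⟨
    (n % d) × x ∙ (n /ℕ d) × (d × x)    ∎

  module Sub {H : Pred Carrier 0ℓ} (sub : IsSubgroup group H) where
    open IsSubgroup sub public

    //∈ : ∀ {x y} → x ∈ H → y ∈ H → (x // y) ∈ H
    //∈ x∈ y∈ = ∙∈ x∈ (⁻¹∈ y∈)

    ×∈ : ∀ n {x} → x ∈ H → (n × x) ∈ H
    ×∈ zero    x∈ = ε∈
    ×∈ (suc n) x∈ = ∙∈ x∈ (×∈ n x∈)

    ≈ε⇒∈ : ∀ {x} → x ≈ ε → x ∈ H
    ≈ε⇒∈ x≈ε = resp (sym x≈ε) ε∈

    //∈⇒∈ : ∀ {x y} → (x // y) ∈ H → y ∈ H → x ∈ H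
    //∈⇒∈ {x} {y} q y∈ = resp (x//y∙y x y) (∙∈ q y∈)

    ∙∈⇒∈ : ∀ {x y} → (x ∙ y) ∈ H → y ∈ H → x ∈ H
    ∙∈⇒∈ {x} {y} xy∈ y∈ = resp ([x∙y]//y x y) (//∈ xy∈ y∈)

    *×∈ : ∀ k {m x} → (m × x) ∈ H → ((k * m) × x) ∈ H
    *×∈ k {m} {x} mx∈ = resp (×-assocˡ x k m) (×∈ k mx∈)

    -- Bézout: x is the difference of a multiple of m x and a multiple of n x. Over the natural
    -- numbers either of the two may be the larger one, hence two cases.
    coprime-× : ∀ {m n x} → Coprime m n → (m × x) ∈ H → (n × x) ∈ H → x ∈ H
    coprime-× {m} {n} {x} cop mx∈ nx∈ with coprime-Bézout cop
    ... | +- k l eq = ∙∈⇒∈ (resp (×-congˡ (≡.sym eq)) (*×∈ k mx∈)) (*×∈ l nx∈)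
    ... | -+ k l eq = ∙∈⇒∈ (resp (×-congˡ (≡.sym eq)) (*×∈ l nx∈)) (*×∈ k mx∈)

  record DecSubgroup : Set₁ where
    field
      mem        : Pred Carrier 0ℓ
      isSubgroup : IsSubgroup group mem
      mem?       : ∀ x → Dec (mem x)
    open Sub isSubgroup public

  infix 4 _∈ₛ_ _⊆ₛ_ _≐ₛ_
  _∈ₛ_ : Carrier → DecSubgroup → Set
  x ∈ₛ K = DecSubgroup.mem K x

  _⊆ₛ_ _≐ₛ_ : DecSubgroup → DecSubgroup → Set
  K ⊆ₛ R = ∀ {x} → x ∈ₛ K → x ∈ₛ R
  K ≐ₛ R = K ⊆ₛ R ∧ R ⊆ₛ K

record IsHom (A B : AbelianGroup 0ℓ 0ℓ) (f : AbelianGroup.Carrier A → AbelianGroup.Carrier B) : Set where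
  private
    module A = AbelianGroup A
    module B = AbelianGroup B
    module MA = Multiples A
    module MB = Multiples B
  field
    f-cong : f Preserves A._≈_ ⟶ B._≈_
    f-∙    : ∀ x y → f (x A.∙ y) B.≈ f x B.∙ f y

  f-ε : f A.ε B.≈ B.ε
  f-ε = begin
    f A.ε                               ≈⟨ MB.[x∙y]//y (f A.ε) (f A.ε) ⟨
    (f A.ε B.∙ f A.ε) MB.// f A.ε        ≈⟨ B.∙-congʳ (B.trans (B.sym (f-∙ A.ε A.ε)) (f-cong (A.identityˡ A.ε))) ⟩
    f A.ε MB.// f A.ε                    ≈⟨ B.inverseʳ (f A.ε) ⟩
    B.ε                                 ∎
    where open SetoidReasoning B.setoid

  f-⁻¹ : ∀ x → f (x A.⁻¹) B.≈ f x B.⁻¹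
  f-⁻¹ x = MB.inverseˡ-unique _ _ (B.trans (B.sym (f-∙ (x A.⁻¹) x)) (B.trans (f-cong (A.inverseˡ x)) f-ε))

  f-// : ∀ x y → f (x MA.// y) B.≈ f x MB.// f y
  f-// x y = B.trans (f-∙ x (y A.⁻¹)) (B.∙-congˡ (f-⁻¹ y))

  f-× : ∀ n x → f (n MA.× x) B.≈ n MB.× f x
  f-× zero    x = f-ε
  f-× (suc n) x = B.trans (f-∙ x (n MA.× x)) (B.∙-congˡ (f-× n x))

×-isHom : (A : AbelianGroup 0ℓ 0ℓ) (n : ℕ) → IsHom A A (Multiples._×_ A n)
×-isHom A n = record { f-cong = ×-congʳ n ; f-∙ = λ x y → ×-distrib-+ x y n }
  where open Multiples A

-- Counting in finite abelian groups

module FiniteAbelian (B : AbelianGroup 0ℓ 0ℓ) (E : Enum (AbelianGroup.setoid B)) where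
  open AbelianGroup B
  open Multiples B public
  open Enum E public

  card-sub : DecSubgroup → ℕ
  card-sub K = count (DecSubgroup.mem? K)

  card-sub-cong : ∀ {K R} → K ≐ₛ R → card-sub K ≡ card-sub R
  card-sub-cong {K} {R} (K⊆R , R⊆K) = count-cong K⊆R R⊆K (DecSubgroup.mem? K) (DecSubgroup.mem? R)

  card-sub-≤ : ∀ {K R} → K ⊆ₛ R → card-sub K ≤ card-sub R
  card-sub-≤ {K} {R} K⊆R = count-≤ K⊆R (DecSubgroup.mem? K) (DecSubgroup.mem? R)

  card-sub≢0 : ∀ K → card-sub K ≢ 0
  card-sub≢0 K = count≢0 resp mem? (ε , ε∈)
    where open DecSubgroup K

  ⊆ₛ∧card≡⇒⊇ₛ : ∀ {K R} → K ⊆ₛ R → card-sub K ≡ card-sub R → R ⊆ₛ K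
  ⊆ₛ∧card≡⇒⊇ₛ {K} {R} K⊆R eq =
    ⊆∧count≡⇒⊇ K.resp R.resp K⊆R K.mem? R.mem? eq
    where
    module K = DecSubgroup K
    module R = DecSubgroup R

  abstract
    _⊆ₛ?_ : ∀ K R → Dec (∀ x → x ∈ₛ K → x ∈ₛ R)
    K ⊆ₛ? R = all? (λ x≈y h y∈K → R.resp x≈y (h (K.resp (sym x≈y) y∈K))) (λ x → K.mem? x →-dec R.mem? x)
      where
      module K = DecSubgroup K
      module R = DecSubgroup R

  _≐ₛ?_ : ∀ K R → Dec (K ≐ₛ R)
  K ≐ₛ? R = map′ (λ (h , k) → h _ , k _) (λ (h , k) → (λ _ → h) , (λ _ → k)) (K ⊆ₛ? R ×-dec R ⊆ₛ? K)

  ∑-translate : (f : Carrier → ℕ) → f Preserves _≈_ ⟶ _≡_ → ∀ c → ∑ elems (λ x → f (x // c)) ≡ ∑ elems f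
  ∑-translate f f-cong c = ∑-reindex E E (_// c) bij f f-cong
    where
    bij : ∀ s → count (λ t → s ≟ t // c) ≡ 1
    bij s = count-unique (λ x≈y eq → trans eq (∙-congʳ x≈y)) (λ t → s ≟ t // c) (s ∙ c)
      (sym ([x∙y]//y s c)) (λ {x} s≈ → trans (sym (x//y∙y x c)) (∙-congʳ (sym s≈)))

  card-coset : ∀ K c → count (λ x → DecSubgroup.mem? K (x // c)) ≡ card-sub K
  card-coset K c = ∑-translate (𝟙 ∘ mem?) (λ x≈y → 𝟙-cong (resp x≈y) (resp (sym x≈y)) _ _) c
    where open DecSubgroup K

  trivial whole : DecSubgroup
  trivial = record
    { mem        = _≈ ε
    ; isSubgroup = IsNormalSubgroup.isSubgroup (trivial-isNormal group)
    ; mem?       = _≟ ε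
    }
  whole = record
    { mem        = λ _ → ⊤
    ; isSubgroup = IsNormalSubgroup.isSubgroup (U-isNormal group)
    ; mem?       = λ _ → yes tt
    }

  card-whole : card-sub whole ≡ card
  card-whole = count-all (DecSubgroup.mem? whole) _

module _ {B C : AbelianGroup 0ℓ 0ℓ} (EB : Enum (AbelianGroup.setoid B)) (EC : Enum (AbelianGroup.setoid C))
         {f : AbelianGroup.Carrier B → AbelianGroup.Carrier C} (hom : IsHom B C f) where
  private
    module B = AbelianGroup B
    module C = AbelianGroup C
    module FB = FiniteAbelian B EB
    module FC = FiniteAbelian C EC
  open IsHom hom

  image : FB.DecSubgroup → FC.DecSubgroup
  image R = record
    { mem        = λ c → ∃ λ x → x FB.∈ₛ R ∧ f x C.≈ c
    ; isSubgroup = record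
      { resp = λ c≈d (x , x∈ , fx) → x , x∈ , C.trans fx c≈d
      ; ε∈   = B.ε , R.ε∈ , f-ε
      ; ∙∈   = λ (x , x∈ , fx) (y , y∈ , fy) → x B.∙ y , R.∙∈ x∈ y∈ , C.trans (f-∙ x y) (C.∙-cong fx fy)
      ; ⁻¹∈  = λ (x , x∈ , fx) → x B.⁻¹ , R.⁻¹∈ x∈ , C.trans (f-⁻¹ x) (C.⁻¹-cong fx)
      }
    ; mem?       = λ c → FB.any? (λ x≈y (x∈ , fx) → R.resp x≈y x∈ , C.trans (f-cong (B.sym x≈y)) fx)
                                 (λ x → R.mem? x ×-dec f x FC.≟ c)
    }
    where module R = FB.DecSubgroup R

  kernel : FB.DecSubgroup → FB.DecSubgroup
  kernel R = record
    { mem        = λ x → x FB.∈ₛ R ∧ f x C.≈ C.ε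
    ; isSubgroup = record
      { resp = λ x≈y (x∈ , fx) → R.resp x≈y x∈ , C.trans (f-cong (B.sym x≈y)) fx
      ; ε∈   = R.ε∈ , f-ε
      ; ∙∈   = λ {x} {y} (x∈ , fx) (y∈ , fy) → R.∙∈ x∈ y∈ ,
                 C.trans (f-∙ x y) (C.trans (C.∙-cong fx fy) (C.identityˡ C.ε))
      ; ⁻¹∈  = λ {x} (x∈ , fx) → R.⁻¹∈ x∈ , C.trans (f-⁻¹ x) (C.trans (C.⁻¹-cong fx) FC.ε⁻¹≈ε)
      }
    ; mem?       = λ x → R.mem? x ×-dec f x FC.≟ C.ε
    }
    where module R = FB.DecSubgroup R

  -- The fibres of `f` on `R` are translates of the kernel over the image and empty elsewhere. The
  -- relative form is needed because `f` is restricted to subgroups such as 𝔸[p] and p𝔸.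
  card-image*kernel : ∀ R → FB.card-sub R ≡ FC.card-sub (image R) * FB.card-sub (kernel R)
  card-image*kernel R = begin
    FB.card-sub R
      ≡⟨ ∑-cong FB.elems fiber ⟩
    ∑ FB.elems (λ x → FC.count (over? x))
      ≡⟨ ∑-swap FB.elems FC.elems (λ x c → 𝟙 (over? x c)) ⟩
    ∑ FC.elems (λ c → FB.count (λ x → over? x c))
      ≡⟨ ∑-cong FC.elems coset ⟩
    ∑ FC.elems (λ c → 𝟙 (I.mem? c) * FB.card-sub (kernel R))
      ≡⟨ ∑-*ʳ FC.elems _ _ ⟩
    FC.card-sub (image R) * FB.card-sub (kernel R) ∎
    where
    open ≡-Reasoning
    module R = FB.DecSubgroup R
    module I = FC.DecSubgroup (image R)
    module K = FB.DecSubgroup (kernel R)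

    over? : ∀ x c → Dec (x FB.∈ₛ R ∧ f x C.≈ c)
    over? x c = R.mem? x ×-dec f x FC.≟ c

    fiber : ∀ x → 𝟙 (R.mem? x) ≡ FC.count (over? x)
    fiber x with R.mem? x
    ... | yes x∈ = ≡.sym (≡.trans (FC.count-cong proj₂ (x∈ ,_) (λ c → yes x∈ ×-dec f x FC.≟ c) (f x FC.≟_))
                                (FC.count-unique (λ c≈d eq → C.trans eq c≈d) (f x FC.≟_) (f x) C.refl C.sym))
    ... | no x∉  = ≡.sym (FC.count-none (λ c → no x∉ ×-dec f x FC.≟ c) (λ (x∈ , _) → x∉ x∈))

    coset : ∀ c → FB.count (λ x → over? x c) ≡ 𝟙 (I.mem? c) * FB.card-sub (kernel R)
    coset c with I.mem? c
    ... | yes (y , y∈ , fy) = ≡.trans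
      (FB.count-cong
        (λ {x} (x∈ , fx) → R.//∈ x∈ y∈ , C.trans (f-// x y) (FC.≈⇒//≈ε (C.trans fx (C.sym fy))))
        (λ {x} (q∈ , fq) → R.//∈⇒∈ q∈ y∈ , C.trans (FC.//≈ε⇒≈ (C.trans (C.sym (f-// x y)) fq)) fy)
        (λ x → over? x c) (λ x → K.mem? (x FB.// y)))
      (≡.trans (FB.card-coset (kernel R) y) (≡.sym (*-identityˡ _)))
    ... | no ∉I = FB.count-none (λ x → over? x c) (λ {x} (x∈ , fx) → ∉I (x , x∈ , fx))

-- Generating tuples of finite abelian p-groups

^-distribʳ-* : ∀ k m n → (m * n) ^ k ≡ m ^ k * n ^ k
^-distribʳ-* zero    m n = ≡.refl
^-distribʳ-* (suc k) m n = ≡.trans (cong (m * n *_) (^-distribʳ-* k m n)) (lemma m n (m ^ k) (n ^ k))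
  where
  lemma : ∀ a b c d → a * b * (c * d) ≡ a * c * (b * d)
  lemma = solve-∀

-- The number of generating n-tuples of F_p^d, by recursion on the first entry of the tuple.
surjections : ℕ → ℕ → ℕ → ℕ
surjections p zero    zero    = 1
surjections p zero    (suc d) = 0
surjections p (suc n) zero    = 1
surjections p (suc n) (suc d) = surjections p n (suc d) + (p ^ suc d ∸ 1) * (p ^ n * surjections p n d)

-- Being a p-group enters as the exponent bound p^e: it makes cyclic subgroups searchable and ends
-- the descent in Nakayama's lemma.
module PGroup (p : ℕ) (pr : Prime p) (e : ℕ) (B : AbelianGroup 0ℓ 0ℓ) (E : Enum (AbelianGroup.setoid B))
              (torsion : ∀ x → AbelianGroup._≈_ B (Multiples._×_ B (p ^ e) x) (AbelianGroup.ε B)) where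
  open AbelianGroup B
  open FiniteAbelian B E public

  private
    instance
      p-nonZero : NonZero p
      p-nonZero = prime⇒nonZero pr

      q-nonZero : NonZero (p ^ e)
      q-nonZero = m^n≢0 p e

    q : ℕ
    q = p ^ e

    ×-%q : ∀ n x → n × x ≈ (n % q) × x
    ×-%q n x = trans (×-%-/ n q x) (trans (∙-congˡ (trans (×-congʳ (n /ℕ q) (torsion x)) (×-ε (n /ℕ q)))) (identityʳ _))

    ×-⁻¹-pred : ∀ n x → (pred q * n) × x ≈ (n × x) ⁻¹
    ×-⁻¹-pred n x = inverseʳ-unique _ _ (begin
      n × x ∙ (pred q * n) × x ≈⟨ ×-homo-+ x n (pred q * n) ⟨
      (suc (pred q) * n) × x   ≈⟨ ×-congˡ (cong (_* n) (suc-pred q)) ⟩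
      (q * n) × x              ≈⟨ ×-assocˡ x q n ⟨
      q × (n × x)              ≈⟨ torsion (n × x) ⟩
      ε                        ∎)
      where open SetoidReasoning setoid

  infixl 6 _⊕_
  -- The subgroup K + ⟨x⟩. Natural multiples suffice as q x = 0: the inverse of n x is (q - 1) n x,
  -- and membership is decided by trying the multiples below q.
  _⊕_ : DecSubgroup → Carrier → DecSubgroup
  K ⊕ x = record
    { mem        = λ z → ∃ λ n → (z // n × x) ∈ₛ K
    ; isSubgroup = record
      { resp = λ z≈w (n , h) → n , K.resp (∙-congʳ z≈w) h
      ; ε∈   = 0 , K.≈ε⇒∈ (inverseʳ ε)
      ; ∙∈   = λ {z} {w} (n , h) (m , k) → n + m ,
                 K.resp (trans (sym (∙-//-interchange z w (n × x) (m × x)))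
                               (∙-congˡ (⁻¹-cong (sym (×-homo-+ x n m))))) (K.∙∈ h k)
      ; ⁻¹∈  = λ {z} (n , h) → pred q * n ,
                 K.resp (trans (sym (⁻¹-//-⁻¹ z (n × x))) (∙-congˡ (⁻¹-cong (sym (×-⁻¹-pred n x))))) (K.⁻¹∈ h)
      }
    ; mem?       = λ z → map′ (λ (i , h) → toℕ i , h)
        (λ (n , h) → fromℕ< (m%n<n n q) ,
          K.resp (∙-congˡ (⁻¹-cong (trans (×-%q n x) (×-congˡ (≡.sym (Fin.toℕ-fromℕ< (m%n<n n q))))))) h)
        (Fin.any? (λ i → K.mem? (z // toℕ i × x)))
    }
    where module K = DecSubgroup K

  module _ (K : DecSubgroup) (x : Carrier) where
    private module K = DecSubgroup K

    ⊕-⊇ : K ⊆ₛ K ⊕ x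
    ⊕-⊇ z∈ = 0 , K.resp (sym (x//ε≈x _)) z∈

    ⊕-∋ : x ∈ₛ K ⊕ x
    ⊕-∋ = 1 , K.≈ε⇒∈ (≈⇒//≈ε (sym (×-homo-1 x)))

    ⊕-min : ∀ {H} → IsSubgroup group H → (∀ {z} → z ∈ₛ K → z ∈ H) → x ∈ H → ∀ {z} → z ∈ₛ K ⊕ x → z ∈ H
    ⊕-min H K⊆H x∈H (n , h) = H.//∈⇒∈ (K⊆H h) (H.×∈ n x∈H)
      where module H = Sub H

    ⊕-absorb : x ∈ₛ K → K ⊕ x ⊆ₛ K
    ⊕-absorb = ⊕-min K.isSubgroup id

    module _ (x∉K : ¬ x ∈ₛ K) (px∈K : p × x ∈ₛ K) where
      private
        separated : ∀ {i j} → i < j → j < p → ¬ ((j × x) // (i × x) ∈ₛ K)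
        separated {i} {j} i<j j<p h = x∉K (K.coprime-× (prime⇒coprime pr ⦃ >-nonZero (m<n⇒0<n∸m i<j) ⦄
          (≤-<-trans (m∸n≤m j i) j<p)) px∈K (K.resp difference h))
          where
          difference : (j × x) // (i × x) ≈ (j ∸ i) × x
          difference = trans (∙-congʳ (trans (×-congˡ (≡.sym (m∸n+n≡m (<⇒≤ i<j)))) (×-homo-+ x (j ∸ i) i)))
                             ([x∙y]//y _ _)

        //-//-cancel : ∀ z u v → (z // u) // (z // v) ≈ v // u
        //-//-cancel z u v = trans (∙-//-interchange z (u ⁻¹) z (v ⁻¹))
          (trans (∙-congʳ (inverseʳ z)) (trans (identityˡ _) (trans (⁻¹-//-⁻¹ u v) (⁻¹-anti-homo-// u v))))

        unique : ∀ z {i j} → i < p → j < p → (z // i × x) ∈ₛ K → (z // j × x) ∈ₛ K → i ≡ j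
        unique z {i} {j} i<p j<p h k with <-cmp i j
        ... | tri< i<j _ _ = contradiction (K.resp (//-//-cancel z (i × x) (j × x)) (K.//∈ h k)) (separated i<j j<p)
        ... | tri≈ _ i≡j _ = i≡j
        ... | tri> _ _ j<i = contradiction (K.resp (//-//-cancel z (j × x) (i × x)) (K.//∈ k h)) (separated j<i i<p)

        reduce : ∀ z n → (z // n × x) ∈ₛ K → (z // (n % p) × x) ∈ₛ K
        reduce z n h = K.resp eq (K.∙∈ h (K.×∈ (n /ℕ p) px∈K))
          where
          open SetoidReasoning setoid
          eq : (z // n × x) ∙ (n /ℕ p) × (p × x) ≈ z // (n % p) × x
          eq = begin
            (z // n × x) ∙ (n /ℕ p) × (p × x)
              ≈⟨ ∙-cong (∙-congˡ (⁻¹-cong (×-%-/ n p x))) (sym (x//ε≈x _)) ⟩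
            (z // ((n % p) × x ∙ (n /ℕ p) × (p × x))) ∙ ((n /ℕ p) × (p × x) // ε)
              ≈⟨ ∙-//-interchange _ _ _ _ ⟨
            (z ∙ (n /ℕ p) × (p × x)) // ((n % p) × x ∙ (n /ℕ p) × (p × x) ∙ ε)
              ≈⟨ ∙-congˡ (⁻¹-cong (identityʳ _)) ⟩
            (z ∙ (n /ℕ p) × (p × x)) // ((n % p) × x ∙ (n /ℕ p) × (p × x))
              ≈⟨ ∙-//-interchange _ _ _ _ ⟩
            (z // (n % p) × x) ∙ ((n /ℕ p) × (p × x) // (n /ℕ p) × (p × x))
              ≈⟨ ∙-congˡ (inverseʳ _) ⟩
            (z // (n % p) × x) ∙ ε
              ≈⟨ identityʳ _ ⟩
            z // (n % p) × x ∎

        module P = Enum (enumFin p)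

        coset? : ∀ z (i : Fin p) → Dec ((z // toℕ i × x) ∈ₛ K)
        coset? z i = K.mem? (z // toℕ i × x)

        which-coset : ∀ z → 𝟙 (DecSubgroup.mem? (K ⊕ x) z) ≡ P.count (coset? z)
        which-coset z with DecSubgroup.mem? (K ⊕ x) z
        ... | yes (n , h) = ≡.sym (P.count-unique (λ { ≡.refl k → k }) (coset? z) i h'
                (λ {j} k → Fin.toℕ-injective (unique z (Fin.toℕ<n j) (Fin.toℕ<n i) k h')))
          where
          i = fromℕ< (m%n<n n p)
          h' : (z // toℕ i × x) ∈ₛ K
          h' = subst (λ m → (z // m × x) ∈ₛ K) (≡.sym (Fin.toℕ-fromℕ< (m%n<n n p))) (reduce z n h)
        ... | no z∉ = ≡.sym (P.count-none (coset? z) (λ {i} h → z∉ (toℕ i , h)))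

      -- K + ⟨x⟩ is the union of the cosets K + i x with i < p, since p x ∈ K. They are disjoint:
      -- for i < j < p the number j - i is prime to p, so (j - i) x ∈ K together with p x ∈ K would
      -- force x ∈ K.
      card-⊕ : card-sub (K ⊕ x) ≡ p * card-sub K
      card-⊕ = begin
        card-sub (K ⊕ x)
          ≡⟨ ∑-cong elems which-coset ⟩
        ∑ elems (λ z → P.count (coset? z))
          ≡⟨ ∑-swap elems P.elems _ ⟩
        ∑ P.elems (λ i → count (λ z → coset? z i))
          ≡⟨ ∑-cong P.elems (λ i → ≡.trans (card-coset K (toℕ i × x)) (≡.sym (*-identityˡ _))) ⟩
        ∑ P.elems (λ _ → 1 * card-sub K)
          ≡⟨ ∑-*ʳ P.elems (λ _ → 1) _ ⟩
        ∑ P.elems (λ _ → 1) * card-sub K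
          ≡⟨ cong (_* card-sub K) (≡.trans (∑-length P.elems) (card-enumFin p)) ⟩
        p * card-sub K ∎
        where open ≡-Reasoning

  1<p : 1 < p
  1<p = nonTrivial⇒n>1 p ⦃ prime⇒nonTrivial pr ⦄

  module _ (K R : DecSubgroup) (K⊆R : K ⊆ₛ R) where
    private module R = DecSubgroup R

    ⊕-⊆ : ∀ {x} → x ∈ₛ R → K ⊕ x ⊆ₛ R
    ⊕-⊆ {x} x∈R = ⊕-min K x R.isSubgroup K⊆R x∈R

  -- As pR ⊆ K, adjoining an element of R outside K multiplies |K| by p. The recursion ends because
  -- m, an upper bound for |R| - |K|, drops at each step.
  index-p-power : ∀ R K → K ⊆ₛ R → (∀ {x} → x ∈ₛ R → p × x ∈ₛ K) → ∃ λ d → card-sub R ≡ p ^ d * card-sub K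
  index-p-power R = λ K K⊆R pR⊆K → go (card-sub R) K K⊆R pR⊆K (m≤m+n _ _)
    where
    module R = DecSubgroup R

    go : ∀ m K → K ⊆ₛ R → (∀ {x} → x ∈ₛ R → p × x ∈ₛ K) → card-sub R ≤ m + card-sub K →
         ∃ λ d → card-sub R ≡ p ^ d * card-sub K
    go m K K⊆R pR⊆K bound
      with any? (λ x≈y (x∈R , x∉K) → R.resp x≈y x∈R , λ y∈K → x∉K (DecSubgroup.resp K (sym x≈y) y∈K))
                (λ x → R.mem? x ×-dec ¬? (DecSubgroup.mem? K x))
    go m K K⊆R pR⊆K bound | no none = 0 , ≡.trans (card-sub-cong {R} {K} (R⊆K , K⊆R)) (≡.sym (*-identityˡ _))
      where
      R⊆K : R ⊆ₛ K
      R⊆K {x} x∈R with DecSubgroup.mem? K x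
      ... | yes x∈K = x∈K
      ... | no x∉K  = contradiction (x , x∈R , x∉K) none
    go zero K K⊆R pR⊆K bound | yes (x , x∈R , x∉K) =
      contradiction (⊆ₛ∧card≡⇒⊇ₛ {K} {R} K⊆R (≤-antisym (card-sub-≤ {K} {R} K⊆R) bound) x∈R) x∉K
    go (suc m) K K⊆R pR⊆K bound | yes (x , x∈R , x∉K) =
      let (d , eq) = go m (K ⊕ x) (⊕-⊆ K R K⊆R x∈R) (λ y∈R → ⊕-⊇ K x (pR⊆K y∈R)) bound'
      in suc d , ≡.trans eq (≡.trans (cong (p ^ d *_) card-K⊕x) (lemma (p ^ d) p (card-sub K)))
      where
      card-K⊕x : card-sub (K ⊕ x) ≡ p * card-sub K
      card-K⊕x = card-⊕ K x x∉K (pR⊆K x∈R)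
      lemma : ∀ k l m → k * (l * m) ≡ l * k * m
      lemma = solve-∀
      bound' : card-sub R ≤ m + card-sub (K ⊕ x)
      bound' = begin
        card-sub R                ≤⟨ bound ⟩
        suc m + card-sub K        ≡⟨ +-suc m (card-sub K) ⟨
        m + suc (card-sub K)      ≤⟨ +-monoʳ-≤ m (m<p*m (card-sub K) ⦃ ≢-nonZero (card-sub≢0 K) ⦄) ⟩
        m + p * card-sub K        ≡⟨ cong (_+_ m) card-K⊕x ⟨
        m + card-sub (K ⊕ x)      ∎
        where
        open ≤-Reasoning
        m<p*m : ∀ m .⦃ _ : NonZero m ⦄ → m < p * m
        m<p*m m = <-≤-trans (m<m*n m p 1<p) (≤-reflexive (*-comm m p))

  -- K + ⟨t⟩, adjoining the entries from the front. The base `K` is a parameter, so that the same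
  -- notion serves for generation, modulo the trivial group, and for generation modulo pR; it also
  -- is the state of the recursion in `count-spanning`.
  span : DecSubgroup → ∀ {n} → (Fin n → Carrier) → DecSubgroup
  span K {zero}  t = K
  span K {suc n} t = span (K ⊕ t zero) (t ∘ suc)

  span-⊇ : ∀ K {n} (t : Fin n → Carrier) → K ⊆ₛ span K t
  span-⊇ K {zero}  t x∈ = x∈
  span-⊇ K {suc n} t x∈ = span-⊇ (K ⊕ t zero) (t ∘ suc) (⊕-⊇ K (t zero) x∈)

  span-∋ : ∀ K {n} (t : Fin n → Carrier) i → t i ∈ₛ span K t
  span-∋ K t zero    = span-⊇ (K ⊕ t zero) (t ∘ suc) (⊕-∋ K (t zero))
  span-∋ K t (suc i) = span-∋ (K ⊕ t zero) (t ∘ suc) i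

  span-min : ∀ K {n} (t : Fin n → Carrier) {H} → IsSubgroup group H →
             (∀ {z} → z ∈ₛ K → z ∈ H) → (∀ i → t i ∈ H) → ∀ {z} → z ∈ₛ span K t → z ∈ H
  span-min K {zero}  t sub K⊆H t∈H z∈ = K⊆H z∈
  span-min K {suc n} t sub K⊆H t∈H z∈ =
    span-min (K ⊕ t zero) (t ∘ suc) sub (⊕-min K (t zero) sub K⊆H (t∈H zero)) (t∈H ∘ suc) z∈

  enumTuple : ∀ n → Enum (Π {n = n} (λ _ → setoid))
  enumTuple n = enumΠ (λ _ → E)

  module _ (R : DecSubgroup) where
    private
      module R = DecSubgroup R

    spans? : ∀ K {n} (t : Fin n → Carrier) → Dec (span K t ≐ₛ R)
    spans? K t = span K t ≐ₛ? R

    -- R/K is an F_p-space of dimension d, and each tuple in it has |K|^n lifts. The induction is on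
    -- the first entry x: for x ∈ K the dimension stays, for x in R outside K it drops by one, and
    -- for x outside R no completion spans R.
    count-spanning : ∀ n d K → K ⊆ₛ R → (∀ {x} → x ∈ₛ R → p × x ∈ₛ K) → card-sub R ≡ p ^ d * card-sub K →
                     Enum.count (enumTuple n) (spans? K) ≡ card-sub K ^ n * surjections p n d
    count-spanning zero zero K K⊆R pR⊆K eq =
      ≡.trans (+-identityʳ _) (𝟙-true {P = K ≐ₛ R} K≐R (K ≐ₛ? R))
      where
      K≐R : K ≐ₛ R
      K≐R = K⊆R , ⊆ₛ∧card≡⇒⊇ₛ {K} {R} K⊆R (≡.sym (≡.trans eq (*-identityˡ _)))
    count-spanning zero (suc d) K K⊆R pR⊆K eq =
      ≡.trans (+-identityʳ _) (𝟙-false {P = K ≐ₛ R} (λ K≐R → card-sub≢0 K (p^*≡⇒≡0 (≡.trans (card-sub-cong {K} {R} K≐R) eq))) (K ≐ₛ? R))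
      where
      p^*≡⇒≡0 : ∀ {m} → m ≡ p ^ suc d * m → m ≡ 0
      p^*≡⇒≡0 {zero}  _  = ≡.refl
      p^*≡⇒≡0 {suc m} eq = contradiction (*-cancelʳ-≡ 1 (p ^ suc d) (suc m) (≡.trans (*-identityˡ (suc m)) eq))
        (<⇒≢ (<-≤-trans 1<p (m≤m*n p (p ^ d) ⦃ m^n≢0 p d ⦄)))
    count-spanning (suc n) d K K⊆R pR⊆K eq = ≡.trans (∑-enumCons (λ _ → setoid) E (enumTuple n) (λ t → 𝟙 (spans? K t))) (total d eq)
      where
      open ≡-Reasoning
      module K = DecSubgroup K

      F : Carrier → ℕ
      F x = Enum.count (enumTuple n) (spans? (K ⊕ x))

      F-∈K : ∀ d → card-sub R ≡ p ^ d * card-sub K → ∀ {x} → x ∈ₛ K → F x ≡ card-sub K ^ n * surjections p n d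
      F-∈K d eq {x} x∈K = ≡.trans
        (count-spanning n d (K ⊕ x) (⊕-⊆ K R K⊆R (K⊆R x∈K)) (λ y∈ → ⊕-⊇ K x (pR⊆K y∈))
          (≡.trans eq (cong (p ^ d *_) (≡.sym card-K⊕x))))
        (cong (λ k → k ^ n * surjections p n d) card-K⊕x)
        where
        card-K⊕x : card-sub (K ⊕ x) ≡ card-sub K
        card-K⊕x = card-sub-cong {K ⊕ x} {K} (⊕-absorb K x x∈K , ⊕-⊇ K x)

      F-∉R : ∀ {x} → ¬ x ∈ₛ R → F x ≡ 0
      F-∉R {x} x∉R = Enum.count-none (enumTuple n) (spans? (K ⊕ x))
        (λ {xs} (⊆R , _) → x∉R (⊆R (span-⊇ (K ⊕ x) xs (⊕-∋ K x))))

      F-∈R : ∀ d → card-sub R ≡ p ^ suc d * card-sub K → ∀ {x} → x ∈ₛ R → ¬ x ∈ₛ K →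
             F x ≡ (p * card-sub K) ^ n * surjections p n d
      F-∈R d eq {x} x∈R x∉K = ≡.trans
        (count-spanning n d (K ⊕ x) (⊕-⊆ K R K⊆R x∈R) (λ y∈ → ⊕-⊇ K x (pR⊆K y∈))
          (≡.trans eq (≡.trans (lemma p (p ^ d) (card-sub K)) (cong (p ^ d *_) (≡.sym card-K⊕x)))))
        (cong (λ k → k ^ n * surjections p n d) card-K⊕x)
        where
        card-K⊕x : card-sub (K ⊕ x) ≡ p * card-sub K
        card-K⊕x = card-⊕ K x x∉K (pR⊆K x∈R)
        lemma : ∀ k l m → k * l * m ≡ l * (k * m)
        lemma = solve-∀

      total : ∀ d → card-sub R ≡ p ^ d * card-sub K →
              ∑ elems F ≡ card-sub K ^ suc n * surjections p (suc n) d
      total zero eq = begin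
        ∑ elems F
          ≡⟨ ∑-cong elems case ⟩
        ∑ elems (λ x → 𝟙 (K.mem? x) * (card-sub K ^ n * surjections p n 0))
          ≡⟨ ∑-*ʳ elems _ _ ⟩
        card-sub K * (card-sub K ^ n * surjections p n 0)
          ≡⟨ *-assoc (card-sub K) _ _ ⟨
        card-sub K ^ suc n * surjections p n 0
          ≡⟨ cong (card-sub K ^ suc n *_) (surjections-zero n) ⟩
        card-sub K ^ suc n * surjections p (suc n) 0 ∎
        where
        surjections-zero : ∀ n → surjections p n 0 ≡ 1
        surjections-zero zero    = ≡.refl
        surjections-zero (suc n) = ≡.refl
        R⊆K : R ⊆ₛ K
        R⊆K = ⊆ₛ∧card≡⇒⊇ₛ {K} {R} K⊆R (≡.sym (≡.trans eq (*-identityˡ _)))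
        case : ∀ x → F x ≡ 𝟙 (K.mem? x) * (card-sub K ^ n * surjections p n 0)
        case x with K.mem? x
        ... | yes x∈K = ≡.trans (F-∈K 0 eq x∈K) (≡.sym (*-identityˡ _))
        ... | no x∉K  = F-∉R (λ x∈R → x∉K (R⊆K x∈R))
      -- The term |K| b is added on both sides in place of subtracting it: |R| - |K| entries, namely
      -- those in R but not in K, contribute b each.
      total (suc d) eq = +-cancelʳ-≡ (card-sub K * b) _ _ (begin
        ∑ elems F + card-sub K * b
          ≡⟨ cong (_+_ (∑ elems F)) (∑-*ʳ elems _ b) ⟨
        ∑ elems F + ∑ elems (λ x → 𝟙 (K.mem? x) * b)
          ≡⟨ ∑-+ elems F _ ⟨
        ∑ elems (λ x → F x + 𝟙 (K.mem? x) * b)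
          ≡⟨ ∑-cong elems case ⟩
        ∑ elems (λ x → 𝟙 (K.mem? x) * a + 𝟙 (R.mem? x) * b)
          ≡⟨ ∑-+ elems _ _ ⟩
        ∑ elems (λ x → 𝟙 (K.mem? x) * a) + ∑ elems (λ x → 𝟙 (R.mem? x) * b)
          ≡⟨ cong₂ _+_ (∑-*ʳ elems _ a) (∑-*ʳ elems _ b) ⟩
        card-sub K * a + card-sub R * b
          ≡⟨ cong (λ r → card-sub K * a + r * b) (≡.trans eq (cong (_* card-sub K) (≡.sym (m∸n+n≡m 1≤p^)))) ⟩
        card-sub K * a + ((p ^ suc d ∸ 1 + 1) * card-sub K) * b
          ≡⟨ cong (λ k → card-sub K * a + ((p ^ suc d ∸ 1 + 1) * card-sub K) * (k * surjections p n d))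
                  (^-distribʳ-* n p (card-sub K)) ⟩
        card-sub K * a + ((p ^ suc d ∸ 1 + 1) * card-sub K) * (p ^ n * card-sub K ^ n * surjections p n d)
          ≡⟨ lemma (card-sub K) (card-sub K ^ n) (surjections p n (suc d)) (p ^ suc d ∸ 1) (p ^ n) (surjections p n d) ⟩
        card-sub K ^ suc n * surjections p (suc n) (suc d)
          + card-sub K * (p ^ n * card-sub K ^ n * surjections p n d)
          ≡⟨ cong (λ k → card-sub K ^ suc n * surjections p (suc n) (suc d) + card-sub K * (k * surjections p n d))
                  (^-distribʳ-* n p (card-sub K)) ⟨
        card-sub K ^ suc n * surjections p (suc n) (suc d) + card-sub K * b ∎)
        where
        a = card-sub K ^ n * surjections p n (suc d)
        b = (p * card-sub K) ^ n * surjections p n d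
        1≤p^ : 1 ≤ p ^ suc d
        1≤p^ = m^n>0 p (suc d)
        lemma : ∀ k kn s r pn s' → k * (kn * s) + ((r + 1) * k) * (pn * kn * s') ≡
                  k * kn * (s + r * (pn * s')) + k * (pn * kn * s')
        lemma = solve-∀
        case : ∀ x → F x + 𝟙 (K.mem? x) * b ≡ 𝟙 (K.mem? x) * a + 𝟙 (R.mem? x) * b
        case x with K.mem? x | R.mem? x
        ... | yes x∈K | yes x∈R = cong (_+ 1 * b) (≡.trans (F-∈K (suc d) eq x∈K) (≡.sym (*-identityˡ a)))
        ... | yes x∈K | no x∉R  = contradiction (K⊆R x∈K) x∉R
        ... | no x∉K  | yes x∈R = ≡.trans (+-identityʳ _) (≡.trans (F-∈R d eq x∈R x∉K) (≡.sym (*-identityˡ b)))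
        ... | no x∉K  | no x∉R  = ≡.trans (+-identityʳ _) (F-∉R x∉R)

    multiples : DecSubgroup
    multiples = image E E (×-isHom B p) R

    torsionₚ : DecSubgroup
    torsionₚ = kernel E E (×-isHom B p) R

    multiples-⊆ : multiples ⊆ₛ R
    multiples-⊆ (x , x∈ , px≈z) = R.resp px≈z (R.×∈ p x∈)

    card-multiples*torsion : card-sub R ≡ card-sub multiples * card-sub torsionₚ
    card-multiples*torsion = card-image*kernel E E (×-isHom B p) R

    -- Nakayama's lemma: R = S + pR implies R = S + p^e R = S.
    nakayama : ∀ {n} (t : Fin n → Carrier) → R ⊆ₛ span multiples t → R ⊆ₛ span trivial t
    nakayama t R⊆ {x} x∈R =
      let (y , y∈R , q) = descend e x∈R
      in S.resp (trans (∙-congˡ (⁻¹-cong (torsion y))) (x//ε≈x x)) q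
      where
      open SetoidReasoning setoid
      module S = DecSubgroup (span trivial t)

      S+pR : Pred Carrier 0ℓ
      S+pR z = ∃ λ y → y ∈ₛ R ∧ (z // p × y) ∈ₛ span trivial t

      S+pR-isSubgroup : IsSubgroup group S+pR
      S+pR-isSubgroup = record
        { resp = λ z≈w (y , y∈ , h) → y , y∈ , S.resp (∙-congʳ z≈w) h
        ; ε∈   = ε , R.ε∈ , S.≈ε⇒∈ (≈⇒//≈ε (sym (×-ε p)))
        ; ∙∈   = λ {z} {w} (y , y∈ , h) (y' , y'∈ , h') → y ∙ y' , R.∙∈ y∈ y'∈ ,
                   S.resp (trans (sym (∙-//-interchange z w (p × y) (p × y')))
                                 (∙-congˡ (⁻¹-cong (sym (×-distrib-+ y y' p))))) (S.∙∈ h h')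
        ; ⁻¹∈  = λ {z} (y , y∈ , h) → y ⁻¹ , R.⁻¹∈ y∈ ,
                   S.resp (trans (sym (⁻¹-//-⁻¹ z (p × y))) (∙-congˡ (⁻¹-cong (sym (×-⁻¹ p y))))) (S.⁻¹∈ h)
        }

      step : ∀ {z} → z ∈ₛ R → z ∈ S+pR
      step z∈R = span-min multiples t S+pR-isSubgroup
        (λ (y , y∈ , py≈z) → y , y∈ , S.≈ε⇒∈ (≈⇒//≈ε (sym py≈z)))
        (λ i → ε , R.ε∈ , S.resp (sym (trans (∙-congˡ (⁻¹-cong (×-ε p))) (x//ε≈x _))) (span-∋ trivial t i))
        (R⊆ z∈R)

      descend : ∀ j {z} → z ∈ₛ R → ∃ λ y → y ∈ₛ R ∧ (z // (p ^ j) × y) ∈ₛ span trivial t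
      descend zero    {z} z∈R = z , z∈R , S.≈ε⇒∈ (≈⇒//≈ε (sym (×-homo-1 z)))
      descend (suc j) {z} z∈R =
        let (y , y∈ , h)   = descend j z∈R
            (y' , y'∈ , h') = step y∈
        in y' , y'∈ , S.resp (combine y y') (S.∙∈ h (S.×∈ (p ^ j) h'))
        where
        combine : ∀ y y' → (z // (p ^ j) × y) ∙ (p ^ j) × (y // p × y') ≈ z // (p ^ suc j) × y'
        combine y y' = begin
          (z // (p ^ j) × y) ∙ (p ^ j) × (y // p × y')
            ≈⟨ ∙-congˡ (×-// (p ^ j) y (p × y')) ⟩
          (z // (p ^ j) × y) ∙ ((p ^ j) × y // (p ^ j) × (p × y'))
            ≈⟨ assoc (z // (p ^ j) × y) ((p ^ j) × y) _ ⟨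
          (z // (p ^ j) × y) ∙ (p ^ j) × y // (p ^ j) × (p × y')
            ≈⟨ ∙-cong (x//y∙y z ((p ^ j) × y)) (⁻¹-cong (trans (×-assocˡ y' (p ^ j) p) (×-congˡ (*-comm (p ^ j) p)))) ⟩
          z // (p ^ suc j) × y' ∎

    -- By `nakayama` a tuple in R generates R iff it does so modulo pR, which reduces the count to
    -- the vector space R/pR.
    count-generating : ∀ n d → card-sub R ≡ p ^ d * card-sub multiples →
      Enum.count (enumTuple n) (spans? trivial) ≡ card-sub multiples ^ n * surjections p n d
    count-generating n d eq = ≡.trans
      (Enum.count-cong (enumTuple n) (λ {t} → raise t) (λ {t} → lower t) (spans? trivial) (spans? multiples))
      (count-spanning n d multiples multiples-⊆ (λ {x} x∈ → x , x∈ , refl) eq)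
      where
      raise : (t : Fin n → Carrier) → span trivial t ≐ₛ R → span multiples t ≐ₛ R
      raise t (S⊆R , R⊆S) =
        span-min multiples t R.isSubgroup multiples-⊆ (λ i → S⊆R (span-∋ trivial t i)) ,
        λ x∈R → span-min trivial t S.isSubgroup S.≈ε⇒∈ (span-∋ multiples t) (R⊆S x∈R)
        where module S = DecSubgroup (span multiples t)

      lower : (t : Fin n → Carrier) → span multiples t ≐ₛ R → span trivial t ≐ₛ R
      lower t (S⊆R , R⊆S) =
        span-min trivial t R.isSubgroup R.≈ε⇒∈ (λ i → S⊆R (span-∋ multiples t i)) ,
        nakayama t R⊆S

-- Closed form of the number of generating tuples of F_p^d

module Surjections (p : ℕ) .⦃ _ : NonZero p ⦄ where

  private
    s : ℕ → ℕ → ℕ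
    s = surjections p

    p^∸1+1 : ∀ k → p ^ k ∸ 1 + 1 ≡ p ^ k
    p^∸1+1 k = m∸n+n≡m (m^n>0 p k)

  surjections-0 : ∀ n → s n 0 ≡ 1
  surjections-0 zero    = ≡.refl
  surjections-0 (suc n) = ≡.refl

  mutual
    -- In subtraction-free form, s(n, d+1) = (p^n - p^d) s(n, d). The definition builds a d × n
    -- matrix of rank d by columns; this builds it by rows, a new row of F_p^n having to avoid the
    -- p^d vectors in the span of the others. The row recursion is derived from the column recursion
    -- by a simultaneous induction with `surjections-suc`.
    surjections-sucʳ : ∀ n d → s n (suc d) + p ^ d * s n d ≡ p ^ n * s n d
    surjections-sucʳ zero    zero    = ≡.refl
    surjections-sucʳ zero    (suc d) = *-zeroʳ (p ^ suc d)
    surjections-sucʳ (suc n) zero    = begin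
      s (suc n) 1 + 1 * 1             ≡⟨ cong (λ k → s (suc n) 1 + 1 * k) (surjections-0 n) ⟨
      s (suc n) 1 + 1 * s n 0         ≡⟨ surjections-suc n 0 ⟩
      p ^ suc n * (1 * s n 0)         ≡⟨ cong (λ k → p ^ suc n * (1 * k)) (surjections-0 n) ⟩
      p ^ suc n * (1 * 1)             ≡⟨⟩
      p ^ suc n * 1                   ∎
      where open ≡-Reasoning
    surjections-sucʳ (suc n) (suc d) = +-cancelʳ-≡ (p ^ suc d * (Z + a * W)) _ _ (begin
      X + p * a * Y + p * a * (Z + a * W)
        ≡⟨ lemma₁ X Y Z W p a ⟩
      (X + p * a * Z) + p * a * (Y + a * W)
        ≡⟨ cong₂ _+_ (surjections-suc n (suc d)) (cong (p * a *_) (surjections-suc n d)) ⟩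
      p * b * (p * a * Z) + p * a * (p * b * (a * W))
        ≡⟨ lemma₂ Z W p a b ⟩
      p * b * (p * a) * (Z + a * W)
        ≡⟨ cong (p * b * (p * a) *_) (surjections-sucʳ n d) ⟩
      p * b * (p * a) * (b * W)
        ≡⟨ lemma₃ W p a b ⟩
      p * b * (p * b * (a * W))
        ≡⟨ cong (p * b *_) (surjections-suc n d) ⟨
      p * b * (Y + a * W)
        ≡⟨ lemma₄ Y W p a b ⟩
      p * b * Y + p * a * (b * W)
        ≡⟨ cong (λ k → p * b * Y + p * a * k) (surjections-sucʳ n d) ⟨
      p * b * Y + p * a * (Z + a * W) ∎)
      where
      open ≡-Reasoning
      X = s (suc n) (suc (suc d))
      Y = s (suc n) (suc d)
      Z = s n (suc d)
      W = s n d
      a = p ^ d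
      b = p ^ n
      lemma₁ : ∀ X Y Z W p a → X + p * a * Y + p * a * (Z + a * W) ≡ (X + p * a * Z) + p * a * (Y + a * W)
      lemma₁ = solve-∀
      lemma₂ : ∀ Z W p a b → p * b * (p * a * Z) + p * a * (p * b * (a * W)) ≡ p * b * (p * a) * (Z + a * W)
      lemma₂ = solve-∀
      lemma₃ : ∀ W p a b → p * b * (p * a) * (b * W) ≡ p * b * (p * b * (a * W))
      lemma₃ = solve-∀
      lemma₄ : ∀ Y W p a b → p * b * (Y + a * W) ≡ p * b * Y + p * a * (b * W)
      lemma₄ = solve-∀

    -- In subtraction-free form, s(n+1, d+1) = (p^(n+1) - 1) p^d s(n, d): the first row is any
    -- nonzero vector, and the other d rows are independent modulo it, each with p lifts.
    surjections-suc : ∀ n d → s (suc n) (suc d) + p ^ d * s n d ≡ p ^ suc n * (p ^ d * s n d)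
    surjections-suc n d = begin
      s n (suc d) + r * (p ^ n * s n d) + p ^ d * s n d
        ≡⟨ lemma (s n (suc d)) (r * (p ^ n * s n d)) (p ^ d * s n d) ⟩
      (s n (suc d) + p ^ d * s n d) + r * (p ^ n * s n d)
        ≡⟨ cong (_+ r * (p ^ n * s n d)) (surjections-sucʳ n d) ⟩
      p ^ n * s n d + r * (p ^ n * s n d)
        ≡⟨ lemma' r (p ^ n * s n d) ⟩
      (r + 1) * (p ^ n * s n d)
        ≡⟨ cong (_* (p ^ n * s n d)) (p^∸1+1 (suc d)) ⟩
      p ^ suc d * (p ^ n * s n d)
        ≡⟨ lemma'' p (p ^ d) (p ^ n) (s n d) ⟩
      p ^ suc n * (p ^ d * s n d) ∎
      where
      open ≡-Reasoning
      r = p ^ suc d ∸ 1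
      lemma : ∀ a b c → a + b + c ≡ (a + c) + b
      lemma = solve-∀
      lemma' : ∀ r k → k + r * k ≡ (r + 1) * k
      lemma' = solve-∀
      lemma'' : ∀ a b c d → a * b * (c * d) ≡ a * c * (b * d)
      lemma'' = solve-∀

  -- Phrased for a nonzero count, because in comparing ranks it is an exhibited generating tuple
  -- that makes the count nonzero.
  surjections≢0⇒≤ : ∀ n d → s n d ≢ 0 → d ≤ n
  surjections≢0⇒≤ n       zero    ≢0 = z≤n
  surjections≢0⇒≤ zero    (suc d) ≢0 = contradiction ≡.refl ≢0
  surjections≢0⇒≤ (suc n) (suc d) ≢0 = s≤s (surjections≢0⇒≤ n d λ eq → ≢0 (+-cancelʳ-≡ (p ^ d * s n d) _ 0
    (≡.trans (surjections-suc n d) (≡.trans (cong (λ k → p ^ suc n * (p ^ d * k)) eq)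
      (≡.trans (cong (p ^ suc n *_) (*-zeroʳ (p ^ d))) (≡.trans (*-zeroʳ (p ^ suc n))
        (≡.sym (≡.trans (cong (p ^ d *_) eq) (*-zeroʳ (p ^ d))))))))))

  surjections-diagonal≢0 : 1 < p → ∀ n → s n n ≢ 0
  surjections-diagonal≢0 1<p zero    ()
  surjections-diagonal≢0 1<p (suc n) eq = <⇒≢ small (≡.trans (≡.sym (cong (_+ p ^ n * s n n) eq)) (surjections-suc n n))
    where
    instance
      s-nonZero : NonZero (p ^ n * s n n)
      s-nonZero = m*n≢0 (p ^ n) (s n n) ⦃ m^n≢0 p n ⦄ ⦃ ≢-nonZero (surjections-diagonal≢0 1<p n) ⦄
    small : p ^ n * s n n < p ^ suc n * (p ^ n * s n n)
    small = <-≤-trans (m<m*n _ (p ^ suc n) (<-≤-trans 1<p (m≤m*n p (p ^ n) ⦃ m^n≢0 p n ⦄)))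
                      (≤-reflexive (*-comm (p ^ n * s n n) (p ^ suc n)))

  ∏⟨_⟩ : (ℕ → ℕ) → ℕ → ℕ → ℕ
  ∏⟨ f ⟩ m zero    = 1
  ∏⟨ f ⟩ m (suc d) = f m * ∏⟨ f ⟩ (suc m) d

  -- For n = m + d this is s(n, d) = p^(nd) ∏ (1 - p^(-k)) over m < k ≤ n, with denominators
  -- cleared. Each step of the row recursion contributes p^n - p^d = p^d (p^(n-d) - 1).
  surjections-closed : ∀ m d →
    s (m + d) d * ∏⟨ p ^_ ⟩ (suc m) d ≡ p ^ ((m + d) * d) * ∏⟨ (λ k → p ^ k ∸ 1) ⟩ (suc m) d
  surjections-closed m zero    = ≡.trans (cong (_* 1) (surjections-0 (m + 0)))
    (≡.sym (cong (λ k → p ^ k * 1) (*-zeroʳ (m + 0))))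
  surjections-closed m (suc d) = begin
    s (m + suc d) (suc d) * (p ^ suc m * D)
      ≡⟨ cong (λ n → s n (suc d) * (p ^ suc m * D)) (+-suc m d) ⟩
    s n (suc d) * (p ^ suc m * D)
      ≡⟨ cong (_* (p ^ suc m * D)) step ⟩
    p ^ d * t * s n d * (p ^ suc m * D)
      ≡⟨ lemma (p ^ d) t (s n d) (p ^ suc m) D ⟩
    p ^ suc m * p ^ d * t * (s n d * D)
      ≡⟨ cong₂ (λ k l → k * t * l) (≡.sym (^-distribˡ-+-* p (suc m) d)) (surjections-closed (suc m) d) ⟩
    p ^ n * t * (p ^ (n * d) * E)
      ≡⟨ lemma' (p ^ n) t (p ^ (n * d)) E ⟩
    p ^ n * p ^ (n * d) * (t * E)
      ≡⟨ cong (_* (t * E)) (^-distribˡ-+-* p n (n * d)) ⟨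
    p ^ (n + n * d) * (t * E)
      ≡⟨ cong (λ k → p ^ k * (t * E)) (*-suc n d) ⟨
    p ^ (n * suc d) * (t * E)
      ≡⟨ cong (λ k → p ^ (k * suc d) * (t * E)) (+-suc m d) ⟨
    p ^ ((m + suc d) * suc d) * (t * E) ∎
    where
    open ≡-Reasoning
    n = suc m + d
    t = p ^ suc m ∸ 1
    D = ∏⟨ p ^_ ⟩ (suc (suc m)) d
    E = ∏⟨ (λ k → p ^ k ∸ 1) ⟩ (suc (suc m)) d
    lemma : ∀ a t s b D → a * t * s * (b * D) ≡ b * a * t * (s * D)
    lemma = solve-∀
    lemma' : ∀ a t b E → a * t * (b * E) ≡ a * b * (t * E)
    lemma' = solve-∀
    expand : ∀ t a s → (t + 1) * a * s ≡ a * t * s + a * s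
    expand = solve-∀
    step : s n (suc d) ≡ p ^ d * t * s n d
    step = +-cancelʳ-≡ (p ^ d * s n d) _ _ (begin
      s n (suc d) + p ^ d * s n d             ≡⟨ surjections-sucʳ n d ⟩
      p ^ n * s n d                           ≡⟨ cong (_* s n d) (^-distribˡ-+-* p (suc m) d) ⟩
      p ^ suc m * p ^ d * s n d               ≡⟨ cong (λ k → k * p ^ d * s n d) (p^∸1+1 (suc m)) ⟨
      (t + 1) * p ^ d * s n d                 ≡⟨ expand t (p ^ d) (s n d) ⟩
      p ^ d * t * s n d + p ^ d * s n d       ∎)

-- Fractions, and the passage from the count to the measure

/-cross : ∀ {a b c d} .⦃ _ : NonZero b ⦄ .⦃ _ : NonZero d ⦄ → a * d ≡ c * b → + a / b ≡ + c / d
/-cross {a} {suc b} {c} {suc d} eq = ℚ.fromℚᵘ-cong {mkℚᵘ (+ a) b} {mkℚᵘ (+ c) d}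
  (*≡* (≡.trans (≡.sym (ℤ.pos-* a (suc d))) (≡.trans (cong +_ eq) (ℤ.pos-* c (suc b)))))

toℚᵘ-/ : ∀ a b → toℚᵘ (a / suc b) ℚᵘ.≃ mkℚᵘ a b
toℚᵘ-/ a b = ℚ.toℚᵘ-fromℚᵘ (mkℚᵘ a b)

/-* : ∀ {a b c d} .⦃ _ : NonZero b ⦄ .⦃ _ : NonZero d ⦄ .⦃ _ : NonZero (b * d) ⦄ →
      (+ a / b) *ℚ (+ c / d) ≡ + (a * c) / (b * d)
/-* {a} {suc b} {c} {suc d} = ℚ.toℚᵘ-injective (begin
  toℚᵘ ((+ a / suc b) *ℚ (+ c / suc d))               ≈⟨ ℚ.toℚᵘ-homo-* (+ a / suc b) (+ c / suc d) ⟩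
  toℚᵘ (+ a / suc b) ℚᵘ.* toℚᵘ (+ c / suc d)          ≈⟨ ℚᵘ.*-cong (toℚᵘ-/ (+ a) b) (toℚᵘ-/ (+ c) d) ⟩
  mkℚᵘ (+ a) b ℚᵘ.* mkℚᵘ (+ c) d                      ≡⟨ cong (λ z → mkℚᵘ z (d + b * suc d)) (ℤ.pos-* a c) ⟨
  mkℚᵘ (+ (a * c)) (d + b * suc d)                    ≈⟨ toℚᵘ-/ (+ (a * c)) (d + b * suc d) ⟨
  toℚᵘ (+ (a * c) / (suc b * suc d))                  ∎)
  where open ℚᵘ.≃-Reasoning

1-1/ : ∀ b .⦃ _ : NonZero b ⦄ → 1ℚ - (+ 1 / b) ≡ + (b ∸ 1) / b
1-1/ (suc b) = ℚ.toℚᵘ-injective (begin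
  toℚᵘ (1ℚ - (+ 1 / suc b))
    ≈⟨ ℚ.toℚᵘ-homo-+ 1ℚ (ℚ.- (+ 1 / suc b)) ⟩
  toℚᵘ 1ℚ ℚᵘ.+ toℚᵘ (ℚ.- (+ 1 / suc b))
    ≈⟨ ℚᵘ.+-congʳ (toℚᵘ 1ℚ) (ℚ.toℚᵘ-homo‿- (+ 1 / suc b)) ⟩
  toℚᵘ 1ℚ ℚᵘ.+ (ℚᵘ.- toℚᵘ (+ 1 / suc b))
    ≈⟨ ℚᵘ.+-congʳ (toℚᵘ 1ℚ) (ℚᵘ.-‿cong (toℚᵘ-/ (+ 1) b)) ⟩
  toℚᵘ 1ℚ ℚᵘ.+ (ℚᵘ.- mkℚᵘ (+ 1) b)
    ≈⟨ *≡* cross ⟩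
  mkℚᵘ (+ b) b
    ≈⟨ toℚᵘ-/ (+ b) b ⟨
  toℚᵘ (+ b / suc b) ∎)
  where
  open ℚᵘ.≃-Reasoning
  cross : ((+ 1) ℤ.* (+ suc b) ℤ.+ ℤ.- (+ 1) ℤ.* (+ 1)) ℤ.* (+ suc b) ≡ (+ b) ℤ.* (+ (1 * suc b))
  cross = cong₂ (λ k l → k ℤ.* (+ l)) (cong (ℤ._+ ℤ.- (+ 1)) (ℤ.*-identityˡ (+ suc b))) (≡.sym (*-identityˡ (suc b)))

module Measure (p : ℕ) (pr : Prime p) where
  private
    instance
      p-nonZero : NonZero p
      p-nonZero = prime⇒nonZero pr
  open Surjections p public

  ∏p^ ∏p^∸1 : ℕ → ℕ → ℕ
  ∏p^   = ∏⟨ p ^_ ⟩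
  ∏p^∸1 = ∏⟨ (λ k → p ^ k ∸ 1) ⟩

  ∏p^≢0 : ∀ m d → NonZero (∏p^ m d)
  ∏p^≢0 m zero    = _
  ∏p^≢0 m (suc d) = m*n≢0 (p ^ m) _ ⦃ m^n≢0 p m ⦄ ⦃ ∏p^≢0 (suc m) d ⦄

  ∏-1-p^- : ∀ lo hi → ∏[ lo ⋯ hi ] (1-p^- pr) ≡ (+ ∏p^∸1 lo (suc hi ∸ lo) / ∏p^ lo (suc hi ∸ lo)) ⦃ ∏p^≢0 lo (suc hi ∸ lo) ⦄
  ∏-1-p^- lo hi = ≡.trans
    (cong (foldr _*ℚ_ 1ℚ) (map-applyUpTo id (λ i → 1-p^- pr (lo + i)) (suc hi ∸ lo)))
    (product (suc hi ∸ lo) lo (λ i → 1-p^- pr (lo + i)) (λ i → ≡.refl))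
    where
    product : ∀ d m (f : ℕ → ℚ) → (∀ i → f i ≡ 1-p^- pr (m + i)) →
              foldr _*ℚ_ 1ℚ (applyUpTo f d) ≡ (+ ∏p^∸1 m d / ∏p^ m d) ⦃ ∏p^≢0 m d ⦄
    product zero    m f f≗ = ≡.refl
    product (suc d) m f f≗ = ≡.trans
      (cong₂ _*ℚ_ (≡.trans (≡.trans (f≗ 0) (cong (1-p^- pr) (+-identityʳ m))) (1-1/ (p ^ m) ⦃ m^n≢0 p m ⦄))
                  (product d (suc m) (f ∘ suc) (λ i → ≡.trans (f≗ (suc i)) (cong (1-p^- pr) (+-suc m i)))))
      (/-* {p ^ m ∸ 1} {p ^ m} {∏p^∸1 (suc m) d} {∏p^ (suc m) d}
           ⦃ m^n≢0 p m ⦄ ⦃ ∏p^≢0 (suc m) d ⦄ ⦃ ∏p^≢0 m (suc d) ⦄)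

  -- The intended values: t is the number of presentations, a = |Aut G|, γ = |G|, γ' = |pG|, φ =
  -- |Φ(𝔸)|; ρ and ρ' are the orders of a kernel H and of pH, and w is the dimension of H/pH.
  module _ {g w a γ γ' ρ ρ' φ t : ℕ} (w≤g : w ≤ g)
           (count : t * a ≡ (γ' ^ g * surjections p g g) * (ρ' ^ suc g * surjections p (suc g) w))
           (γ-eq : γ ≡ p ^ g * γ') (ρ-eq : ρ ≡ p ^ w * ρ') (γρ-eq : γ * ρ ≡ p ^ g * φ) where
    private
      lo = g + 2 ∸ w
      -- The second product has the w exponents m + 1, ..., g + 1; by w ≤ g the truncated
      -- subtractions are exact.
      m = suc g ∸ w

      lo≡ : lo ≡ suc m
      lo≡ = ≡.trans (cong (_∸ w) (+-comm g 2)) (+-∸-assoc 1 {suc g} {w} (m≤n⇒m≤1+n w≤g))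

      m+w : m + w ≡ suc g
      m+w = m∸n+n≡m (m≤n⇒m≤1+n w≤g)

      D₁ = ∏p^ 1 g
      E₁ = ∏p^∸1 1 g
      D₂ = ∏p^ (suc m) w
      E₂ = ∏p^∸1 (suc m) w
      s₁ = surjections p g g
      s₂ = surjections p (suc g) w

      closed₂ : s₂ * D₂ ≡ p ^ (suc g * w) * E₂
      closed₂ = subst (λ n → surjections p n w * D₂ ≡ p ^ (n * w) * E₂) m+w (surjections-closed m w)

    -- The powers of p in the closed forms turn γ'^g into γ^g and ρ'^(g+1) into ρ^(g+1). The factor
    -- γ in the denominator of the formula completes γ^g to γ^(g+1), and (γ ρ)^(g+1) = (p^g
    -- φ)^(g+1).
    measure-identity : t * (a * γ * 1 * D₁ * D₂) ≡ 1 * p ^ (g * (g + 1)) * E₁ * E₂ * φ ^ suc g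
    measure-identity = begin
      t * (a * γ * 1 * D₁ * D₂)
        ≡⟨ lemma₁ t a γ D₁ D₂ ⟩
      t * a * γ * D₁ * D₂
        ≡⟨ cong (λ k → k * γ * D₁ * D₂) count ⟩
      (γ' ^ g * s₁) * (ρ' ^ suc g * s₂) * γ * D₁ * D₂
        ≡⟨ lemma₂ (γ' ^ g) s₁ (ρ' ^ suc g) s₂ γ D₁ D₂ ⟩
      γ' ^ g * ρ' ^ suc g * γ * (s₁ * D₁) * (s₂ * D₂)
        ≡⟨ cong₂ (λ k l → γ' ^ g * ρ' ^ suc g * γ * k * l) (surjections-closed 0 g) closed₂ ⟩
      γ' ^ g * ρ' ^ suc g * γ * (p ^ (g * g) * E₁) * (p ^ (suc g * w) * E₂)
        ≡⟨ cong₂ (λ k l → γ' ^ g * ρ' ^ suc g * γ * (k * E₁) * (l * E₂)) (≡.sym (^-*-assoc p g g))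
             (≡.trans (cong (p ^_) (*-comm (suc g) w)) (≡.sym (^-*-assoc p w (suc g)))) ⟩
      γ' ^ g * ρ' ^ suc g * γ * ((p ^ g) ^ g * E₁) * ((p ^ w) ^ suc g * E₂)
        ≡⟨ lemma₃ (γ' ^ g) (ρ' ^ suc g) γ ((p ^ g) ^ g) E₁ ((p ^ w) ^ suc g) E₂ ⟩
      γ * ((p ^ g) ^ g * γ' ^ g) * ((p ^ w) ^ suc g * ρ' ^ suc g) * (E₁ * E₂)
        ≡⟨ cong₂ (λ k l → γ * k * l * (E₁ * E₂)) (power g (p ^ g) γ' γ-eq) (power (suc g) (p ^ w) ρ' ρ-eq) ⟩
      γ ^ suc g * ρ ^ suc g * (E₁ * E₂)
        ≡⟨ cong (_* (E₁ * E₂)) (power (suc g) γ ρ ≡.refl) ⟩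
      (γ * ρ) ^ suc g * (E₁ * E₂)
        ≡⟨ cong (_* (E₁ * E₂)) (power (suc g) (p ^ g) φ γρ-eq) ⟨
      (p ^ g) ^ suc g * φ ^ suc g * (E₁ * E₂)
        ≡⟨ cong (λ k → k * φ ^ suc g * (E₁ * E₂))
                (≡.trans (^-*-assoc p g (suc g)) (cong (λ n → p ^ (g * n)) (+-comm 1 g))) ⟩
      p ^ (g * (g + 1)) * φ ^ suc g * (E₁ * E₂)
        ≡⟨ lemma₄ (p ^ (g * (g + 1))) (φ ^ suc g) E₁ E₂ ⟩
      1 * p ^ (g * (g + 1)) * E₁ * E₂ * φ ^ suc g ∎
      where
      open ≡-Reasoning
      power : ∀ k {n} a b → n ≡ a * b → a ^ k * b ^ k ≡ n ^ k
      power k a b ≡.refl = ≡.sym (^-distribʳ-* k a b)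
      lemma₁ : ∀ t a γ x y → t * (a * γ * 1 * x * y) ≡ t * a * γ * x * y
      lemma₁ = solve-∀
      lemma₂ : ∀ a b c d e x y → (a * b) * (c * d) * e * x * y ≡ a * c * e * (b * x) * (d * y)
      lemma₂ = solve-∀
      lemma₃ : ∀ a b c x y z v → a * b * c * (x * y) * (z * v) ≡ c * (x * a) * (z * b) * (y * v)
      lemma₃ = solve-∀
      lemma₄ : ∀ a b x y → a * b * (x * y) ≡ 1 * a * x * y * b
      lemma₄ = solve-∀

    -- The two fractions are kept behind equations: unfolding them in a conversion check is expensive.
    measure-ratio : .⦃ _ : NonZero (a * γ) ⦄ .⦃ _ : NonZero (φ ^ suc g) ⦄ →
      ∀ {x z} → x ≡ + 1 / (a * γ) → z ≡ + t / φ ^ suc g →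
      x *ℚ (+ (p ^ (g * (g + 1))) / 1) *ℚ ∏[ 1 ⋯ g ] (1-p^- pr) *ℚ ∏[ lo ⋯ g + 1 ] (1-p^- pr) ≡ z
    measure-ratio {x} {z} x≡ z≡ = begin
      x *ℚ (+ (p ^ (g * (g + 1))) / 1) *ℚ ∏[ 1 ⋯ g ] (1-p^- pr) *ℚ ∏[ lo ⋯ g + 1 ] (1-p^- pr)
        ≡⟨ cong₂ (λ k l → k *ℚ ∏[ 1 ⋯ g ] (1-p^- pr) *ℚ l)
             (≡.trans (cong (_*ℚ (+ (p ^ (g * (g + 1))) / 1)) x≡) (/-* {1} {a * γ} {p ^ (g * (g + 1))} {1})) second ⟩
      (+ (1 * p ^ (g * (g + 1))) / (a * γ * 1)) *ℚ ∏[ 1 ⋯ g ] (1-p^- pr) *ℚ (+ E₂ / D₂)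
        ≡⟨ cong (λ k → (+ (1 * p ^ (g * (g + 1))) / (a * γ * 1)) *ℚ k *ℚ (+ E₂ / D₂)) (∏-1-p^- 1 g) ⟩
      (+ (1 * p ^ (g * (g + 1))) / (a * γ * 1)) *ℚ (+ E₁ / D₁) *ℚ (+ E₂ / D₂)
        ≡⟨ cong (_*ℚ (+ E₂ / D₂)) (/-* {1 * p ^ (g * (g + 1))} {a * γ * 1} {E₁} {D₁}) ⟩
      (+ (1 * p ^ (g * (g + 1)) * E₁) / (a * γ * 1 * D₁)) *ℚ (+ E₂ / D₂)
        ≡⟨ /-* {1 * p ^ (g * (g + 1)) * E₁} {a * γ * 1 * D₁} {E₂} {D₂} ⟩
      + (1 * p ^ (g * (g + 1)) * E₁ * E₂) / (a * γ * 1 * D₁ * D₂)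
        ≡⟨ /-cross {1 * p ^ (g * (g + 1)) * E₁ * E₂} {a * γ * 1 * D₁ * D₂} {t} {φ ^ suc g} (≡.sym measure-identity) ⟩
      + t / φ ^ suc g
        ≡⟨ z≡ ⟨
      z ∎
      where
      open ≡-Reasoning
      instance
        nz₀ : NonZero (a * γ * 1)
        nz₀ = m*n≢0 (a * γ) 1
        nz-D₁ : NonZero D₁
        nz-D₁ = ∏p^≢0 1 g
        nz₁ : NonZero (a * γ * 1 * D₁)
        nz₁ = m*n≢0 (a * γ * 1) D₁
        nz-D₂ : NonZero D₂
        nz-D₂ = ∏p^≢0 (suc m) w
        nz₂ : NonZero (a * γ * 1 * D₁ * D₂)
        nz₂ = m*n≢0 (a * γ * 1 * D₁) D₂
      width : suc (g + 1) ∸ suc m ≡ w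
      width = ≡.trans (cong (_∸ m) (≡.trans (+-comm g 1) (≡.sym m+w))) (m+n∸m≡n m w)
      second : ∏[ lo ⋯ g + 1 ] (1-p^- pr) ≡ + E₂ / D₂
      second = begin
        ∏[ lo ⋯ g + 1 ] (1-p^- pr)    ≡⟨ cong (λ k → ∏[ k ⋯ g + 1 ] (1-p^- pr)) lo≡ ⟩
        ∏[ suc m ⋯ g + 1 ] (1-p^- pr) ≡⟨ ∏-1-p^- (suc m) (g + 1) ⟩
        (+ ∏p^∸1 (suc m) (suc (g + 1) ∸ suc m) / ∏p^ (suc m) (suc (g + 1) ∸ suc m)) ⦃ ∏p^≢0 (suc m) (suc (g + 1) ∸ suc m) ⦄
          ≡⟨ cong (λ d → (+ ∏p^∸1 (suc m) d / ∏p^ (suc m) d) ⦃ ∏p^≢0 (suc m) d ⦄) width ⟩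
        + E₂ / D₂ ∎

-- Isomorphisms and automorphisms

module _ {A B : AbelianGroup 0ℓ 0ℓ} {f : AbelianGroup.Carrier A → AbelianGroup.Carrier B} where
  private
    module A = AbelianGroup A
    module B = AbelianGroup B

  hom⇒isGroupHomomorphism : IsHom A B f → IsGroupHomomorphism (Group.rawGroup A.group) (Group.rawGroup B.group) f
  hom⇒isGroupHomomorphism hom = record
    { isMonoidHomomorphism = record
      { isMagmaHomomorphism = record { isRelHomomorphism = record { cong = f-cong } ; homo = f-∙ }
      ; ε-homo = f-ε
      }
    ; ⁻¹-homo = f-⁻¹
    }
    where open IsHom hom

  hom⇒isGroupIsomorphism : IsHom A B f → (∀ {x y} → f x B.≈ f y → x A.≈ y) → (∀ z → ∃ λ x → f x B.≈ z) →
                       IsGroupIsomorphism (Group.rawGroup A.group) (Group.rawGroup B.group) f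
  hom⇒isGroupIsomorphism hom inj surj = record
    { isGroupMonomorphism = record { isGroupHomomorphism = hom⇒isGroupHomomorphism hom ; injective = inj }
    ; surjective = λ z → let (x , fx≈z) = surj z in x , λ w≈x → B.trans (IsHom.f-cong hom w≈x) fx≈z
    }

  isHom : IsGroupHomomorphism (Group.rawGroup A.group) (Group.rawGroup B.group) f → IsHom A B f
  isHom hom = record { f-cong = ⟦⟧-cong ; f-∙ = homo }
    where open IsGroupHomomorphism hom

module _ {A B C : AbelianGroup 0ℓ 0ℓ} where
  private
    module A = AbelianGroup A
    module B = AbelianGroup B
    module C = AbelianGroup C

  ∘-isHom : ∀ {f : B.Carrier → C.Carrier} {h : A.Carrier → B.Carrier} →
            IsHom B C f → IsHom A B h → IsHom A C (f ∘ h)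
  ∘-isHom {f} {h} F H = record
    { f-cong = λ x≈y → F.f-cong (H.f-cong x≈y)
    ; f-∙    = λ x y → C.trans (F.f-cong (H.f-∙ x y)) (F.f-∙ (h x) (h y))
    }
    where
    module F = IsHom F
    module H = IsHom H

  ≅-∘ : AbelianGroup.group B ≅ AbelianGroup.group C → AbelianGroup.group A ≅ AbelianGroup.group B →
        AbelianGroup.group A ≅ AbelianGroup.group C
  ≅-∘ (f , f-iso) (h , h-iso) = f ∘ h , hom⇒isGroupIsomorphism {A} {C}
    (∘-isHom (isHom {B} {C} F.isGroupHomomorphism) (isHom {A} {B} H.isGroupHomomorphism))
    (λ eq → H.injective (F.injective eq))
    (λ z → let (y , y≈) = F.surjective z
               (x , x≈) = H.surjective y
           in x , y≈ (x≈ A.refl))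
    where
    module F = IsGroupIsomorphism f-iso
    module H = IsGroupIsomorphism h-iso

module _ (G : AbelianGroup 0ℓ 0ℓ) (finG : Finite (AbelianGroup.setoid G)) where
  private
    module G = AbelianGroup G
    open FiniteAbelian G (enumFinite finG)
    open Inverse (Finite.enum finG)

    Bijective : (G.Carrier → G.Carrier) → Set
    Bijective f = (∀ x y → f (x G.∙ y) G.≈ f x G.∙ f y)
                ∧ (∀ x y → f x G.≈ f y → x G.≈ y)
                ∧ (∀ z → ∃ λ x → f x G.≈ z)

    bijective-resp : ∀ {f h} → (∀ x → f x G.≈ h x) → Bijective f → Bijective h
    bijective-resp f≈h (homo , inj , surj) =
      (λ x y → G.trans (G.sym (f≈h _)) (G.trans (homo x y) (G.∙-cong (f≈h x) (f≈h y)))) ,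
      (λ x y hx≈hy → inj x y (G.trans (f≈h x) (G.trans hx≈hy (G.sym (f≈h y))))) ,
      (λ z → let (x , fx≈z) = surj z in x , G.trans (G.sym (f≈h x)) fx≈z)

    bijective? : ∀ f → (∀ {x y} → x G.≈ y → f x G.≈ f y) → Dec (Bijective f)
    bijective? f f-cong =
      all? (λ x≈x' h y → G.trans (f-cong (G.∙-congʳ (G.sym x≈x'))) (G.trans (h y) (G.∙-congʳ (f-cong x≈x'))))
        (λ x → all? (λ y≈y' h → G.trans (f-cong (G.∙-congˡ (G.sym y≈y'))) (G.trans h (G.∙-congˡ (f-cong y≈y'))))
          (λ y → f (x G.∙ y) ≟ f x G.∙ f y))
      ×-dec all? (λ x≈x' h y fx'≈fy → G.trans (G.sym x≈x') (h y (G.trans (f-cong x≈x') fx'≈fy)))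
        (λ x → all? (λ y≈y' h fx≈fy' → G.trans (h (G.trans fx≈fy' (f-cong (G.sym y≈y')))) y≈y')
          (λ y → f x ≟ f y →-dec x ≟ y))
      ×-dec all? (λ z≈z' (x , fx≈z) → x , G.trans fx≈z z≈z')
        (λ z → any? (λ x≈x' fx≈z → G.trans (f-cong (G.sym x≈x')) fx≈z) (λ x → f x ≟ z))

    tabulated-cong : (f : Fin (size finG) → G.Carrier) → ∀ {x y} → x G.≈ y → f (from x) G.≈ f (from y)
    tabulated-cong f x≈y = G.reflexive (cong f (from-cong x≈y))

    toAut : (f : Fin (size finG) → G.Carrier) → Bijective (f ∘ from) → G.group ≅ G.group
    toAut f (homo , inj , surj) = f ∘ from ,
      hom⇒isGroupIsomorphism {G} {G} (record { f-cong = tabulated-cong f ; f-∙ = homo }) (inj _ _) surj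

    tabulateAut : G.group ≅ G.group → Fin (size finG) → G.Carrier
    tabulateAut (α , _) i = α (to i)

    α-to-from : ((α , _) : G.group ≅ G.group) → ∀ x → α (to (from x)) G.≈ α x
    α-to-from (α , iso) x = IsGroupIsomorphism.⟦⟧-cong iso (strictlyInverseˡ x)

    tabulateAut-bijective : ∀ α → Bijective (tabulateAut α ∘ from)
    tabulateAut-bijective α@(_ , iso) = bijective-resp (λ x → G.sym (α-to-from α x))
      (I.∙-homo , (λ _ _ → I.injective) , λ z → let (x , x≈) = I.surjective z in x , x≈ G.refl)
      where module I = IsGroupIsomorphism iso

    tabulateAut-injective : ∀ {α β} → (∀ i → tabulateAut α i G.≈ tabulateAut β i) → ∀ x → proj₁ α x G.≈ proj₁ β x
    tabulateAut-injective {α} {β} eq x =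
      G.trans (G.sym (α-to-from α x)) (G.trans (eq (from x)) (α-to-from β x))

    -- An automorphism is encoded as its table of values on the listed elements. A table composed
    -- with `from` respects equality for free, as equal elements have the same index, so only the
    -- conditions in `Bijective` remain to be decided.
    module Automorphisms = Subset (enumΠ {n = size finG} (λ _ → enumFinite finG)) (Aut G.group)
      (λ f → bijective? (f ∘ from) (tabulated-cong f))
      (λ f≈h → bijective-resp (λ x → f≈h (from x)))
      toAut tabulateAut tabulateAut-bijective
      (λ α≈β i → α≈β (to i))
      (λ {α} {β} → tabulateAut-injective {α} {β})
      (λ f _ i → G.reflexive (cong f (strictlyInverseʳ i)))

  abstract
    enumAut : Enum (Aut G.group)
    enumAut = Automorphisms.enum

module _ {A B : AbelianGroup 0ℓ 0ℓ} {f : AbelianGroup.Carrier A → AbelianGroup.Carrier B} where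

-- Presentations of G as a quotient of 𝔸 by g + 1 elements

module Presenting (p : ℕ) (pr : Prime p) (e g : ℕ)
  (𝔸 : AbelianGroup 0ℓ 0ℓ) (E𝔸 : Enum (AbelianGroup.setoid 𝔸))
  (torsion𝔸 : ∀ x → AbelianGroup._≈_ 𝔸 (Multiples._×_ 𝔸 (p ^ suc e) x) (AbelianGroup.ε 𝔸))
  (G : AbelianGroup 0ℓ 0ℓ) (EG : Enum (AbelianGroup.setoid G))
  (torsionG : ∀ x → AbelianGroup._≈_ G (Multiples._×_ G (p ^ suc e) x) (AbelianGroup.ε G))
  (basis : Fin g → AbelianGroup.Carrier 𝔸)
  where

  module 𝔸 = AbelianGroup 𝔸
  module G = AbelianGroup G
  module P𝔸 = PGroup p pr (suc e) 𝔸 E𝔸 torsion𝔸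
  module PG = PGroup p pr (suc e) G EG torsionG

  -- What the count uses of 𝔸 ≅ (ℤ/p^(e+1))^g: its basis maps freely to G, |𝔸[p]| = p^g and 𝔸[p] ⊆
  -- p^e 𝔸. The level is c' = e + 1, and w will be the dimension of ker φ_y modulo p.
  module WithBasis
    (basis-spans : ∀ x → x P𝔸.∈ₛ P𝔸.span P𝔸.trivial basis)
    (extend : (y : Fin g → G.Carrier) →
              Σ[ f ∈ (𝔸.Carrier → G.Carrier) ] (IsHom 𝔸 G f ∧ (∀ k → f (basis k) G.≈ y k)))
    (p-torsion-divisible : ∀ x → p P𝔸.× x 𝔸.≈ 𝔸.ε → ∃ λ y → (p ^ e) P𝔸.× y 𝔸.≈ x)
    (card-p-torsion𝔸 : P𝔸.card-sub (P𝔸.torsionₚ P𝔸.whole) ≡ p ^ g)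
    (card-p-torsionG : PG.card-sub (PG.torsionₚ PG.whole) ≡ p ^ g)
    (generated : ∃ λ (y : Fin g → G.Carrier) → PG.span PG.trivial y PG.≐ₛ PG.whole)
    (w : ℕ) (card-p^e-G : PG.card-sub (image EG EG (×-isHom G (p ^ e)) PG.whole) * p ^ w ≡ p ^ g)
    where

    φ : (Fin g → G.Carrier) → 𝔸.Carrier → G.Carrier
    φ y = proj₁ (extend y)

    φ-isHom : ∀ y → IsHom 𝔸 G (φ y)
    φ-isHom y = proj₁ (proj₂ (extend y))

    φ-basis : ∀ y k → φ y (basis k) G.≈ y k
    φ-basis y = proj₂ (proj₂ (extend y))

    hom-unique : ∀ {f h} → IsHom 𝔸 G f → IsHom 𝔸 G h → (∀ k → f (basis k) G.≈ h (basis k)) → ∀ x → f x G.≈ h x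
    hom-unique {f} {h} F H eq x = P𝔸.span-min P𝔸.trivial basis equalizer
      (λ z≈ε → G.trans (F.f-cong z≈ε) (G.trans F.f-ε (G.trans (G.sym H.f-ε) (H.f-cong (𝔸.sym z≈ε)))))
      eq (basis-spans x)
      where
      module F = IsHom F
      module H = IsHom H
      equalizer : IsSubgroup 𝔸.group (λ z → f z G.≈ h z)
      equalizer = record
        { resp = λ x≈y eq → G.trans (F.f-cong (𝔸.sym x≈y)) (G.trans eq (H.f-cong x≈y))
        ; ε∈   = G.trans F.f-ε (G.sym H.f-ε)
        ; ∙∈   = λ {x} {y} p q → G.trans (F.f-∙ x y) (G.trans (G.∙-cong p q) (G.sym (H.f-∙ x y)))
        ; ⁻¹∈  = λ {x} p → G.trans (F.f-⁻¹ x) (G.trans (G.⁻¹-cong p) (G.sym (H.f-⁻¹ x)))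
        }

    φ-cong : ∀ {y y'} → (∀ k → y k G.≈ y' k) → ∀ x → φ y x G.≈ φ y' x
    φ-cong {y} {y'} y≈y' = hom-unique (φ-isHom y) (φ-isHom y')
      (λ k → G.trans (φ-basis y k) (G.trans (y≈y' k) (G.sym (φ-basis y' k))))

    ker : (Fin g → G.Carrier) → P𝔸.DecSubgroup
    ker y = kernel E𝔸 EG (φ-isHom y) P𝔸.whole

    ∈ker : ∀ {y x} → φ y x G.≈ G.ε → x P𝔸.∈ₛ ker y
    ∈ker eq = _ , eq

    Generating : (Fin g → G.Carrier) → Set
    Generating y = PG.span PG.trivial y PG.≐ₛ PG.whole

    surjective : ∀ {y} → Generating y → ∀ z → ∃ λ x → φ y x G.≈ z
    surjective {y} (_ , whole⊆) z =
      let (x , _ , eq) = PG.span-min PG.trivial y I.isSubgroup I.≈ε⇒∈ (λ k → basis k , _ , φ-basis y k) (whole⊆ {z} _)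
      in x , eq
      where module I = PG.DecSubgroup (image E𝔸 EG (φ-isHom y) P𝔸.whole)

    generating : ∀ {y} → (∀ z → ∃ λ x → φ y x G.≈ z) → Generating y
    generating {y} surj = _ , λ {z} _ →
      let (x , eq) = surj z
      in S.resp eq (P𝔸.span-min P𝔸.trivial basis preimage
           (λ z≈ε → S.≈ε⇒∈ (G.trans (f-cong z≈ε) f-ε))
           (λ k → S.resp (G.sym (φ-basis y k)) (PG.span-∋ PG.trivial y k)) (basis-spans x))
      where
      open IsHom (φ-isHom y)
      module S = PG.DecSubgroup (PG.span PG.trivial y)
      preimage : IsSubgroup 𝔸.group (λ x → φ y x PG.∈ₛ PG.span PG.trivial y)
      preimage = record
        { resp = λ x≈x' → S.resp (f-cong x≈x')
        ; ε∈   = S.≈ε⇒∈ f-ε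
        ; ∙∈   = λ {x} {x'} p q → S.resp (G.sym (f-∙ x x')) (S.∙∈ p q)
        ; ⁻¹∈  = λ {x} p → S.resp (G.sym (f-⁻¹ x)) (S.⁻¹∈ p)
        }

    γ γ' : ℕ
    γ  = PG.card
    γ' = PG.card-sub (PG.multiples PG.whole)

    γ≡ : γ ≡ p ^ g * γ'
    γ≡ = ≡.trans (≡.sym PG.card-whole) (≡.trans (PG.card-multiples*torsion PG.whole)
      (≡.trans (cong (γ' *_) card-p-torsionG) (*-comm γ' (p ^ g))))

    ϕ : ℕ
    ϕ = P𝔸.card-sub (P𝔸.multiples P𝔸.whole)

    card-𝔸 : P𝔸.card ≡ p ^ g * ϕ
    card-𝔸 = ≡.trans (≡.sym P𝔸.card-whole) (≡.trans (P𝔸.card-multiples*torsion P𝔸.whole)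
      (≡.trans (cong (ϕ *_) card-p-torsion𝔸) (*-comm ϕ (p ^ g))))

    instance
      γ-nonZero : NonZero γ
      γ-nonZero = ≢-nonZero (λ eq → PG.card-sub≢0 PG.whole (≡.trans PG.card-whole eq))

      γ'-nonZero : NonZero γ'
      γ'-nonZero = ≢-nonZero (PG.card-sub≢0 (PG.multiples PG.whole))

      p-nonZero : NonZero p
      p-nonZero = prime⇒nonZero pr

      p^w-nonZero : NonZero (p ^ w)
      p^w-nonZero = m^n≢0 p w

    module _ {y} (y-gen : Generating y) where
      private
        hom = φ-isHom y
        module hom = IsHom hom

      γ*ker : γ * P𝔸.card-sub (ker y) ≡ p ^ g * ϕ
      γ*ker = begin
        γ * P𝔸.card-sub (ker y)
          ≡⟨ cong (_* P𝔸.card-sub (ker y)) (≡.trans (≡.sym PG.card-whole) (PG.card-sub-cong {PG.whole} {Im} whole≐)) ⟩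
        PG.card-sub Im * P𝔸.card-sub (ker y)
          ≡⟨ card-image*kernel E𝔸 EG hom P𝔸.whole ⟨
        P𝔸.card-sub P𝔸.whole
          ≡⟨ ≡.trans P𝔸.card-whole card-𝔸 ⟩
        p ^ g * ϕ ∎
        where
        open ≡-Reasoning
        Im = image E𝔸 EG hom P𝔸.whole
        whole≐ : PG.whole PG.≐ₛ Im
        whole≐ = (λ {z} _ → let (x , eq) = surjective y-gen z in x , _ , eq) , _

      -- This is `card-image*kernel` for φ_y on 𝔸[p], whose image is p^e G: p^e 𝔸 ⊆ 𝔸[p] by the
      -- exponent of 𝔸, and 𝔸[p] ⊆ p^e 𝔸 by `p-torsion-divisible`.
      card-ker-p-torsion : P𝔸.card-sub (P𝔸.torsionₚ (ker y)) ≡ p ^ w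
      card-ker-p-torsion = *-cancelˡ-≡ _ _ (PG.card-sub p^eG) ⦃ ≢-nonZero (PG.card-sub≢0 p^eG) ⦄ (begin
        PG.card-sub p^eG * P𝔸.card-sub (P𝔸.torsionₚ (ker y))
          ≡⟨ cong₂ _*_ (PG.card-sub-cong {p^eG} {Im} (p^eG⊆ , ⊆p^eG))
               (P𝔸.card-sub-cong {P𝔸.torsionₚ (ker y)} {Ker} ((λ ((_ , q) , r) → (_ , r) , q) , (λ ((_ , r) , q) → (_ , q) , r))) ⟩
        PG.card-sub Im * P𝔸.card-sub Ker
          ≡⟨ card-image*kernel E𝔸 EG hom (P𝔸.torsionₚ P𝔸.whole) ⟨
        P𝔸.card-sub (P𝔸.torsionₚ P𝔸.whole)
          ≡⟨ ≡.trans card-p-torsion𝔸 (≡.sym card-p^e-G) ⟩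
        PG.card-sub p^eG * p ^ w ∎)
        where
        open ≡-Reasoning
        p^eG = image EG EG (×-isHom G (p ^ e)) PG.whole
        Im   = image E𝔸 EG hom (P𝔸.torsionₚ P𝔸.whole)
        Ker  = kernel E𝔸 EG hom (P𝔸.torsionₚ P𝔸.whole)
        p^eG⊆ : p^eG PG.⊆ₛ Im
        p^eG⊆ (b , _ , p^eb≈z) = let (a , φa≈b) = surjective y-gen b in
          (p ^ e) P𝔸.× a ,
          (_ , 𝔸.trans (P𝔸.×-assocˡ a p (p ^ e)) (torsion𝔸 a)) ,
          G.trans (hom.f-× (p ^ e) a) (G.trans (PG.×-congʳ (p ^ e) φa≈b) p^eb≈z)
        ⊆p^eG : Im PG.⊆ₛ p^eG
        ⊆p^eG (x , (_ , px≈ε) , φx≈z) = let (a , p^ea≈x) = p-torsion-divisible x px≈ε in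
          φ y a , _ , G.trans (G.sym (hom.f-× (p ^ e) a)) (G.trans (hom.f-cong p^ea≈x) φx≈z)

      card-ker : P𝔸.card-sub (ker y) ≡ p ^ w * P𝔸.card-sub (P𝔸.multiples (ker y))
      card-ker = ≡.trans (P𝔸.card-multiples*torsion (ker y))
        (≡.trans (cong (P𝔸.card-sub (P𝔸.multiples (ker y)) *_) card-ker-p-torsion) (*-comm _ (p ^ w)))

      -- φ_y maps p𝔸 onto pG, so its kernel on p𝔸 has order |p𝔸| / |pG|. This equals |𝔸| / |G|, the
      -- order of the whole kernel, so the two kernels coincide.
      ker⊆p𝔸 : ker y P𝔸.⊆ₛ P𝔸.multiples P𝔸.whole
      ker⊆p𝔸 x∈ = proj₁ (P𝔸.⊆ₛ∧card≡⇒⊇ₛ {Ker} {ker y} (λ (_ , eq) → _ , eq) cards x∈)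
        where
        open ≡-Reasoning
        p𝔸  = P𝔸.multiples P𝔸.whole
        Ker = kernel E𝔸 EG hom p𝔸
        Im  = image E𝔸 EG hom p𝔸
        Im≐pG : Im PG.≐ₛ PG.multiples PG.whole
        Im≐pG = (λ (x , (a , _ , pa≈x) , φx≈z) → φ y a , _ ,
                   G.trans (G.sym (hom.f-× p a)) (G.trans (hom.f-cong pa≈x) φx≈z)) ,
                (λ (b , _ , pb≈z) → let (a , φa≈b) = surjective y-gen b in
                   p P𝔸.× a , (a , _ , 𝔸.refl) , G.trans (hom.f-× p a) (G.trans (PG.×-congʳ p φa≈b) pb≈z))
        cards : P𝔸.card-sub Ker ≡ P𝔸.card-sub (ker y)
        cards = *-cancelˡ-≡ _ _ γ (begin
          γ * P𝔸.card-sub Ker                          ≡⟨ cong (_* P𝔸.card-sub Ker) γ≡ ⟩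
          p ^ g * γ' * P𝔸.card-sub Ker                 ≡⟨ *-assoc (p ^ g) γ' _ ⟩
          p ^ g * (γ' * P𝔸.card-sub Ker)               ≡⟨ cong (λ k → p ^ g * (k * P𝔸.card-sub Ker)) (PG.card-sub-cong {Im} {PG.multiples PG.whole} Im≐pG) ⟨
          p ^ g * (PG.card-sub Im * P𝔸.card-sub Ker)   ≡⟨ cong (p ^ g *_) (card-image*kernel E𝔸 EG hom p𝔸) ⟨
          p ^ g * ϕ                                    ≡⟨ γ*ker ⟨
          γ * P𝔸.card-sub (ker y)                      ∎)

    ρ ρ' : ℕ
    ρ  = P𝔸.card-sub (ker (proj₁ generated))
    ρ' = P𝔸.card-sub (P𝔸.multiples (ker (proj₁ generated)))

    ρ≡ : ρ ≡ p ^ w * ρ'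
    ρ≡ = card-ker (proj₂ generated)

    γρ≡ : γ * ρ ≡ p ^ g * ϕ
    γρ≡ = γ*ker (proj₂ generated)

    -- The double count: pairs (t, y) with ⟨t⟩ = ker (φ y) and y generating G.

    Rel : (Fin (suc g) → 𝔸.Carrier) → (Fin g → G.Carrier) → Set
    Rel t y = Generating y ∧ P𝔸.span P𝔸.trivial t P𝔸.≐ₛ ker y

    Rel? : ∀ t y → Dec (Rel t y)
    Rel? t y = PG.spans? PG.whole PG.trivial y ×-dec P𝔸.spans? (ker y) P𝔸.trivial t

    private
      module T = Enum (P𝔸.enumTuple (suc g))
      module Y = Enum (PG.enumTuple g)

    -- The answer is independent of y: `γ*ker` fixes the order of the kernel, and `card-ker` then
    -- that of its p-th multiples. Both are expressed by the reference epimorphism in `generated`.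
    count-t : ∀ {y} → Generating y → T.count (P𝔸.spans? (ker y) P𝔸.trivial) ≡ ρ' ^ suc g * surjections p (suc g) w
    count-t {y} y-gen = ≡.trans (P𝔸.count-generating (ker y) (suc g) w (card-ker y-gen))
      (cong (λ k → k ^ suc g * surjections p (suc g) w) (*-cancelˡ-≡ _ _ (p ^ w)
        (≡.trans (≡.sym (card-ker y-gen)) (≡.trans
          (*-cancelˡ-≡ _ _ γ (≡.trans (γ*ker y-gen) (≡.sym γρ≡))) ρ≡))))

    count-pairs : ∑ T.elems (λ t → Y.count (Rel? t)) ≡
                  (γ' ^ g * surjections p g g) * (ρ' ^ suc g * surjections p (suc g) w)
    count-pairs = begin
      ∑ T.elems (λ t → Y.count (Rel? t))
        ≡⟨ ∑-swap T.elems Y.elems (λ t y → 𝟙 (Rel? t y)) ⟩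
      ∑ Y.elems (λ y → T.count (λ t → Rel? t y))
        ≡⟨ ∑-cong Y.elems fiber ⟩
      ∑ Y.elems (λ y → 𝟙 (PG.spans? PG.whole PG.trivial y) * M)
        ≡⟨ ∑-*ʳ Y.elems (λ y → 𝟙 (PG.spans? PG.whole PG.trivial y)) M ⟩
      Y.count (PG.spans? PG.whole PG.trivial) * M
        ≡⟨ cong (_* M) (PG.count-generating PG.whole g g (≡.trans PG.card-whole γ≡)) ⟩
      (γ' ^ g * surjections p g g) * M ∎
      where
      open ≡-Reasoning
      M = ρ' ^ suc g * surjections p (suc g) w
      fiber : ∀ y → T.count (λ t → Rel? t y) ≡ 𝟙 (PG.spans? PG.whole PG.trivial y) * M
      fiber y with PG.spans? PG.whole PG.trivial y
      ... | yes y-gen = ≡.trans (T.count-cong proj₂ (y-gen ,_) (λ t → yes y-gen ×-dec P𝔸.spans? (ker y) P𝔸.trivial t)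
                                            (P𝔸.spans? (ker y) P𝔸.trivial))
                              (≡.trans (count-t y-gen) (≡.sym (*-identityˡ M)))
      ... | no ¬y-gen = T.count-none (λ t → no ¬y-gen ×-dec P𝔸.spans? (ker y) P𝔸.trivial t) (λ (y-gen , _) → ¬y-gen y-gen)

    Presented : (Fin (suc g) → 𝔸.Carrier) → Set
    Presented t = AbelianGroup.group (abelianQuotient 𝔸 (⟨⟩-isSubgroup 𝔸.group (Image 𝔸.group t))) ≅ G.group

    ⟨⟩⊆span : ∀ (t : Fin (suc g) → 𝔸.Carrier) {x} → ⟨_⟩ 𝔸.group (Image 𝔸.group t) x → x P𝔸.∈ₛ P𝔸.span P𝔸.trivial t
    ⟨⟩⊆span t = go
      where
      module S = P𝔸.DecSubgroup (P𝔸.span P𝔸.trivial t)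
      go : ∀ {x} → ⟨_⟩ 𝔸.group (Image 𝔸.group t) x → x P𝔸.∈ₛ P𝔸.span P𝔸.trivial t
      go (gen (k , tk≈x))  = S.resp tk≈x (P𝔸.span-∋ P𝔸.trivial t k)
      go (gen-resp x≈y x∈) = S.resp x≈y (go x∈)
      go gen-ε             = S.ε∈
      go (gen-∙ x∈ y∈)     = S.∙∈ (go x∈) (go y∈)
      go (gen-⁻¹ x∈)       = S.⁻¹∈ (go x∈)

    span⊆⟨⟩ : ∀ (t : Fin (suc g) → 𝔸.Carrier) {x} → x P𝔸.∈ₛ P𝔸.span P𝔸.trivial t → ⟨_⟩ 𝔸.group (Image 𝔸.group t) x
    span⊆⟨⟩ t = P𝔸.span-min P𝔸.trivial t (⟨⟩-isSubgroup 𝔸.group _)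
      (λ x≈ε → gen-resp (𝔸.sym x≈ε) gen-ε) (λ k → gen (k , 𝔸.refl))

    module _ (t : Fin (suc g) → 𝔸.Carrier) where
      private
        Q : AbelianGroup 0ℓ 0ℓ
        Q = abelianQuotient 𝔸 (⟨⟩-isSubgroup 𝔸.group (Image 𝔸.group t))
        module Q = AbelianGroup Q

        project : ∀ {x y} → x 𝔸.≈ y → x Q.≈ y
        project x≈y = gen-resp (𝔸.sym (P𝔸.≈⇒//≈ε x≈y)) gen-ε

        project-isHom : IsHom 𝔸 Q id
        project-isHom = record { f-cong = project ; f-∙ = λ _ _ → Q.refl }

      Rel⇒Presented : ∀ {y} → Rel t y → Presented t
      Rel⇒Presented {y} (y-gen , ⟨t⟩⊆ker , ker⊆⟨t⟩) = φ y , hom⇒isGroupIsomorphism {Q} {G}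
        (record
          { f-cong = λ q → PG.//≈ε⇒≈ (G.trans (G.sym (f-// _ _)) (proj₂ (⟨t⟩⊆ker (⟨⟩⊆span t q))))
          ; f-∙    = f-∙
          })
        (λ eq → span⊆⟨⟩ t (ker⊆⟨t⟩ (∈ker {y} (G.trans (f-// _ _) (PG.≈⇒//≈ε eq)))))
        (surjective y-gen)
        where open IsHom (φ-isHom y)

      module _ (ψ : Presented t) where
        private
          module ψ = IsGroupIsomorphism (proj₂ ψ)

          ψ-isHom : IsHom 𝔸 G (proj₁ ψ)
          ψ-isHom = ∘-isHom {𝔸} {Q} {G} (isHom {Q} {G} ψ.isGroupHomomorphism) project-isHom

          module ψ-hom = IsHom ψ-isHom

        images : Fin g → G.Carrier
        images k = proj₁ ψ (basis k)

        φ-images : ∀ x → φ images x G.≈ proj₁ ψ x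
        φ-images = hom-unique (φ-isHom images) ψ-isHom (φ-basis images)

        -- By `hom-unique`, φ of the images of the basis is the projection followed by ψ.
        -- Injectivity of ψ makes ⟨t⟩ its kernel.
        Presented⇒Rel : Rel t images
        Presented⇒Rel =
          generating (λ z → let (x , x≈) = ψ.surjective z in x , G.trans (φ-images x) (x≈ Q.refl)) ,
          (λ x∈ → ∈ker {images} (G.trans (φ-images _) (G.trans (ψ.⟦⟧-cong (gen-resp (𝔸.sym (P𝔸.x//ε≈x _)) (span⊆⟨⟩ t x∈))) ψ.ε-homo))) ,
          (λ (_ , eq) → ⟨⟩⊆span t (gen-resp (P𝔸.x//ε≈x _)
             (ψ.injective (G.trans (G.sym (φ-images _)) (G.trans eq (G.sym ψ.ε-homo))))))

      -- Two epimorphisms with kernel ⟨t⟩ differ by a unique automorphism of G.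
      change : ∀ {y} (ψ : Presented t) → Rel t y → Σ[ α ∈ G.group ≅ G.group ] (∀ k → proj₁ α (images ψ k) G.≈ y k)
      change {y} ψ rel = (α , hom⇒isGroupIsomorphism {G} {G} α-isHom α-injective α-surjective) ,
        (λ k → G.trans (α-ψ (basis k)) (φ-basis y k))
        where
        module ψ = IsGroupIsomorphism (proj₂ ψ)
        module χ = IsGroupIsomorphism (proj₂ (Rel⇒Presented rel))
        lift : ∀ z → ∃ λ x → proj₁ ψ x G.≈ z
        lift z = let (x , x≈) = ψ.surjective z in x , x≈ Q.refl
        α : G.Carrier → G.Carrier
        α z = φ y (proj₁ (lift z))
        α-unique : ∀ {x z} → proj₁ ψ x G.≈ z → α z G.≈ φ y x
        α-unique {x} {z} eq = χ.⟦⟧-cong (ψ.injective (G.trans (proj₂ (lift z)) (G.sym eq)))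
        α-ψ : ∀ x → α (proj₁ ψ x) G.≈ φ y x
        α-ψ x = α-unique G.refl
        α-isHom : IsHom G G α
        α-isHom = record
          { f-cong = λ {z} {z'} z≈z' → α-unique (G.trans (proj₂ (lift z')) (G.sym z≈z'))
          ; f-∙    = λ z z' → G.trans
              (α-unique (G.trans (ψ.∙-homo _ _) (G.∙-cong (proj₂ (lift z)) (proj₂ (lift z')))))
              (χ.∙-homo _ _)
          }
        α-injective : ∀ {z z'} → α z G.≈ α z' → z G.≈ z'
        α-injective {z} {z'} eq = G.trans (G.sym (proj₂ (lift z)))
          (G.trans (ψ.⟦⟧-cong (χ.injective eq)) (proj₂ (lift z')))
        α-surjective : ∀ z → ∃ λ x → α x G.≈ z
        α-surjective z = let (x , x≈) = χ.surjective z in proj₁ ψ x , G.trans (α-ψ x) (x≈ Q.refl)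

    Rel-respʸ : ∀ t → Rel t Respects Setoid._≈_ (Π {n = g} (λ _ → G.setoid))
    Rel-respʸ t {y} {y'} y≈y' (y-gen , ⟨t⟩⊆ , ⊆⟨t⟩) =
      generating (λ z → let (x , eq) = surjective y-gen z in x , G.trans (G.sym (φ-cong y≈y' x)) eq) ,
      (λ x∈ → ∈ker {y'} (G.trans (G.sym (φ-cong y≈y' _)) (proj₂ (⟨t⟩⊆ x∈)))) ,
      (λ (_ , eq) → ⊆⟨t⟩ (∈ker {y} (G.trans (φ-cong y≈y' _) eq)))

    -- Isomorphisms from the quotient are not directly searchable, but by the first isomorphism
    -- theorem one exists iff some y satisfies the decidable relation `Rel t y`, and the tuples y
    -- are enumerated.
    Presented? : ∀ t → Dec (Presented t)
    Presented? t = map′ (λ (_ , rel) → Rel⇒Presented t rel) (λ ψ → images t ψ , Presented⇒Rel t ψ)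
                        (Y.any? (λ {y} {y'} → Rel-respʸ t {y} {y'}) (Rel? t))

    Presented-resp : Presented Respects Setoid._≈_ (Π {n = suc g} (λ _ → 𝔸.setoid))
    Presented-resp {t} {t'} t≈t' ψ = let (y-gen , ⟨t⟩⊆ , ⊆⟨t⟩) = Presented⇒Rel t ψ in
      Rel⇒Presented t' {images t ψ}
        (y-gen , (λ x∈ → ⟨t⟩⊆ (mono (λ k → 𝔸.sym (t≈t' k)) x∈)) , (λ x∈ → mono t≈t' (⊆⟨t⟩ x∈)))
      where
      mono : ∀ {t t'} → (∀ k → t k 𝔸.≈ t' k) → P𝔸.span P𝔸.trivial t P𝔸.⊆ₛ P𝔸.span P𝔸.trivial t'
      mono {t} {t'} t≈t' = P𝔸.span-min P𝔸.trivial t S.isSubgroup S.≈ε⇒∈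
        (λ k → S.resp (𝔸.sym (t≈t' k)) (P𝔸.span-∋ P𝔸.trivial t' k))
        where module S = P𝔸.DecSubgroup (P𝔸.span P𝔸.trivial t')

    Presented⇒∈p𝔸 : ∀ {t} → Presented t → ∀ k → t k P𝔸.∈ₛ P𝔸.multiples P𝔸.whole
    Presented⇒∈p𝔸 {t} ψ k = let (y-gen , ⟨t⟩⊆ , _) = Presented⇒Rel t ψ in
      ker⊆p𝔸 {images t ψ} y-gen (⟨t⟩⊆ (P𝔸.span-∋ P𝔸.trivial t k))

    module _ (EAut : Enum (Aut G.group)) where

      -- If t presents G, the y related to t form a torsor under Aut G: `change` gives transitivity,
      -- and the action is free since an automorphism is determined by its values on the generators
      -- `images t ψ`.
      count-automorphisms : ∀ t → Y.count (Rel? t) ≡ 𝟙 (Presented? t) * Enum.card EAut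
      count-automorphisms t with Presented? t
      ... | no ¬ψ = Y.count-none (Rel? t) (λ {y} rel → ¬ψ (Rel⇒Presented t {y} rel))
      ... | yes ψ = ≡.trans
        (count-image (PG.enumTuple g) EAut
          (λ α k → proj₁ α (images t ψ k))
          (λ α≈β k → α≈β (images t ψ k))
          (λ {α} {β} → determined α β)
          (Rel? t) (λ {y} {y'} → Rel-respʸ t {y} {y'})
          (λ {y} rel → change t {y} ψ rel)
          (λ α → Presented⇒Rel t (≅-∘ {quotient} {G} {G} α ψ)))
        (≡.sym (*-identityˡ _))
        where
        quotient : AbelianGroup 0ℓ 0ℓ
        quotient = abelianQuotient 𝔸 (⟨⟩-isSubgroup 𝔸.group (Image 𝔸.group t))
        determined : (α β : G.group ≅ G.group) → (∀ k → proj₁ α (images t ψ k) G.≈ proj₁ β (images t ψ k)) →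
                     ∀ z → proj₁ α z G.≈ proj₁ β z
        determined (α , α-iso) (β , β-iso) eq z =
          let (x , φx≈z) = surjective (proj₁ rel) z in
          G.trans (α.f-cong (G.sym φx≈z)) (G.trans (agree x) (β.f-cong φx≈z))
          where
          rel = Presented⇒Rel t ψ
          y = images t ψ
          α-hom = isHom {G} {G} (IsGroupIsomorphism.isGroupHomomorphism α-iso)
          β-hom = isHom {G} {G} (IsGroupIsomorphism.isGroupHomomorphism β-iso)
          module α = IsHom α-hom
          module β = IsHom β-hom
          agree : ∀ x → α (φ y x) G.≈ β (φ y x)
          agree = hom-unique (∘-isHom {𝔸} {G} {G} α-hom (φ-isHom y)) (∘-isHom {𝔸} {G} {G} β-hom (φ-isHom y))
            (λ k → G.trans (α.f-cong (φ-basis y k)) (G.trans (eq k) (β.f-cong (G.sym (φ-basis y k)))))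

      count-presentations : ∀ {n a} → n ≡ T.count Presented? → a ≡ Enum.card EAut →
                            n * a ≡ (γ' ^ g * surjections p g g) * (ρ' ^ suc g * surjections p (suc g) w)
      count-presentations ≡.refl ≡.refl = ≡.trans (≡.sym (∑-*ʳ T.elems (𝟙 ∘ Presented?) (Enum.card EAut)))
        (≡.trans (∑-cong T.elems (λ t → ≡.sym (count-automorphisms t))) count-pairs)

-- Topological groups and the lower p-central series

-- Bounds the exponent of T / P_n(T) by p^n. Applied to F^ab this bounds the exponent of 𝔸, and
-- applied to the discrete group G of p-class n that of G.
power∈P : ∀ p T n x → (MonoidMult._×_ (TopGroup.monoid T) (p ^ n) x) ∈ P p T n
power∈P p T zero    x = tt
power∈P p T (suc n) x = IsNormalSubgroup.resp (P-isNormal p T (suc n)) (×-assocˡ x p (p ^ n))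
  (TopGroup.⊆Closure T (gen (inj₂ ((p ^ n) × x , power∈P p T n x , refl))))
  where
  open TopGroup T using (monoid; refl)
  open MonoidMult monoid

module _ (T : TopGroup) {S : Pred (TopGroup.Carrier T) 0ℓ} where
  open TopGroup T

  Closure-closed : ∀ {x} → (∀ i → ∃ λ w → w ∈ Closure S ∧ (x // w) ∈ basis i) → x ∈ Closure S
  Closure-closed {x} approx i =
    let (w , w∈ , q) = approx i
        (y , y∈ , r) = w∈ i
    in y , y∈ , resp (//-trans x w y) (∙∈ q r)
    where
    open IsNormalSubgroup (basis-normal i)
    open GroupProperties group
    open SetoidReasoning setoid
    //-trans : ∀ x y z → (x // y) ∙ (y // z) ≈ x // z
    //-trans x y z = begin
      (x // y) ∙ (y // z)   ≈⟨ assoc (x // y) y (z ⁻¹) ⟨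
      (x // y) ∙ y ∙ z ⁻¹   ≈⟨ ∙-congʳ (//-rightDividesˡ y x) ⟩
      x // z                ∎

-- Admits finite p-groups as targets of the universal property of `F`.
discrete-isProP : ∀ p (H : Grp) (fin : Finite (Group.setoid H)) → (∃ λ k → size fin ≡ p ^ k) → IsProP p (discrete H)
discrete-isProP p H fin p-power = record
  { finite    = λ _ → record
    { size = size fin
    ; enum = record
      { to        = to
      ; from      = from
      ; to-cong   = λ eq → x≈y⇒x∙y⁻¹≈ε (to-cong eq)
      ; from-cong = λ q → from-cong (x∙y⁻¹≈ε⇒x≈y _ _ q)
      ; inverse   = (λ eq → x≈y⇒x∙y⁻¹≈ε (inverseˡ eq)) , (λ q → inverseʳ (x∙y⁻¹≈ε⇒x≈y _ _ q))
      }
    }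
  ; p-power   = λ _ → p-power
  ; separated = λ x≈ε → x≈ε tt
  ; complete  = λ x _ → x tt , λ _ → x≈y⇒x∙y⁻¹≈ε (Group.refl H)
  }
  where
  open Inverse (Finite.enum fin)
  open GroupProperties H

module _ (p : ℕ) (F : TopGroup) (c : ℕ) (H : AbelianGroup 0ℓ 0ℓ) where
  private
    module F = TopGroup F
    module Fab = TopGroup (ab F)
    module H = AbelianGroup H
    module MH = Multiples H
    𝔸 = abQuotient p F c

  module _ (torsion : ∀ x → (p ^ c) MH.× x H.≈ H.ε)
           (f : F.Carrier → H.Carrier) (cont : IsContinuousHom F (discrete H.group) f) where
    private
      open IsContinuousHom cont
      open IsGroupHomomorphism isGroupHomomorphism

      module _ {S : Pred F.Carrier 0ℓ} (kills : ∀ {x} → x ∈ S → f x H.≈ H.ε) where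
        kills-⟨⟩ : ∀ {x} → ⟨_⟩ F.group S x → f x H.≈ H.ε
        kills-⟨⟩ (gen x∈)          = kills x∈
        kills-⟨⟩ (gen-resp x≈y x∈) = H.trans (⟦⟧-cong (F.sym x≈y)) (kills-⟨⟩ x∈)
        kills-⟨⟩ gen-ε             = ε-homo
        kills-⟨⟩ (gen-∙ x∈ y∈)     = H.trans (homo _ _) (H.trans (H.∙-cong (kills-⟨⟩ x∈) (kills-⟨⟩ y∈)) (H.identityˡ H.ε))
        kills-⟨⟩ (gen-⁻¹ x∈)       = H.trans (⁻¹-homo _) (H.trans (H.⁻¹-cong (kills-⟨⟩ x∈)) MH.ε⁻¹≈ε)

      f-// : ∀ x y → f (x F.// y) H.≈ f x MH.// f y
      f-// x y = H.trans (homo x (y F.⁻¹)) (H.∙-congˡ (⁻¹-homo y))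

      kernel⇒≈ : ∀ {x y} → f (x F.// y) H.≈ H.ε → f x H.≈ f y
      kernel⇒≈ q = MH.//≈ε⇒≈ (H.trans (H.sym (f-// _ _)) q)

      i₀ : F.Index
      i₀ = proj₁ (continuous tt)

      kills-basis : ∀ {x} → x ∈ F.basis i₀ → f x H.≈ H.ε
      kills-basis = proj₂ (continuous tt)

      kills-commutators : ∀ {S x} → CommutatorsWith F.group S x → f x H.≈ H.ε
      kills-commutators {x = z} (x , y , _ , z≈) = begin
        f z                                       ≈⟨ ⟦⟧-cong z≈ ⟩
        f (x F.∙ y F.∙ x F.⁻¹ F.∙ y F.⁻¹)         ≈⟨ f-// (x F.∙ y F.∙ x F.⁻¹) y ⟩
        f (x F.∙ y F.∙ x F.⁻¹) MH.// f y          ≈⟨ H.∙-congʳ (H.trans (f-// (x F.∙ y) x) (H.∙-congʳ (homo x y))) ⟩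
        ((f x H.∙ f y) MH.// f x) MH.// f y       ≈⟨ H.∙-congʳ (MH.xyx⁻¹≈y (f x) (f y)) ⟩
        f y MH.// f y                             ≈⟨ H.inverseʳ (f y) ⟩
        H.ε                                       ∎
        where open SetoidReasoning H.setoid

      kills-Derived : ∀ {x} → x ∈ Derived F → f x H.≈ H.ε
      kills-Derived x∈ = let (y , y∈ , q) = x∈ i₀ in
        H.trans (kernel⇒≈ (kills-basis q)) (kills-⟨⟩ (kills-commutators {λ _ → ⊤}) y∈)

      Fab-cong : ∀ {x y} → x Fab.≈ y → f x H.≈ f y
      Fab-cong q = kernel⇒≈ (kills-Derived q)

      kills-basis-ab : ∀ {x} → x ∈ Fab.basis i₀ → f x H.≈ H.ε
      kills-basis-ab (b , b∈ , q) = H.trans (kernel⇒≈ (kills-Derived q)) (kills-basis b∈)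

      f-× : ∀ n x → f (MonoidMult._×_ Fab.monoid n x) H.≈ n MH.× f x
      f-× zero    x = ε-homo
      f-× (suc n) x = H.trans (homo _ _) (H.∙-congˡ (f-× n x))

      Multiple : ℕ → H.Carrier → Set
      Multiple n h = ∃ λ z → (p ^ n) MH.× z H.≈ h

      -- H is abelian, so commutators vanish and each step of the series only contributes a factor
      -- p. Taking closures changes nothing: `f` kills the open subgroup `i₀`, so a point of the
      -- closure has the image of a nearby point of the abstract subgroup. At n = c the exponent of
      -- H makes `f` kill P_c.
      P⇒Multiple : ∀ n {x} → x ∈ P p (ab F) n → Multiple n (f x)
      P⇒Multiple zero    {x} _  = f x , MH.×-homo-1 (f x)
      P⇒Multiple (suc n) {x} x∈ = let (y , y∈ , q) = x∈ i₀
                                      (z , eq)     = go y∈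
                                  in z , H.trans eq (H.sym (kernel⇒≈ (kills-basis-ab q)))
        where
        go : ∀ {y} → ⟨_⟩ Fab.group _ y → Multiple (suc n) (f y)
        go (gen (inj₁ (x , y , _ , z≈))) = H.ε , H.trans (MH.×-ε (p ^ suc n))
          (H.sym (H.trans (Fab-cong z≈) (kills-commutators {λ _ → ⊤} (x , y , tt , F.refl))))
        go (gen (inj₂ (x , x∈ , z≈))) = let (z , eq) = P⇒Multiple n x∈ in
          z , H.trans (H.sym (MH.×-assocˡ z p (p ^ n)))
                (H.trans (MH.×-congʳ p eq) (H.sym (H.trans (Fab-cong z≈) (f-× p x))))
        go (gen-resp x≈y x∈) = let (z , eq) = go x∈ in z , H.trans eq (Fab-cong x≈y)
        go gen-ε = H.ε , H.trans (MH.×-ε (p ^ suc n)) (H.sym ε-homo)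
        go (gen-∙ x∈ y∈) = let (z , eq) = go x∈
                               (w , eq') = go y∈
                           in z H.∙ w , H.trans (MH.×-distrib-+ z w (p ^ suc n)) (H.trans (H.∙-cong eq eq') (H.sym (homo _ _)))
        go (gen-⁻¹ x∈) = let (z , eq) = go x∈ in
          z H.⁻¹ , H.trans (MH.×-⁻¹ (p ^ suc n) z) (H.trans (H.⁻¹-cong eq) (H.sym (⁻¹-homo _)))

    factors : IsHom 𝔸 H f
    factors = record
      { f-cong = λ q → let (z , eq) = P⇒Multiple c q in kernel⇒≈ (H.trans (H.sym eq) (torsion z))
      ; f-∙    = homo
      }

  extension : ∀ {g} (free : IsFreeProP p g F) (fin : Finite H.setoid) → (∃ λ k → size fin ≡ p ^ k) →
              (∀ x → (p ^ c) MH.× x H.≈ H.ε) → (y : Fin g → H.Carrier) →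
              Σ[ f ∈ (F.Carrier → H.Carrier) ]
                (IsContinuousHom F (discrete H.group) f ∧ IsHom 𝔸 H f ∧ (∀ k → f (IsFreeProP.ι free k) H.≈ y k))
  extension free fin p-power torsion y =
    let (f , cont , f-ι) = IsFreeProP.extend free (discrete H.group) (discrete-isProP p H.group fin p-power) y
    in f , cont , factors torsion f cont , f-ι

-- Finite sums in abelian groups

module GroupSum (A : AbelianGroup 0ℓ 0ℓ) where
  open AbelianGroup A
  open Multiples A
  open Sum commutativeMonoid public using (sum; sum-cong-≋; ∑-distrib-+)

  sum-ε : ∀ {n} (t : Fin n → Carrier) → (∀ k → t k ≈ ε) → sum t ≈ ε
  sum-ε {zero}  t eq = refl
  sum-ε {suc n} t eq = trans (∙-cong (eq zero) (sum-ε (t ∘ suc) (eq ∘ suc))) (identityˡ ε)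

  sum-single : ∀ {n} (t : Fin n → Carrier) j → (∀ k → k ≢ j → t k ≈ ε) → sum t ≈ t j
  sum-single t zero    eq = trans (∙-congˡ (sum-ε (t ∘ suc) (λ k → eq (suc k) λ ()))) (identityʳ _)
  sum-single t (suc j) eq = trans
    (∙-cong (eq zero λ ()) (sum-single (t ∘ suc) j (λ k k≢j → eq (suc k) (k≢j ∘ Fin.suc-injective))))
    (identityˡ _)

  sum∈ : ∀ {H : Pred Carrier 0ℓ} → IsSubgroup group H → ∀ {n} (t : Fin n → Carrier) → (∀ k → t k ∈ H) → sum t ∈ H
  sum∈ sub {zero}  t t∈ = IsSubgroup.ε∈ sub
  sum∈ sub {suc n} t t∈ = IsSubgroup.∙∈ sub (t∈ zero) (sum∈ sub (t ∘ suc) (t∈ ∘ suc))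

module _ {A B : AbelianGroup 0ℓ 0ℓ} {f : AbelianGroup.Carrier A → AbelianGroup.Carrier B} (hom : IsHom A B f) where
  private
    module A = AbelianGroup A
    module B = AbelianGroup B
  open IsHom hom

  hom-sum : ∀ {n} (t : Fin n → A.Carrier) → f (GroupSum.sum A t) B.≈ GroupSum.sum B (f ∘ t)
  hom-sum {zero}  t = f-ε
  hom-sum {suc n} t = B.trans (f-∙ _ _) (B.∙-congˡ (hom-sum (t ∘ suc)))

-- Residues

∣-diff-trans : ∀ {m} x y z → m ℤ.∣ (x ℤ.- y) → m ℤ.∣ (y ℤ.- z) → m ℤ.∣ (x ℤ.- z)
∣-diff-trans {m} x y z p q = subst (m ℤ.∣_) (lemma x y z) (ℤ.∣m∣n⇒∣m+n p q)
  where
  lemma : ∀ x y z → (x ℤ.- y) ℤ.+ (y ℤ.- z) ≡ x ℤ.- z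
  lemma = solve-∀ℤ

∣-diff-sym : ∀ {m} x y → m ℤ.∣ (x ℤ.- y) → m ℤ.∣ (y ℤ.- x)
∣-diff-sym {m} x y p = subst (m ℤ.∣_) (lemma x y) (ℤ.∣m⇒∣-m p)
  where
  lemma : ∀ x y → ℤ.- (x ℤ.- y) ≡ y ℤ.- x
  lemma = solve-∀ℤ

∣-diff-refl : ∀ {m x y} → x ≡ y → m ℤ.∣ (x ℤ.- y)
∣-diff-refl {m} {x} ≡.refl = subst (m ℤ.∣_) (≡.sym (ℤ.+-inverseʳ x)) (ℤ.divides 0ℤ ≡.refl)

∣-diff⇒∣ : ∀ {m x y} → m ℤ.∣ (x ℤ.- y) → m ℤ.∣ y → m ℤ.∣ x
∣-diff⇒∣ {m} {x} {y} p q = subst (m ℤ.∣_) (lemma x y) (ℤ.∣m∣n⇒∣m+n p q)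
  where
  lemma : ∀ x y → (x ℤ.- y) ℤ.+ y ≡ x
  lemma = solve-∀ℤ

-- Reducing z / d modulo e represents every multiple of d modulo d e by some d i with i < e;
-- `digit-unique` adds that i is unique. The case d = 1 is the ordinary residue.
digit : ∀ d e .⦃ _ : NonZero e ⦄ z → (+ d) ℤ.∣ z → ∃ λ (i : Fin e) → (+ (d * e)) ℤ.∣ (z ℤ.- + (d * toℕ i))
digit d e z (ℤ.divides k z≡kd) = fromℕ< (ℤ.n%ℕd<d k e) , ℤ.divides (k ℤ./ℕ e) (begin
  z ℤ.- + (d * toℕ (fromℕ< (ℤ.n%ℕd<d k e)))
    ≡⟨ cong₂ (λ a b → a ℤ.- + (d * b)) z≡kd (Fin.toℕ-fromℕ< (ℤ.n%ℕd<d k e)) ⟩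
  k ℤ.* + d ℤ.- + (d * r)
    ≡⟨ cong₂ (λ a b → a ℤ.* + d ℤ.- b) (ℤ.a≡a%ℕn+[a/ℕn]*n k e) (ℤ.pos-* d r) ⟩
  (+ r ℤ.+ s ℤ.* + e) ℤ.* + d ℤ.- + d ℤ.* + r
    ≡⟨ lemma (+ r) s (+ e) (+ d) ⟩
  s ℤ.* (+ d ℤ.* + e)
    ≡⟨ cong (s ℤ.*_) (ℤ.pos-* d e) ⟨
  s ℤ.* + (d * e) ∎)
  where
  open ≡-Reasoning
  r = k ℤ.%ℕ e
  s = k ℤ./ℕ e
  lemma : ∀ r s e d → (r ℤ.+ s ℤ.* e) ℤ.* d ℤ.- d ℤ.* r ≡ s ℤ.* (d ℤ.* e)
  lemma = solve-∀ℤ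

digit-unique : ∀ d e .⦃ _ : NonZero d ⦄ (i j : Fin e) → (+ (d * e)) ℤ.∣ (+ (d * toℕ i) ℤ.- + (d * toℕ j)) → i ≡ j
digit-unique d@(suc _) e i j p = Fin.toℕ-injective (ℤ.+-injective (ℤ.i-j≡0⇒i≡j (+ toℕ i) (+ toℕ j)
  (≡.trans (ℤ.m-n≡m⊖n (toℕ i) (toℕ j)) (ℤ.∣i∣≡0⇒i≡0 small))))
  where
  lemma : ∀ d i j → d ℤ.* i ℤ.- d ℤ.* j ≡ d ℤ.* (i ℤ.- j)
  lemma = solve-∀ℤ
  e∣ : (+ e) ℤ.∣ (+ toℕ i ℤ.- + toℕ j)
  e∣ = ℤ.*-cancelˡ-∣ (+ d) (≡.subst₂ ℤ._∣_ (ℤ.pos-* d e)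
    (≡.trans (cong₂ ℤ._-_ (ℤ.pos-* d (toℕ i)) (ℤ.pos-* d (toℕ j))) (lemma (+ d) (+ toℕ i) (+ toℕ j))) p)
  bound : ℤ.∣ toℕ i ℤ.⊖ toℕ j ∣ < e
  bound = ≤-<-trans (ℤ.∣m⊝n∣≤m⊔n (toℕ i) (toℕ j)) (⊔-pres-<m (Fin.toℕ<n i) (Fin.toℕ<n j))
  small : ℤ.∣ toℕ i ℤ.⊖ toℕ j ∣ ≡ 0
  small with ℤ.∣ toℕ i ℤ.⊖ toℕ j ∣ in eq
  ... | zero  = ≡.refl
  ... | suc k = contradiction
    (∣⇒≤ (subst (e ∣_) (≡.trans (cong ℤ.∣_∣ (ℤ.m-n≡m⊖n (toℕ i) (toℕ j))) eq) (ℤ.∣⇒∣ᵤ e∣)))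
    (<⇒≱ (subst (_< e) eq bound))

ℤmodᵃ : ℕ → AbelianGroup 0ℓ 0ℓ
ℤmodᵃ m = record
  { isAbelianGroup = record
    { isGroup = Group.isGroup (ℤmod m)
    ; comm    = λ x y → ∣-diff-refl (ℤ.+-comm x y)
    }
  }

∏ᵃ : ∀ {r} → (Fin r → AbelianGroup 0ℓ 0ℓ) → AbelianGroup 0ℓ 0ℓ
∏ᵃ H = record
  { isAbelianGroup = record
    { isGroup = Group.isGroup (∏ (λ i → AbelianGroup.group (H i)))
    ; comm    = λ x y i → AbelianGroup.comm (H i) (x i) (y i)
    }
  }

∏ᵃ-proj : ∀ {r} (H : Fin r → AbelianGroup 0ℓ 0ℓ) j → IsHom (∏ᵃ H) (H j) (λ x → x j)
∏ᵃ-proj H j = record { f-cong = λ x≈y → x≈y j ; f-∙ = λ x y → AbelianGroup.refl (H j) }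

ℤmod-× : ∀ m n z → Multiples._×_ (ℤmodᵃ m) n z ≡ + n ℤ.* z
ℤmod-× m zero    z = ≡.sym (ℤ.*-zeroˡ z)
ℤmod-× m (suc n) z = ≡.trans (cong (ℤ._+_ z) (ℤmod-× m n z)) (lemma (+ n) z)
  where
  lemma : ∀ n z → z ℤ.+ n ℤ.* z ≡ (1ℤ ℤ.+ n) ℤ.* z
  lemma = solve-∀ℤ

∏ℤmod : ∀ {r} → (Fin r → ℕ) → AbelianGroup 0ℓ 0ℓ
∏ℤmod m = ∏ᵃ (λ i → ℤmodᵃ (m i))

∏ℤmod-× : ∀ {r} (m : Fin r → ℕ) n x i → Multiples._×_ (∏ℤmod m) n x i ≡ + n ℤ.* x i
∏ℤmod-× m n x i = ≡.trans (proj n) (ℤmod-× (m i) n (x i))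
  where
  proj : ∀ n → Multiples._×_ (∏ℤmod m) n x i ≡ Multiples._×_ (ℤmodᵃ (m i)) n (x i)
  proj zero    = ≡.refl
  proj (suc n) = cong (ℤ._+_ (x i)) (proj n)

residue : ∀ m .⦃ _ : NonZero m ⦄ z → ∃ λ (i : Fin m) → (+ m) ℤ.∣ (z ℤ.- + toℕ i)
residue m z = let (i , p) = digit 1 m z (ℤ.divides z (≡.sym (ℤ.*-identityʳ z))) in
  i , ≡.subst₂ (λ k l → (+ k) ℤ.∣ (z ℤ.- + l)) (*-identityˡ m) (*-identityˡ (toℕ i)) p

residue-unique : ∀ m (i j : Fin m) → (+ m) ℤ.∣ (+ toℕ i ℤ.- + toℕ j) → i ≡ j
residue-unique m i j p = digit-unique 1 m i j
  (subst (ℤ._∣ (+ (1 * toℕ i) ℤ.- + (1 * toℕ j))) (cong +_ (≡.sym (*-identityˡ m)))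
    (≡.subst₂ (λ k l → (+ m) ℤ.∣ (+ k ℤ.- + l)) (≡.sym (*-identityˡ (toℕ i))) (≡.sym (*-identityˡ (toℕ j))) p))

module _ (m : ℕ) .⦃ _ : NonZero m ⦄ where
  private
    rep : ℤ → Fin m
    rep z = proj₁ (residue m z)

    rep-cong : ∀ {x y} → (+ m) ℤ.∣ (x ℤ.- y) → rep x ≡ rep y
    rep-cong {x} {y} p = residue-unique m (rep x) (rep y)
      (∣-diff-trans (+ toℕ (rep x)) x (+ toℕ (rep y)) (∣-diff-sym x (+ toℕ (rep x)) (proj₂ (residue m x)))
        (∣-diff-trans x y (+ toℕ (rep y)) p (proj₂ (residue m y))))

    rep-inj : ∀ {x y} → rep x ≡ rep y → (+ m) ℤ.∣ (x ℤ.- y)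
    rep-inj {x} {y} eq = ∣-diff-trans x (+ toℕ (rep x)) y (proj₂ (residue m x))
      (subst (λ i → (+ m) ℤ.∣ (+ toℕ i ℤ.- y)) (≡.sym eq) (∣-diff-sym y (+ toℕ (rep y)) (proj₂ (residue m y))))

    rep-toℕ : ∀ i → rep (+ toℕ i) ≡ i
    rep-toℕ i = residue-unique m (rep (+ toℕ i)) i
      (∣-diff-sym (+ toℕ i) (+ toℕ (rep (+ toℕ i))) (proj₂ (residue m (+ toℕ i))))

    module Residues = Subset (enumFin m) (Group.setoid (ℤmod m)) {P = λ _ → ⊤}
      (λ _ → yes tt) (λ _ _ → tt) (λ i _ → + toℕ i) rep (λ _ → tt)
      (λ {x} {y} → rep-cong {x} {y}) (λ {x} {y} → rep-inj {x} {y}) (λ i _ → rep-toℕ i)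

  enumℤmod : Enum (Group.setoid (ℤmod m))
  enumℤmod = Residues.enum

  card-enumℤmod : Enum.card enumℤmod ≡ m
  card-enumℤmod = ≡.trans Residues.card-enum
    (≡.trans (Enum.count-all (enumFin m) (λ _ → yes tt) (λ _ → tt)) (card-enumFin m))

δ : ∀ {g} → Fin g → Fin g → ℕ
δ k j with k Fin.≟ j
... | yes _ = 1
... | no _  = 0

δ-diag : ∀ {g} (k : Fin g) → δ k k ≡ 1
δ-diag k with k Fin.≟ k
... | yes _  = ≡.refl
... | no k≢k = contradiction ≡.refl k≢k

δ-off : ∀ {g} {k j : Fin g} → k ≢ j → δ k j ≡ 0
δ-off {k = k} {j} k≢j with k Fin.≟ j
... | yes k≡j = contradiction k≡j k≢j
... | no _    = ≡.refl

-- Groups isomorphic to (ℤ/p^(e+1))^g by means of coordinates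

module Coordinates (p : ℕ) (pr : Prime p) (e g : ℕ) (𝔸 : AbelianGroup 0ℓ 0ℓ)
  (torsion𝔸 : ∀ x → AbelianGroup._≈_ 𝔸 (Multiples._×_ 𝔸 (p ^ suc e) x) (AbelianGroup.ε 𝔸))
  (ι : Fin g → AbelianGroup.Carrier 𝔸)
  (coord : AbelianGroup.Carrier 𝔸 → Fin g → ℤ)
  (coord-isHom : IsHom 𝔸 (∏ℤmod (λ (_ : Fin g) → p ^ suc e)) coord)
  (coord-ι : ∀ k j → (+ (p ^ suc e)) ℤ.∣ (coord (ι k) j ℤ.- + δ k j))
  where

  private
    q : ℕ
    q = p ^ suc e

    instance
      p-nonZero : NonZero p
      p-nonZero = prime⇒nonZero pr

      q-nonZero : NonZero q
      q-nonZero = m^n≢0 p (suc e)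

      p^e-nonZero : NonZero (p ^ e)
      p^e-nonZero = m^n≢0 p e

    Z : AbelianGroup 0ℓ 0ℓ
    Z = ∏ℤmod (λ (_ : Fin g) → q)

    module Z = AbelianGroup Z
    module coord = IsHom coord-isHom

  open AbelianGroup 𝔸
  open Multiples 𝔸
  open GroupSum 𝔸

  coordⱼ-isHom : ∀ j → IsHom 𝔸 (ℤmodᵃ q) (λ x → coord x j)
  coordⱼ-isHom j = ∘-isHom {𝔸} {Z} {ℤmodᵃ q} (∏ᵃ-proj (λ _ → ℤmodᵃ q) j) coord-isHom

  coord-× : ∀ n x j → (+ q) ℤ.∣ (coord (n × x) j ℤ.- + n ℤ.* coord x j)
  coord-× n x j = subst (λ z → (+ q) ℤ.∣ (coord (n × x) j ℤ.- z)) (∏ℤmod-× (λ (_ : Fin g) → q) n (coord x) j)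
                        (coord.f-× n x j)

  coord-×ι : ∀ n k j → (+ q) ℤ.∣ (coord (n × ι k) j ℤ.- + (n * δ k j))
  coord-×ι n k j = ∣-diff-trans (coord (n × ι k) j) (+ n ℤ.* coord (ι k) j) (+ (n * δ k j)) (coord-× n (ι k) j)
    (subst ((+ q) ℤ.∣_) (≡.trans (lemma (+ n) (coord (ι k) j) (+ δ k j)) (cong (λ z → + n ℤ.* coord (ι k) j ℤ.- z) (≡.sym (ℤ.pos-* n (δ k j)))))
           (ℤ.∣n⇒∣m*n (+ n) (coord-ι k j)))
    where
    lemma : ∀ n x d → n ℤ.* (x ℤ.- d) ≡ n ℤ.* x ℤ.- n ℤ.* d
    lemma = solve-∀ℤ

  lin : (Fin g → ℕ) → Carrier
  lin n = sum (λ k → n k × ι k)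

  coord-lin : ∀ n j → (+ q) ℤ.∣ (coord (lin n) j ℤ.- + n j)
  coord-lin n j = ∣-diff-trans (coord (lin n) j) (coord (n j × ι j) j) (+ n j)
    (ℤq.trans {coord (lin n) j} {GroupSum.sum (ℤmodᵃ q) (λ k → coord (n k × ι k) j)} {coord (n j × ι j) j}
      (hom-sum {𝔸} {ℤmodᵃ q} (coordⱼ-isHom j) (λ k → n k × ι k))
      (GroupSum.sum-single (ℤmodᵃ q) (λ k → coord (n k × ι k) j) j off))
    (subst (λ m → (+ q) ℤ.∣ (coord (n j × ι j) j ℤ.- + m)) (≡.trans (cong (n j *_) (δ-diag j)) (*-identityʳ (n j)))
      (coord-×ι (n j) j j))
    where
    module ℤq = AbelianGroup (ℤmodᵃ q)
    off : ∀ k → k ≢ j → coord (n k × ι k) j ℤq.≈ 0ℤ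
    off k k≢j = subst (λ m → (+ q) ℤ.∣ (coord (n k × ι k) j ℤ.- + m)) (≡.trans (cong (n k *_) (δ-off k≢j)) (*-zeroʳ (n k)))
      (coord-×ι (n k) k j)

  Combination : Pred Carrier 0ℓ
  Combination x = ∃ λ n → x ≈ lin n

  lin-× : ∀ m n → m × lin n ≈ lin (λ k → m * n k)
  lin-× m n = trans (hom-sum {𝔸} {𝔸} (×-isHom 𝔸 m) (λ k → n k × ι k)) (sum-cong-≋ (λ k → ×-assocˡ (ι k) m (n k)))

  Combination-isSubgroup : IsSubgroup group Combination
  Combination-isSubgroup = record
    { resp = λ x≈y (n , eq) → n , trans (sym x≈y) eq
    ; ε∈   = (λ _ → 0) , sym (sum-ε (λ k → 0 × ι k) (λ _ → refl))
    ; ∙∈   = λ (m , eq) (n , eq') → (λ k → m k + n k) , trans (∙-cong eq eq')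
               (trans (sym (∑-distrib-+ (λ k → m k × ι k) (λ k → n k × ι k)))
                      (sum-cong-≋ (λ k → sym (×-homo-+ (ι k) (m k) (n k)))))
    ; ⁻¹∈  = λ {x} (n , eq) → (λ k → pred q * n k) , trans (⁻¹-pred x) (trans (×-congʳ (pred q) eq) (lin-× (pred q) n))
    }
    where
    ⁻¹-pred : ∀ x → x ⁻¹ ≈ pred q × x
    ⁻¹-pred x = sym (inverseʳ-unique x (pred q × x) (trans (×-congˡ (suc-pred q)) (torsion𝔸 x)))

  ι-combination : ∀ k → Combination (ι k)
  ι-combination k = δ k , sym (trans (sum-single (λ j → δ k j × ι j) k off) (trans (×-congˡ (δ-diag k)) (×-homo-1 (ι k))))
    where
    off : ∀ j → j ≢ k → δ k j × ι j ≈ ε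
    off j j≢k = ×-congˡ (δ-off (λ k≡j → j≢k (≡.sym k≡j)))

  -- The coordinates of a combination are its coefficients modulo q, and q kills 𝔸. Elements not yet
  -- known to be combinations need the topology of `F`, so injectivity of `coord` is only assumed
  -- below and is later deduced from this case by density.
  coord-combination-injective : ∀ {x} → Combination x → (∀ j → (+ q) ℤ.∣ coord x j) → x ≈ ε
  coord-combination-injective (n , x≈) q∣ = trans x≈ (sum-ε (λ k → n k × ι k) vanish)
    where
    q∣n : ∀ k → (+ q) ℤ.∣ (+ n k)
    q∣n k = ∣-diff⇒∣ {x = + n k} {y = coord (lin n) k}
      (∣-diff-sym (coord (lin n) k) (+ n k) (coord-lin n k)) (∣-diff⇒∣ (coord.f-cong (sym x≈) k) (q∣ k))
    kill : ∀ {m} → q ∣ m → ∀ y → m × y ≈ ε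
    kill (divides m eq) y = trans (×-congˡ eq) (trans (sym (×-assocˡ y m q)) (trans (×-congʳ m (torsion𝔸 y)) (×-ε m)))
    vanish : ∀ k → n k × ι k ≈ ε
    vanish k = kill (ℤ.∣⇒∣ᵤ (q∣n k)) (ι k)

  module _ (coord-injective : ∀ {x} → (∀ j → (+ q) ℤ.∣ coord x j) → x ≈ ε) where

    coord-inj : ∀ {x y} → (∀ j → (+ q) ℤ.∣ (coord x j ℤ.- coord y j)) → x ≈ y
    coord-inj {x} {y} eq = //≈ε⇒≈ (coord-injective (λ j → ∣-diff⇒∣ (coord.f-// x y j) (eq j)))

    lin-residues : ∀ x (n : Fin g → ℕ) → (∀ j → (+ q) ℤ.∣ (coord x j ℤ.- + n j)) → x ≈ lin n
    lin-residues x n eq = coord-inj (λ j → ∣-diff-trans (coord x j) (+ n j) (coord (lin n) j) (eq j)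
      (∣-diff-sym (coord (lin n) j) (+ n j) (coord-lin n j)))

    private
      rep : (Fin g → ℤ) → Fin g → ℕ
      rep z j = toℕ (proj₁ (residue q (z j)))

      coord-lin-rep : ∀ z j → (+ q) ℤ.∣ (coord (lin (rep z)) j ℤ.- z j)
      coord-lin-rep z j = ∣-diff-trans (coord (lin (rep z)) j) (+ rep z j) (z j) (coord-lin (rep z) j)
        (∣-diff-sym (z j) (+ rep z j) (proj₂ (residue q (z j))))

    -- Up to equality `coord` is a bijection onto (ℤ/q)^g, with inverse `lin` of the residues.
    -- Through it 𝔸 acquires decidable equality.
    E𝔸 : Enum setoid
    E𝔸 = Subset.enum (enumΠ (λ (_ : Fin g) → enumℤmod q)) setoid {P = λ _ → ⊤} (λ _ → yes tt) (λ _ _ → tt)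
      (λ z _ → lin (rep z)) coord (λ _ → tt) coord.f-cong coord-inj (λ z _ → coord-lin-rep z)

    open PGroup p pr (suc e) 𝔸 E𝔸 torsion𝔸 using (span; trivial; span-∋; whole; multiples; torsionₚ; card-sub)

    ι-spans : ∀ x → x ∈ₛ span trivial ι
    ι-spans x = S.resp (sym (lin-residues x (rep (coord x)) (λ j → proj₂ (residue q (coord x j)))))
      (sum∈ S.isSubgroup _ (λ k → S.×∈ (rep (coord x) k) (span-∋ trivial ι k)))
      where module S = DecSubgroup (span trivial ι)

    -- Used with d = p^e for the p-torsion and with d = p for the Frattini subgroup. The bound m on
    -- the coefficients lets them serve as the parametrisation by which the p-torsion is counted.
    ∣coord⇒multiple : ∀ d m .⦃ _ : NonZero m ⦄ → d * m ≡ q → ∀ x → (∀ j → (+ d) ℤ.∣ coord x j) →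
                      ∃ λ (t : Fin g → Fin m) → d × lin (toℕ ∘ t) ≈ x
    ∣coord⇒multiple d m dm≡q x d∣ =
      (λ j → proj₁ (digit d m (coord x j) (d∣ j))) ,
      trans (lin-× d _) (sym (lin-residues x _ (λ j →
        subst (λ k → (+ k) ℤ.∣ (coord x j ℤ.- + (d * toℕ (proj₁ (digit d m (coord x j) (d∣ j)))))) dm≡q
              (proj₂ (digit d m (coord x j) (d∣ j))))))

    p-torsion⇒∣coord : ∀ x → p × x ≈ ε → ∀ j → (+ (p ^ e)) ℤ.∣ coord x j
    p-torsion⇒∣coord x px≈ε j = ℤ.*-cancelˡ-∣ (+ p) (subst (ℤ._∣ (+ p ℤ.* coord x j)) (ℤ.pos-* p (p ^ e))
      (∣-diff⇒∣ (∣-diff-sym (coord (p × x) j) (+ p ℤ.* coord x j) (coord-× p x j))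
        (∣-diff⇒∣ {y = 0ℤ} (ℤq.trans {coord (p × x) j} {coord ε j} {0ℤ} (coord.f-cong px≈ε j) (coord.f-ε j)) (ℤ.divides 0ℤ ≡.refl))))
      where module ℤq = AbelianGroup (ℤmodᵃ q)

    p-torsion-divisible : ∀ x → p × x ≈ ε → ∃ λ y → (p ^ e) × y ≈ x
    p-torsion-divisible x px≈ε =
      let (t , eq) = ∣coord⇒multiple (p ^ e) p (*-comm (p ^ e) p) x (p-torsion⇒∣coord x px≈ε) in lin (toℕ ∘ t) , eq

    card-p-torsion : card-sub (torsionₚ whole) ≡ p ^ g
    card-p-torsion = ≡.trans
      (count-image E𝔸 (enumΠ (λ (_ : Fin g) → enumFin p)) h
        (λ t≗u → ×-congʳ (p ^ e) (sum-cong-≋ (λ k → ×-congˡ (cong toℕ (t≗u k)))))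
        h-inj (DecSubgroup.mem? (torsionₚ whole)) (DecSubgroup.resp (torsionₚ whole))
        (λ {x} (_ , px≈ε) → ∣coord⇒multiple (p ^ e) p (*-comm (p ^ e) p) x (p-torsion⇒∣coord x px≈ε))
        (λ t → tt , trans (×-assocˡ _ p (p ^ e)) (torsion𝔸 _)))
      (≡.trans (card-enumΠ (λ (_ : Fin g) → enumFin p))
        (≡.trans (∏ℕ-cong {g} (λ _ → card-enumFin p)) (∏ℕ-const g p)))
      where
      h : (Fin g → Fin p) → Carrier
      h t = (p ^ e) × lin (toℕ ∘ t)
      coord-h : ∀ t j → (+ q) ℤ.∣ (coord (h t) j ℤ.- + (p ^ e * toℕ (t j)))
      coord-h t j = ∣-diff-trans (coord (h t) j) (coord (lin (λ k → p ^ e * toℕ (t k))) j) _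
        (coord.f-cong (lin-× (p ^ e) (toℕ ∘ t)) j) (coord-lin (λ k → p ^ e * toℕ (t k)) j)
      h-inj : ∀ {t u} → h t ≈ h u → ∀ j → t j ≡ u j
      h-inj {t} {u} eq j = digit-unique (p ^ e) p (t j) (u j)
        (subst (λ k → (+ k) ℤ.∣ (+ (p ^ e * toℕ (t j)) ℤ.- + (p ^ e * toℕ (u j)))) (*-comm p (p ^ e))
          (∣-diff-trans (+ (p ^ e * toℕ (t j))) (coord (h t) j) (+ (p ^ e * toℕ (u j)))
            (∣-diff-sym (coord (h t) j) (+ (p ^ e * toℕ (t j))) (coord-h t j))
            (∣-diff-trans (coord (h t) j) (coord (h u) j) (+ (p ^ e * toℕ (u j))) (coord.f-cong eq j) (coord-h u j))))

    module _ (j : Fin g) where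
      private
        M : Pred Carrier 0ℓ
        M x = (+ p) ℤ.∣ coord x j

        p∣q : (+ p) ℤ.∣ (+ q)
        p∣q = ℤ.divides (+ (p ^ e)) (≡.trans (cong +_ (*-comm p (p ^ e))) (ℤ.pos-* (p ^ e) p))

        weaken : ∀ {z} → (+ q) ℤ.∣ z → (+ p) ℤ.∣ z
        weaken = ℤ.∣-trans p∣q

        M-isSubgroup : IsSubgroup group M
        M-isSubgroup = record
          { resp = λ {x} {y} x≈y p∣x → ∣-diff⇒∣ (weaken (coord.f-cong (sym x≈y) j)) p∣x
          ; ε∈   = ∣-diff⇒∣ {y = 0ℤ} (weaken (coord.f-ε j)) (ℤ.divides 0ℤ ≡.refl)
          ; ∙∈   = λ {x} {y} p∣x p∣y → ∣-diff⇒∣ (weaken (coord.f-∙ x y j)) (ℤ.∣m∣n⇒∣m+n p∣x p∣y)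
          ; ⁻¹∈  = λ {x} p∣x → ∣-diff⇒∣ (weaken (coord.f-⁻¹ x j)) (ℤ.∣m⇒∣-m p∣x)
          }

        coord-ιⱼ : (+ q) ℤ.∣ (coord (ι j) j ℤ.- 1ℤ)
        coord-ιⱼ = subst (λ d → (+ q) ℤ.∣ (coord (ι j) j ℤ.- + d)) (δ-diag j) (coord-ι j j)

        ι∉M : ¬ M (ι j)
        ι∉M p∣ = <⇒≱ (PGroup.1<p p pr (suc e) 𝔸 E𝔸 torsion𝔸)
          (∣⇒≤ (ℤ.∣⇒∣ᵤ (∣-diff⇒∣ {x = 1ℤ} {y = coord (ι j) j} (∣-diff-sym (coord (ι j) j) 1ℤ (weaken coord-ιⱼ)) p∣)))

        reduce : ∀ x → ∃ λ (i : Fin p) → M (x // toℕ i × ι j)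
        reduce x = let (i , p∣) = residue p (coord x j) in i ,
          ∣-diff⇒∣ (weaken (coord.f-// x (toℕ i × ι j) j))
            (∣-diff-trans (coord x j) (+ toℕ i) (coord (toℕ i × ι j) j) p∣
              (∣-diff-sym (coord (toℕ i × ι j) j) (+ toℕ i)
                (subst (λ d → (+ p) ℤ.∣ (coord (toℕ i × ι j) j ℤ.- + d))
                  (≡.trans (cong (toℕ i *_) (δ-diag j)) (*-identityʳ (toℕ i))) (weaken (coord-×ι (toℕ i) j j)))))

        p×∈M : ∀ x → M (p × x)
        p×∈M x = ∣-diff⇒∣ (weaken (coord-× p x j)) (ℤ.∣m⇒∣m*n (coord x j) ℤ.∣-refl)

      -- Modulo `M` every y is i ι_j with i < p, and if y is outside `M` then i is invertible modulo
      -- p. A larger subgroup with an element outside `M` thus contains ι_j, hence everything. These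
      -- g subgroups already intersect in p𝔸, which is what `Frattini⇒multiple` needs.
      coordinate-maximal : IsMaximalSubgroup group M
      coordinate-maximal = record
        { isSubgroup = M-isSubgroup
        ; decidable  = λ x → (+ p) ℤ.∣? coord x j
        ; proper     = λ all → ι∉M (all (ι j))
        ; maximal    = max
        }
        where
        max : ∀ (K : Pred Carrier 0ℓ) → IsSubgroup group K → (∀ x → Dec (K x)) → M ⊆ K → K ⊆ M ⊎ (∀ x → x ∈ K)
        max K sub K? M⊆K with K? (ι j)
        ... | yes ι∈K = inj₂ λ x → let (i , x∈) = reduce x in K.//∈⇒∈ (M⊆K x∈) (K.×∈ (toℕ i) ι∈K)
          where module K = Sub sub
        ... | no ι∉K = inj₁ λ {y} y∈K → case (+ p) ℤ.∣? coord y j of λ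
          { (yes y∈M) → y∈M
          ; (no y∉M)  → contradiction (ι∈K y y∈K y∉M) ι∉K
          }
          where
          module K = Sub sub
          module M = Sub M-isSubgroup
          ι∈K : ∀ y → y ∈ K → ¬ M y → ι j ∈ K
          ι∈K y y∈K y∉M = let (i , h) = reduce y in
            K.coprime-× (prime⇒coprime pr ⦃ ≢-nonZero (λ i≡0 → y∉M (M.resp (trans (∙-congˡ (⁻¹-cong (×-congˡ i≡0))) (x//ε≈x y)) h)) ⦄ (Fin.toℕ<n i))
              (M⊆K (p×∈M (ι j)))
              (K.resp (trans (∙-congˡ (trans (⁻¹-cong refl) refl)) (lemma y (toℕ i × ι j))) (K.//∈ y∈K (M⊆K h)))
            where
            lemma : ∀ y z → y // (y // z) ≈ z
            lemma y z = trans (∙-congˡ (⁻¹-anti-homo-// y z)) (trans (comm y (z // y)) (x//y∙y z y))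

    Frattini⇒multiple : ∀ {x} → Frattini group x → x ∈ₛ multiples whole
    Frattini⇒multiple {x} x∈Φ =
      let (t , eq) = ∣coord⇒multiple p (p ^ e) ≡.refl x (λ j → x∈Φ _ (coordinate-maximal j)) in lin (toℕ ∘ t) , tt , eq

-- The Frattini subgroup of a finite abelian p-group

module _ (p : ℕ) (pr : Prime p) (e : ℕ) (B : AbelianGroup 0ℓ 0ℓ) (E : Enum (AbelianGroup.setoid B))
         (torsion : ∀ x → AbelianGroup._≈_ B (Multiples._×_ B (p ^ e) x) (AbelianGroup.ε B)) where
  open AbelianGroup B
  open PGroup p pr e B E torsion

  -- If p y ∉ M then M + ⟨p y⟩ is everything, so y ≡ n p y ≡ (n p)^e y = 0 modulo M.
  multiple⇒Frattini : ∀ {x} → x ∈ₛ multiples whole → Frattini group x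
  multiple⇒Frattini {x} (y , _ , py≈x) M max with IsMaximalSubgroup.decidable max x
  ... | yes x∈M = x∈M
  ... | no x∉M  = case IsMaximalSubgroup.maximal max K.mem K.isSubgroup K.mem? (⊕-⊇ Mˢ x) of λ
    { (inj₁ K⊆M)   → K⊆M (⊕-∋ Mˢ x)
    ; (inj₂ all∈K) → M.resp py≈x (M.×∈ p (y∈M (proj₁ (all∈K y)) (proj₂ (all∈K y))))
    }
    where
    Mˢ : DecSubgroup
    Mˢ = record
      { mem        = M
      ; isSubgroup = IsMaximalSubgroup.isSubgroup max
      ; mem?       = IsMaximalSubgroup.decidable max
      }
    module M = DecSubgroup Mˢ
    module K = DecSubgroup (Mˢ ⊕ x)

    y∈M : ∀ n → M (y // n × x) → M y
    y∈M n h = M.//∈⇒∈ (power e) (M.≈ε⇒∈ (trans (×-congˡ (^-distribʳ-* e n p)) (trans (sym (×-assocˡ y (n ^ e) (p ^ e)))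
                        (trans (×-congʳ (n ^ e) (torsion y)) (×-ε (n ^ e))))))
      where
      m = n * p
      base : M (y // m × y)
      base = M.resp (∙-congˡ (⁻¹-cong (trans (×-congʳ n (sym py≈x)) (×-assocˡ y n p)))) h
      power : ∀ j → M (y // (m ^ j) × y)
      power zero    = M.≈ε⇒∈ (≈⇒//≈ε (sym (×-homo-1 y)))
      power (suc j) = M.resp eq (M.∙∈ base (M.×∈ m (power j)))
        where
        open SetoidReasoning setoid
        eq : (y // m × y) ∙ m × (y // (m ^ j) × y) ≈ y // (m ^ suc j) × y
        eq = begin
          (y // m × y) ∙ m × (y // (m ^ j) × y)             ≈⟨ ∙-congˡ (×-// m y ((m ^ j) × y)) ⟩
          (y // m × y) ∙ (m × y // m × ((m ^ j) × y))       ≈⟨ assoc (y // m × y) (m × y) _ ⟨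
          (y // m × y) ∙ m × y // m × ((m ^ j) × y)         ≈⟨ ∙-cong (x//y∙y y (m × y)) (⁻¹-cong (×-assocˡ y m (m ^ j))) ⟩
          y // (m ^ suc j) × y                              ∎

-- Coordinates on F^ab / P_(e+1)(F^ab)

module FreeAbelianQuotient (p : ℕ) (pr : Prime p) (e g : ℕ) (F : TopGroup) (free : IsFreeProP p g F) where
  private
    q : ℕ
    q = p ^ suc e

    instance
      p-nonZero : NonZero p
      p-nonZero = prime⇒nonZero pr

      q-nonZero : NonZero q
      q-nonZero = m^n≢0 p (suc e)

    module F = TopGroup F
    module Fab = TopGroup (ab F)
    open IsFreeProP free using (ι; generates)

    𝔸 Z : AbelianGroup 0ℓ 0ℓ
    𝔸 = abQuotient p F (suc e)
    Z = ∏ℤmod (λ (_ : Fin g) → q)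

    module 𝔸 = AbelianGroup 𝔸
    module M𝔸 = Multiples 𝔸
    module Z = AbelianGroup Z
    module P = IsNormalSubgroup (P-isNormal p (ab F) (suc e))

    EZ : Enum Z.setoid
    EZ = enumΠ (λ (_ : Fin g) → enumℤmod q)

    card-Z : Enum.card EZ ≡ p ^ (suc e * g)
    card-Z = ≡.trans (card-enumΠ (λ (_ : Fin g) → enumℤmod q))
      (≡.trans (∏ℕ-cong {g} (λ _ → card-enumℤmod q)) (≡.trans (∏ℕ-const g q) (^-*-assoc p (suc e) g)))

    torsionZ : ∀ x → Multiples._×_ Z q x Z.≈ Z.ε
    torsionZ x j = ∣-diff⇒∣ {y = + q ℤ.* x j} (∣-diff-refl (≡.trans (ℤ.+-identityʳ _) (∏ℤmod-× (λ (_ : Fin g) → q) q x j)))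
                            (ℤ.∣m⇒∣m*n (x j) ℤ.∣-refl)

    extended : Σ[ f ∈ (F.Carrier → Z.Carrier) ]
                 (IsContinuousHom F (discrete Z.group) f ∧ IsHom 𝔸 Z f ∧ (∀ k → f (ι k) Z.≈ (λ j → + δ k j)))
    extended = extension p F (suc e) Z free (finiteEnum EZ) (suc e * g , card-Z) torsionZ (λ k j → + δ k j)

  coord : F.Carrier → Fin g → ℤ
  coord = proj₁ extended

  coord-isHom : IsHom 𝔸 Z coord
  coord-isHom = proj₁ (proj₂ (proj₂ extended))

  coord-ι : ∀ k j → (+ q) ℤ.∣ (coord (ι k) j ℤ.- + δ k j)
  coord-ι = proj₂ (proj₂ (proj₂ extended))

  torsion𝔸 : ∀ x → (p ^ suc e) M𝔸.× x 𝔸.≈ 𝔸.ε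
  torsion𝔸 x = P.resp (Fab.sym (MFab.x//ε≈x _)) (subst (P p (ab F) (suc e)) (×≡ q) (power∈P p (ab F) (suc e) x))
    where
    module MFab = Multiples (abGroup F)
    -- The two multiplications differ in the equality that their monoids carry along.
    ×≡ : ∀ n → n MFab.× x ≡ n M𝔸.× x
    ×≡ zero    = ≡.refl
    ×≡ (suc n) = cong (x F.∙_) (×≡ n)

  open Coordinates p pr e g 𝔸 torsion𝔸 ι coord coord-isHom coord-ι
    using (Combination; Combination-isSubgroup; ι-combination; coord-combination-injective)

  private
    module D = IsNormalSubgroup (Derived-isNormal F)
    module C = IsSubgroup Combination-isSubgroup

    F≈⇒Fab≈ : ∀ {x y} → x F.≈ y → x Fab.≈ y
    F≈⇒Fab≈ x≈y = D.resp (F.sym (F.trans (F.∙-congʳ x≈y) (F.inverseʳ _))) D.ε∈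

    Fab≈⇒𝔸≈ : ∀ {x y} → x Fab.≈ y → x 𝔸.≈ y
    Fab≈⇒𝔸≈ x≈y = P.resp (Fab.sym (Fab.trans (Fab.∙-congʳ x≈y) (Fab.inverseʳ _))) P.ε∈

    generated-combination : ∀ {w} → ⟨_⟩ F.group (Image F.group ι) w → Combination w
    generated-combination (gen (k , ιk≈w))   = C.resp (Fab≈⇒𝔸≈ (F≈⇒Fab≈ ιk≈w)) (ι-combination k)
    generated-combination (gen-resp x≈y x∈)  = C.resp (Fab≈⇒𝔸≈ (F≈⇒Fab≈ x≈y)) (generated-combination x∈)
    generated-combination gen-ε              = C.ε∈
    generated-combination (gen-∙ x∈ y∈)      = C.∙∈ (generated-combination x∈) (generated-combination y∈)
    generated-combination (gen-⁻¹ x∈)        = C.⁻¹∈ (generated-combination x∈)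

  -- The generators are dense, so x is a limit of combinations w of them on which coord vanishes;
  -- these lie in P_(e+1), which is closed.
  coord-injective : ∀ {x} → (∀ j → (+ q) ℤ.∣ coord x j) → x 𝔸.≈ 𝔸.ε
  coord-injective {x} q∣x = P.resp (Fab.sym (MFab.x//ε≈x x)) (Closure-closed (ab F) approx)
    where
    module MFab = Multiples (abGroup F)
    kills : ∃ λ i₀ → ∀ {y} → y ∈ F.basis i₀ → coord y Z.≈ Z.ε
    kills = IsContinuousHom.continuous (proj₁ (proj₂ extended)) tt
    close : ∀ {w} → F.basis (proj₁ kills) (x MFab.// w) → ∀ j → (+ q) ℤ.∣ (coord x j ℤ.- coord w j)
    close {w} h j = ∣-diff⇒∣ {x = coord x j ℤ.- coord w j} {y = coord (x MFab.// w) j}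
      (∣-diff-sym (coord (x MFab.// w) j) (coord x j ℤ.- coord w j) (IsHom.f-// coord-isHom x w j))
      (∣-diff⇒∣ {y = 0ℤ} (proj₂ kills h j) (ℤ.divides 0ℤ ≡.refl))
    approx : ∀ i → ∃ λ w → P p (ab F) (suc e) w ∧ Fab.basis i (x MFab.// w)
    approx i =
      let (k , k⊆i , k⊆i₀) = F.directed i (proj₁ kills)
          (w , w∈ , h)     = generates x k
          w≈ε              = coord-combination-injective (generated-combination w∈) (λ j →
            ∣-diff⇒∣ {x = coord w j} {y = coord x j} (∣-diff-sym (coord x j) (coord w j) (close (k⊆i₀ h) j)) (q∣x j))
      in w , P.resp (MFab.x//ε≈x w) w≈ε , x MFab.// w , k⊆i h , ≈ε⇒∈Derived (F.inverseʳ _)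
      where
      ≈ε⇒∈Derived : ∀ {y} → y F.≈ F.ε → Derived F y
      ≈ε⇒∈Derived y≈ε = D.resp (F.sym y≈ε) D.ε∈

-- The rank of a finite abelian p-group

module _ (p : ℕ) (pr : Prime p) (e : ℕ) (G : AbelianGroup 0ℓ 0ℓ) (E : Enum (AbelianGroup.setoid G))
         (torsion : ∀ x → AbelianGroup._≈_ G (Multiples._×_ G (p ^ e) x) (AbelianGroup.ε G)) where
  open AbelianGroup G
  open PGroup p pr e G E torsion

  private
    instance
      p-nonZero : NonZero p
      p-nonZero = prime⇒nonZero pr

  Generates⇒spans : ∀ {n} (t : Fin n → Carrier) → Generates group t → span trivial t ≐ₛ whole
  Generates⇒spans t gens = _ , λ {x} _ → go (gens x)
    where
    module S = DecSubgroup (span trivial t)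
    go : ∀ {x} → ⟨_⟩ group (Image group t) x → x ∈ₛ span trivial t
    go (gen (k , tk≈x))  = S.resp tk≈x (span-∋ trivial t k)
    go (gen-resp x≈y x∈) = S.resp x≈y (go x∈)
    go gen-ε             = S.ε∈
    go (gen-∙ x∈ y∈)     = S.∙∈ (go x∈) (go y∈)
    go (gen-⁻¹ x∈)       = S.⁻¹∈ (go x∈)

  spans⇒Generates : ∀ {n} (t : Fin n → Carrier) → span trivial t ≐ₛ whole → Generates group t
  spans⇒Generates t (_ , whole⊆) x = span-min trivial t (⟨⟩-isSubgroup group _)
    (λ x≈ε → gen-resp (sym x≈ε) gen-ε) (λ k → gen (k , refl)) (whole⊆ {x} tt)

  -- |G[p]| = |G/pG| = p^d for some d. By the counting formula generating n-tuples exist for n = d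
  -- and never for n < d: the given generators yield d ≤ g, and minimality against a generating
  -- d-tuple yields g ≤ d.
  card-p-torsion≡p^rank : ∀ {g} → HasRank group g → card-sub (torsionₚ whole) ≡ p ^ g
  card-p-torsion≡p^rank {g} rank = ≡.trans card-torsion (cong (p ^_) (≤-antisym d≤g g≤d))
    where
    open HasRank rank
    open Surjections p

    index : ∃ λ d → card-sub whole ≡ p ^ d * card-sub (multiples whole)
    index = index-p-power whole (multiples whole) _ (λ {x} _ → x , tt , refl)

    d : ℕ
    d = proj₁ index

    number : ∀ n → Enum.count (enumTuple n) (spans? whole trivial) ≡ card-sub (multiples whole) ^ n * surjections p n d
    number n = count-generating whole n d (proj₂ index)

    instance
      pG-nonZero : NonZero (card-sub (multiples whole))
      pG-nonZero = ≢-nonZero (card-sub≢0 (multiples whole))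

    card-torsion : card-sub (torsionₚ whole) ≡ p ^ d
    card-torsion = *-cancelˡ-≡ _ _ (card-sub (multiples whole))
      (≡.trans (≡.sym (card-multiples*torsion whole)) (≡.trans (proj₂ index) (*-comm (p ^ d) _)))

    spans-resp : ∀ {n} {t u : Fin n → Carrier} → (∀ k → t k ≈ u k) → span trivial t ≐ₛ whole → span trivial u ≐ₛ whole
    spans-resp {t = t} {u} t≈u (_ , whole⊆) = _ , λ {x} _ → span-min trivial t S.isSubgroup S.≈ε⇒∈
      (λ k → S.resp (sym (t≈u k)) (span-∋ trivial u k)) (whole⊆ {x} tt)
      where module S = DecSubgroup (span trivial u)

    d≤g : d ≤ g
    d≤g = surjections≢0⇒≤ g d λ s≡0 → Enum.count≢0 (enumTuple g) (λ {t} {u} → spans-resp {g} {t} {u})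
      (spans? whole trivial) (generators , Generates⇒spans generators generates)
      (≡.trans (number g) (≡.trans (cong (card-sub (multiples whole) ^ g *_) s≡0) (*-zeroʳ (card-sub (multiples whole) ^ g))))

    g≤d : g ≤ d
    g≤d = let (t , spans) = Any.satisfied (∑≢0⇒Any (spans? whole trivial) (Enum.elems (enumTuple d)) nonempty)
          in minimal t (spans⇒Generates t spans)
      where
      instance
        s-nonZero : NonZero (surjections p d d)
        s-nonZero = ≢-nonZero (surjections-diagonal≢0 1<p d)
        pG^-nonZero : NonZero (card-sub (multiples whole) ^ d)
        pG^-nonZero = m^n≢0 (card-sub (multiples whole)) d
      nonempty : Enum.count (enumTuple d) (spans? whole trivial) ≢ 0
      nonempty eq = ≢-nonZero⁻¹ (card-sub (multiples whole) ^ d * surjections p d d)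
        ⦃ m*n≢0 (card-sub (multiples whole) ^ d) (surjections p d d) ⦄ (≡.trans (≡.sym (number d)) eq)

-- Divisors of prime powers

module _ (p : ℕ) (pr : Prime p) where
  private
    instance
      p-nonZero : NonZero p
      p-nonZero = prime⇒nonZero pr

  ∣p^⇒p∣ : ∀ c {m} → m ∣ p ^ c → 1 < m → p ∣ m
  ∣p^⇒p∣ c {m} m∣ 1<m with p ℕ.∣? m
  ... | yes p∣m = p∣m
  ... | no p∤m  = contradiction (∣1⇒≡1 (strip c m∣)) (λ m≡1 → <⇒≢ 1<m (≡.sym m≡1))
    where
    coprime : Coprime m p
    coprime (d∣m , d∣p) with prime⇒irreducible pr d∣p
    ... | inj₁ d≡1 = d≡1
    ... | inj₂ d≡p = contradiction (subst (_∣ m) d≡p d∣m) p∤m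
    strip : ∀ c → m ∣ p ^ c → m ∣ 1
    strip zero    m∣ = m∣
    strip (suc c) m∣ = strip c (coprime-divisor coprime m∣)

  -- The cofactor p^(c+1) / m exceeds 1 and divides a power of p, so a factor p can be split off it.
  ∣p^∧<⇒∣p^pred : ∀ c {m} → m ∣ p ^ suc c → m < p ^ suc c → m ∣ p ^ c
  ∣p^∧<⇒∣p^pred c {m} (divides k eq) m< =
    let (divides k' k≡) = ∣p^⇒p∣ (suc c) {k} (divides m (≡.trans eq (*-comm k m))) 1<k
    in divides k' (*-cancelˡ-≡ (p ^ c) (k' * m) p (≡.trans eq (≡.trans (cong (_* m) (≡.trans k≡ (*-comm k' p))) (*-assoc p k' m))))
    where
    1<k : 1 < k
    1<k = ≰⇒> λ k≤1 → <⇒≱ m< (≤-trans (≤-reflexive eq) (≤-trans (*-monoˡ-≤ m k≤1) (≤-reflexive (*-identityˡ m))))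

-- Cyclic decompositions

module Decomposition (p : ℕ) (pr : Prime p) (c : ℕ) (G : AbelianGroup 0ℓ 0ℓ) (E : Enum (AbelianGroup.setoid G))
  (torsion : ∀ x → AbelianGroup._≈_ G (Multiples._×_ G (p ^ suc c) x) (AbelianGroup.ε G))
  {r : ℕ} (ms : Vec ℕ r) (decomposition : IsCyclicDecomposition (AbelianGroup.group G) ms)
  where
  open AbelianGroup G
  open PGroup p pr (suc c) G E torsion

  private
    open IsCyclicDecomposition decomposition using (nontrivial; iso)

    m : Fin r → ℕ
    m = lookup ms

    Z : AbelianGroup 0ℓ 0ℓ
    Z = ∏ℤmod m

    module Z = AbelianGroup Z
    module I = IsGroupIsomorphism (proj₂ iso)

    φ : Carrier → Fin r → ℤ
    φ = proj₁ iso

    φ-isHom : IsHom G Z φ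
    φ-isHom = isHom {G} {Z} I.isGroupHomomorphism

    module φ = IsHom φ-isHom

    φ-× : ∀ n x i → (+ m i) ℤ.∣ (φ (n × x) i ℤ.- + n ℤ.* φ x i)
    φ-× n x i = subst (λ z → (+ m i) ℤ.∣ (φ (n × x) i ℤ.- z)) (∏ℤmod-× m n (φ x) i) (φ.f-× n x i)

    inv : (Fin r → ℤ) → Carrier
    inv z = proj₁ (I.surjective z)

    φ-inv : ∀ z i → (+ m i) ℤ.∣ (φ (inv z) i ℤ.- z i)
    φ-inv z = proj₂ (I.surjective z) refl

    instance
      p-nonZero : NonZero p
      p-nonZero = prime⇒nonZero pr

    1<m : ∀ i → 1 < m i
    1<m i = All.lookup nontrivial (∈-lookup i ms)

    m-nonZero : ∀ i → NonZero (m i)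
    m-nonZero i = >-nonZero (<-trans (s≤s z≤n) (1<m i))

    -- The exponent bound, applied to the element with all coordinates 1.
    m∣p^ : ∀ i → m i ∣ p ^ suc c
    m∣p^ i = ℤ.∣⇒∣ᵤ (∣-diff⇒∣ {x = + (p ^ suc c)} {y = + (p ^ suc c) ℤ.* φ x i}
      (subst (λ z → (+ m i) ℤ.∣ (z ℤ.- + (p ^ suc c) ℤ.* φ x i)) (ℤ.*-identityʳ (+ (p ^ suc c)))
        (subst ((+ m i) ℤ.∣_) (lemma (+ (p ^ suc c)) (φ x i)) (ℤ.∣n⇒∣m*n (+ (p ^ suc c)) (∣-diff-sym (φ x i) 1ℤ (φ-inv (λ _ → 1ℤ) i)))))
      (∣-diff⇒∣ {x = + (p ^ suc c) ℤ.* φ x i} {y = φ ((p ^ suc c) × x) i}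
        (∣-diff-sym (φ ((p ^ suc c) × x) i) (+ (p ^ suc c) ℤ.* φ x i) (φ-× (p ^ suc c) x i))
        (∣-diff⇒∣ {y = φ ε i} (φ.f-cong (torsion x) i) (∣-diff⇒∣ {y = 0ℤ} (φ.f-ε i) (ℤ.divides 0ℤ ≡.refl)))))
      where
      x = inv (λ _ → 1ℤ)
      lemma : ∀ n z → n ℤ.* (1ℤ ℤ.- z) ≡ n ℤ.* 1ℤ ℤ.- n ℤ.* z
      lemma = solve-∀ℤ

    module _ (d k : Fin r → ℕ) (dk≡m : ∀ i → d i * k i ≡ m i) where
      private
        h : (∀ i → Fin (k i)) → Carrier
        h t = inv (λ i → + (d i * toℕ (t i)))

        d∣m : ∀ i → (+ d i) ℤ.∣ (+ m i)
        d∣m i = ℤ.divides (+ k i) (≡.trans (cong +_ (≡.trans (≡.sym (dk≡m i)) (*-comm (d i) (k i)))) (ℤ.pos-* (k i) (d i)))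

        dk-nonZero : ∀ i → NonZero (d i * k i)
        dk-nonZero i = subst NonZero (≡.sym (dk≡m i)) (m-nonZero i)

        d-nonZero : ∀ i → NonZero (d i)
        d-nonZero i = m*n≢0⇒m≢0 (d i) ⦃ dk-nonZero i ⦄

        k-nonZero : ∀ i → NonZero (k i)
        k-nonZero i = m*n≢0⇒n≢0 (d i) ⦃ dk-nonZero i ⦄

        digits : ∀ x → (∀ i → (+ d i) ℤ.∣ φ x i) → ∀ i → ∃ λ (t : Fin (k i)) → (+ (d i * k i)) ℤ.∣ (φ x i ℤ.- + (d i * toℕ t))
        digits x d∣ i = digit (d i) (k i) ⦃ k-nonZero i ⦄ (φ x i) (d∣ i)

      ∣coord⇒digits : ∀ x → (∀ i → (+ d i) ℤ.∣ φ x i) → ∃ λ (t : ∀ i → Fin (k i)) → h t ≈ x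
      ∣coord⇒digits x d∣ = (λ i → proj₁ (digits x d∣ i)) , I.injective (λ i →
        ∣-diff-trans (φ (h _) i) (+ (d i * toℕ (proj₁ (digits x d∣ i)))) (φ x i) (φ-inv _ i)
          (∣-diff-sym (φ x i) _ (subst (λ k → (+ k) ℤ.∣ (φ x i ℤ.- + (d i * toℕ (proj₁ (digits x d∣ i))))) (dk≡m i) (proj₂ (digits x d∣ i)))))

      -- With m_i = d_i k_i, the multiples of d_i in ℤ/m_i are the d_i t with digits t < k_i. Both
      -- G[p] and p^c G are described by such divisibility conditions.
      count-∣coord : {P : Carrier → Set} (P? : ∀ x → Dec (P x)) → (∀ {x y} → x ≈ y → P x → P y) →
        (∀ {x} → P x → ∀ i → (+ d i) ℤ.∣ φ x i) → (∀ {x} → (∀ i → (+ d i) ℤ.∣ φ x i) → P x) →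
        Enum.count E P? ≡ ∏ℕ k
      count-∣coord P? resp P⇒∣ ∣⇒P = ≡.trans
        (count-image E (enumΠ (λ i → enumFin (k i))) h
          (λ {t} {u} t≗u → I.injective (λ i → ∣-diff-trans (φ (h t) i) (+ (d i * toℕ (t i))) (φ (h u) i) (φ-inv _ i)
            (∣-diff-sym (φ (h u) i) (+ (d i * toℕ (t i)))
              (subst (λ j → (+ m i) ℤ.∣ (φ (h u) i ℤ.- + (d i * toℕ j))) (≡.sym (t≗u i)) (φ-inv _ i)))))
          (λ {t} {u} ht≈hu i → digit-unique (d i) (k i) ⦃ d-nonZero i ⦄ (t i) (u i)
            (subst (λ k → (+ k) ℤ.∣ (+ (d i * toℕ (t i)) ℤ.- + (d i * toℕ (u i)))) (≡.sym (dk≡m i))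
              (∣-diff-trans (+ (d i * toℕ (t i))) (φ (h t) i) (+ (d i * toℕ (u i)))
                (∣-diff-sym (φ (h t) i) (+ (d i * toℕ (t i))) (φ-inv _ i))
                (∣-diff-trans (φ (h t) i) (φ (h u) i) (+ (d i * toℕ (u i))) (φ.f-cong ht≈hu i) (φ-inv _ i)))))
          P? resp
          (λ {x} px → ∣coord⇒digits x (P⇒∣ px))
          (λ t → ∣⇒P (λ i → ∣-diff⇒∣ {x = φ (h t) i} {y = + (d i * toℕ (t i))} (ℤ.∣-trans (d∣m i) (φ-inv _ i))
            (ℤ.divides (+ toℕ (t i)) (≡.trans (cong +_ (*-comm (d i) (toℕ (t i)))) (ℤ.pos-* (toℕ (t i)) (d i)))))))
        (≡.trans (card-enumΠ (λ i → enumFin (k i))) (∏ℕ-cong (λ i → card-enumFin (k i))))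

  -- In ℤ/m_i the p-torsion is generated by m_i / p. Compared with `card-p-torsion≡p^rank` this
  -- shows that the number of nontrivial cyclic factors is the rank.
  card-p-torsion≡p^length : card-sub (torsionₚ whole) ≡ p ^ r
  card-p-torsion≡p^length = ≡.trans
    (count-∣coord d (λ _ → p) dp≡m (DecSubgroup.mem? (torsionₚ whole)) (DecSubgroup.resp (torsionₚ whole)) torsion⇒∣ ∣⇒torsion)
    (∏ℕ-const r p)
    where
    d : Fin r → ℕ
    d i = ℕ.quotient (∣p^⇒p∣ p pr (suc c) (m∣p^ i) (1<m i))
    dp≡m : ∀ i → d i * p ≡ m i
    dp≡m i = ≡.sym (_∣_.equality (∣p^⇒p∣ p pr (suc c) (m∣p^ i) (1<m i)))
    +m≡ : ∀ i → + m i ≡ + p ℤ.* + d i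
    +m≡ i = ≡.trans (cong +_ (≡.trans (≡.sym (dp≡m i)) (*-comm (d i) p))) (ℤ.pos-* p (d i))
    torsion⇒∣ : ∀ {x} → x ∈ₛ torsionₚ whole → ∀ i → (+ d i) ℤ.∣ φ x i
    torsion⇒∣ {x} (_ , px≈ε) i = ℤ.*-cancelˡ-∣ (+ p) (subst (ℤ._∣ (+ p ℤ.* φ x i)) (+m≡ i)
      (∣-diff⇒∣ {y = φ (p × x) i} (∣-diff-sym (φ (p × x) i) (+ p ℤ.* φ x i) (φ-× p x i))
        (∣-diff⇒∣ {y = φ ε i} (φ.f-cong px≈ε i) (∣-diff⇒∣ {y = 0ℤ} (φ.f-ε i) (ℤ.divides 0ℤ ≡.refl)))))
    ∣⇒torsion : ∀ {x} → (∀ i → (+ d i) ℤ.∣ φ x i) → x ∈ₛ torsionₚ whole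
    ∣⇒torsion {x} d∣ = tt , I.injective (λ i → ∣-diff-trans (φ (p × x) i) (+ p ℤ.* φ x i) (φ ε i) (φ-× p x i)
      (∣-diff-trans (+ p ℤ.* φ x i) 0ℤ (φ ε i)
        (subst ((+ m i) ℤ.∣_) (≡.sym (ℤ.+-identityʳ _)) (subst (ℤ._∣ (+ p ℤ.* φ x i)) (≡.sym (+m≡ i)) (ℤ.*-monoʳ-∣ (+ p) (d∣ i))))
        (∣-diff-sym (φ ε i) 0ℤ (φ.f-ε i))))

  p^cG : DecSubgroup
  p^cG = image E E (×-isHom G (p ^ c)) whole

  private
    q : ℕ
    q = p ^ suc c

    -- `D` is a generator of the subgroup p^c (ℤ/m_i) and `K` its order. For m_i < p^(c+1) one has
    -- m_i | p^c and the subgroup vanishes; otherwise m_i = p^(c+1) and it has order p.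
    D : ∀ i → Dec (m i < q) → ℕ
    D i small? = if does small? then m i else p ^ c

    K : ∀ {n} → Dec (n < q) → ℕ
    K small? = if does small? then 1 else p

    DK≡m : ∀ i (small? : Dec (m i < q)) → D i small? * K small? ≡ m i
    DK≡m i (yes _)  = *-identityʳ (m i)
    DK≡m i (no m≮q) = ≡.trans (*-comm (p ^ c) p)
      (≤-antisym (≮⇒≥ m≮q) (∣⇒≤ ⦃ m^n≢0 p (suc c) ⦄ (m∣p^ i)))

    D∣p^c : ∀ i (small? : Dec (m i < q)) → D i small? ∣ p ^ c
    D∣p^c i (yes m<q) = ∣p^∧<⇒∣p^pred p pr c (m∣p^ i) m<q
    D∣p^c i (no _)    = ℕ.∣-refl

    -- For m i < q there is only the digit 0; otherwise D i = p ^ c.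
    D*digit : ∀ i (small? : Dec (m i < q)) (t : Fin (K small?)) → D i small? * toℕ t ≡ p ^ c * toℕ t
    D*digit i (yes _) zero = ≡.trans (*-zeroʳ (m i)) (≡.sym (*-zeroʳ (p ^ c)))
    D*digit i (no _)  t    = ≡.refl

    small? : ∀ i → Dec (m i < q)
    small? i = m i <? q

  -- Every cyclic factor accounts for exactly one p: in |p^c G| if its order is p^(c+1), in the
  -- second power if its order is smaller.
  card-p^cG : card-sub p^cG * p ^ Vec.count (λ m → m <? p ^ suc c) ms ≡ p ^ r
  card-p^cG = ≡.trans (cong (_* p ^ Vec.count (_<? q) ms)
    (count-∣coord (λ i → D i (small? i)) (λ i → K (small? i)) (λ i → DK≡m i (small? i))
      (DecSubgroup.mem? p^cG) (DecSubgroup.resp p^cG) multiple⇒∣ ∣⇒multiple))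
    (product ms)
    where
    rest : ∀ {n} → Vec ℕ n → ℕ
    rest xs = ∏ℕ (λ i → K (lookup xs i <? q))
    product : ∀ {n} (xs : Vec ℕ n) → rest xs * p ^ Vec.count (_<? q) xs ≡ p ^ n
    product []       = ≡.refl
    product (x ∷ xs) with does (x <? q)
    ... | Bool.true  = ≡.trans (lemma (rest xs) p (p ^ Vec.count (_<? q) xs)) (cong (p *_) (product xs))
      where
      lemma : ∀ a p b → 1 * a * (p * b) ≡ p * (a * b)
      lemma = solve-∀
    ... | Bool.false = ≡.trans (*-assoc p (rest xs) (p ^ Vec.count (_<? q) xs)) (cong (p *_) (product xs))
    multiple⇒∣ : ∀ {x} → x ∈ₛ p^cG → ∀ i → (+ D i (small? i)) ℤ.∣ φ x i
    multiple⇒∣ {x} (b , _ , eq) i = ∣-diff⇒∣ {x = φ x i} {y = + (p ^ c) ℤ.* φ b i}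
      (ℤ.∣-trans D∣m (∣-diff-trans (φ x i) (φ ((p ^ c) × b) i) (+ (p ^ c) ℤ.* φ b i) (φ.f-cong (sym eq) i) (φ-× (p ^ c) b i)))
      (ℤ.∣m⇒∣m*n {m = + (p ^ c)} (φ b i) (ℤ.∣ᵤ⇒∣ (D∣p^c i (small? i))))
      where
      D∣m : (+ D i (small? i)) ℤ.∣ (+ m i)
      D∣m = ℤ.∣ᵤ⇒∣ (divides (K (small? i)) (≡.trans (≡.sym (DK≡m i (small? i))) (*-comm (D i (small? i)) _)))
    ∣⇒multiple : ∀ {x} → (∀ i → (+ D i (small? i)) ℤ.∣ φ x i) → x ∈ₛ p^cG
    ∣⇒multiple {x} D∣ =
      let (t , ht≈x) = ∣coord⇒digits (λ i → D i (small? i)) (λ i → K (small? i)) (λ i → DK≡m i (small? i)) x D∣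
          b = inv (λ i → + toℕ (t i))
          z = λ i → + (D i (small? i) * toℕ (t i))
      in b , tt , trans (I.injective (λ i →
           ∣-diff-trans (φ ((p ^ c) × b) i) (+ (p ^ c) ℤ.* φ b i) (φ (inv z) i) (φ-× (p ^ c) b i)
             (∣-diff-trans (+ (p ^ c) ℤ.* φ b i) (z i) (φ (inv z) i)
               (subst ((+ m i) ℤ.∣_) (factor i t b)
                 (ℤ.∣n⇒∣m*n (+ (p ^ c)) (φ-inv (λ i → + toℕ (t i)) i)))
               (∣-diff-sym (φ (inv z) i) (z i) (φ-inv z i))))) ht≈x
      where
      lemma : ∀ n x y → n ℤ.* (x ℤ.- y) ≡ n ℤ.* x ℤ.- n ℤ.* y
      lemma = solve-∀ℤ
      factor : ∀ i (t : ∀ i → Fin (K (small? i))) b →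
        + (p ^ c) ℤ.* (φ b i ℤ.- + toℕ (t i)) ≡ + (p ^ c) ℤ.* φ b i ℤ.- + (D i (small? i) * toℕ (t i))
      factor i t b = ≡.trans (lemma (+ (p ^ c)) (φ b i) (+ toℕ (t i)))
        (cong (λ z → + (p ^ c) ℤ.* φ b i ℤ.- z)
          (≡.trans (≡.sym (ℤ.pos-* (p ^ c) (toℕ (t i)))) (cong +_ (≡.sym (D*digit i (small? i) (t i))))))

-- The measure of G at a given level

^-cancelʳ-≤ : ∀ m → 1 < m → ∀ {n o} → m ^ n ≤ m ^ o → n ≤ o
^-cancelʳ-≤ m 1<m m^n≤m^o = ≮⇒≥ λ o<n → <⇒≱ (^-monoʳ-< m 1<m o<n) m^n≤m^o

^-injectiveʳ : ∀ m → 1 < m → ∀ {n o} → m ^ n ≡ m ^ o → n ≡ o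
^-injectiveʳ m 1<m eq = ≤-antisym (^-cancelʳ-≤ m 1<m (≤-reflexive eq)) (^-cancelʳ-≤ m 1<m (≤-reflexive (≡.sym eq)))

×-torsion-≤ : ∀ (A : AbelianGroup 0ℓ 0ℓ) p {c d} → c ≤ d →
  ∀ x → AbelianGroup._≈_ A (Multiples._×_ A (p ^ c) x) (AbelianGroup.ε A) →
  AbelianGroup._≈_ A (Multiples._×_ A (p ^ d) x) (AbelianGroup.ε A)
×-torsion-≤ A p {c} {d} c≤d x eq = trans (×-congˡ split) (trans (sym (×-assocˡ x (p ^ (d ∸ c)) (p ^ c)))
  (trans (×-congʳ (p ^ (d ∸ c)) eq) (×-ε (p ^ (d ∸ c)))))
  where
  open AbelianGroup A
  open Multiples A
  split : p ^ d ≡ p ^ (d ∸ c) * p ^ c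
  split = ≡.trans (cong (p ^_) (≡.sym (m∸n+n≡m c≤d))) (^-distribˡ-+-* p (d ∸ c) c)

finiteDomain : ∀ {a b ℓ} {H : Set a} {X : Setoid b ℓ} → (H → Finite X) → Setoid b ℓ
finiteDomain {X = X} _ = X

-- This is FrattiniSetoid for abQuotient p F c.  It is read off from the type of the field, because
-- comparing the two presentations of that group during type checking is prohibitively slow.
frattiniSetoid : (p g : ℕ) (F : TopGroup) (c : ℕ) (G : Grp) → Setoid (Level.suc 0ℓ) 0ℓ
frattiniSetoid p g F c G = finiteDomain (HasMeas.frattini {p} {g} {F} {c} {G} {1ℚ})

hasMeas-of-ratio : ∀ {p g F c G μ} (presentations : Finite (Presentations p g F c G))
  (frattini : Finite (frattiniSetoid p g F c G)) →
  .⦃ _ : NonZero (size frattini ^ suc g) ⦄ → μ ≡ + size presentations / (size frattini ^ suc g) →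
  HasMeas p g F c G μ
hasMeas-of-ratio presentations frattini ratio = record
  { presentations = presentations ; frattini = frattini ; ratio = ratio }

module MeasureOfGroup (p : ℕ) (pr : Prime p) (g : ℕ) (F : TopGroup) (free : IsFreeProP p g F)
  (G : AbelianGroup 0ℓ 0ℓ) (finG : Finite (AbelianGroup.setoid G)) (p-power : ∃ λ k → size finG ≡ p ^ k)
  (rank : HasRank (AbelianGroup.group G) g)
  where
  private
    module G = AbelianGroup G

    EG : Enum G.setoid
    EG = enumFinite finG

  finAut : Finite (Aut G.group)
  finAut = finiteEnum (enumAut G finG)

  module _ (e : ℕ) (torsion : ∀ x → Multiples._×_ G (p ^ suc e) x G.≈ G.ε) where
    private
      𝔸 : AbelianGroup 0ℓ 0ℓ
      𝔸 = abQuotient p F (suc e)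

      open IsFreeProP free using (ι)
      open FreeAbelianQuotient p pr e g F free
      module C = Coordinates p pr e g 𝔸 torsion𝔸 ι coord coord-isHom coord-ι

      E𝔸 : Enum (AbelianGroup.setoid 𝔸)
      E𝔸 = C.E𝔸 coord-injective

      open Presenting p pr e g 𝔸 E𝔸 torsion𝔸 G EG torsion ι using (module 𝔸; module P𝔸; module PG; module WithBasis)

      extend : (y : Fin g → G.Carrier) → Σ[ f ∈ (𝔸.Carrier → G.Carrier) ] (IsHom 𝔸 G f ∧ (∀ k → f (ι k) G.≈ y k))
      extend y = let (f , _ , hom , f-ι) = extension p F (suc e) G free finG p-power torsion y in f , hom , f-ι

    p^eG : PG.DecSubgroup
    p^eG = image EG EG (×-isHom G (p ^ e)) PG.whole

    module _ (w : ℕ) (card-p^eG : PG.card-sub p^eG * p ^ w ≡ p ^ g) where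
      private
        module Count = WithBasis (C.ι-spans coord-injective) extend (C.p-torsion-divisible coord-injective)
          (C.card-p-torsion coord-injective) (card-p-torsion≡p^rank p pr (suc e) G EG torsion rank)
          (HasRank.generators rank , Generates⇒spans p pr (suc e) G EG torsion (HasRank.generators rank) (HasRank.generates rank))
          w card-p^eG

        toFrattini : ∀ {x} → x P𝔸.∈ₛ P𝔸.multiples P𝔸.whole → Frattini 𝔸.group x
        toFrattini = multiple⇒Frattini p pr (suc e) 𝔸 E𝔸 torsion𝔸

        module FrattiniElements = Subset E𝔸 (frattiniSetoid p g F (suc e) G.group)
          (P𝔸.DecSubgroup.mem? (P𝔸.multiples P𝔸.whole)) (P𝔸.DecSubgroup.resp (P𝔸.multiples P𝔸.whole))
          (λ x x∈ → x , toFrattini x∈) proj₁ (λ x → C.Frattini⇒multiple coord-injective (proj₂ x))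
          id id (λ x _ → 𝔸.refl)

        module PresentationTuples = Subset (P𝔸.enumTuple (suc g)) (Presentations p g F (suc e) G.group)
          {P = Count.Presented} Count.Presented? Count.Presented-resp
          (λ t presented → (λ k → t k , toFrattini (Count.Presented⇒∈p𝔸 presented k)) , presented)
          (λ v k → proj₁ (proj₁ v k)) proj₂ id id (λ t _ k → 𝔸.refl)

        frattini : Finite (frattiniSetoid p g F (suc e) G.group)
        frattini = FrattiniElements.finite

        presentations : Finite (Presentations p g F (suc e) G.group)
        presentations = PresentationTuples.finite

        w≤g : w ≤ g
        w≤g = ^-cancelʳ-≤ p PG.1<p (≤-trans (m≤n*m (p ^ w) (PG.card-sub p^eG) ⦃ ≢-nonZero (PG.card-sub≢0 p^eG) ⦄) (≤-reflexive card-p^eG))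

        card-presentations : size presentations ≡ Enum.count (P𝔸.enumTuple (suc g)) Count.Presented?
        card-presentations = PresentationTuples.size-finite

        count-identity : size presentations * size finAut ≡
          (Count.γ' ^ g * surjections p g g) * (Count.ρ' ^ suc g * surjections p (suc g) w)
        count-identity = Count.count-presentations (enumAut G finG) {size presentations} {size finAut}
          card-presentations ≡.refl

        γ-eq : size finG ≡ p ^ g * Count.γ'
        γ-eq = ≡.trans (≡.sym (card-enumFinite finG)) Count.γ≡

        γρ-eq : size finG * Count.ρ ≡ p ^ g * size frattini
        γρ-eq = ≡.trans (cong (_* Count.ρ) (≡.sym (card-enumFinite finG)))
          (≡.trans Count.γρ≡ (cong (p ^ g *_) (≡.sym FrattiniElements.size-finite)))

      -- Both formulas of the theorem are instances: at level e + 1 = c the number w is u, and at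
      -- higher levels p^e G is trivial and w is g.
      hasMeas : HasMeas p g F (suc e) G.group
        (1/∣Aut∣∣G∣ G.group finAut finG *ℚ (+ (p ^ (g * (g + 1))) / 1)
          *ℚ ∏[ 1 ⋯ g ] (1-p^- pr)
          *ℚ ∏[ g + 2 ∸ w ⋯ g + 1 ] (1-p^- pr))
      hasMeas = hasMeas-of-ratio {p} {g} {F} {suc e} {G.group} presentations frattini ratio
        where
        instance
          ∣Aut∣∣G∣-nonZero : NonZero (size finAut * size finG)
          ∣Aut∣∣G∣-nonZero = m*n≢0 (size finAut) (size finG)
            ⦃ size-nonZero finAut (idAut G.group) ⦄ ⦃ size-nonZero finG G.ε ⦄

          ∣Φ∣^-nonZero : NonZero (size frattini ^ suc g)
          ∣Φ∣^-nonZero = m^n≢0 (size frattini) (suc g) ⦃ size-nonZero frattini (𝔸.ε , ε∈Frattini 𝔸.group) ⦄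

        ratio : 1/∣Aut∣∣G∣ G.group finAut finG *ℚ (+ (p ^ (g * (g + 1))) / 1)
                  *ℚ ∏[ 1 ⋯ g ] (1-p^- pr) *ℚ ∏[ g + 2 ∸ w ⋯ g + 1 ] (1-p^- pr)
                ≡ + size presentations / (size frattini ^ suc g)
        ratio = Measure.measure-ratio p pr {g} {w} {size finAut} {size finG} {Count.γ'} {Count.ρ} {Count.ρ'}
          {size frattini} {size presentations} w≤g count-identity γ-eq Count.ρ≡ γρ-eq ≡.refl ≡.refl

open import Data.Vec.Base using (count)

theorem2p19 : ∀ (p g c : ℕ) (pr : Prime p) → ¬ (2 ∣ p) → 1 ≤ g →
    (F : TopGroup) → IsFreeProP p g F →
    (A : AbelianGroup 0ℓ 0ℓ) → let G = AbelianGroup.group A in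
    (finG : Finite (AbelianGroup.setoid A)) → (∃ λ k → size finG ≡ p ^ k) →
    HasPClass p (discrete G) c → HasRank G g →
    Σ[ finAut ∈ Finite (Aut G) ]
    ((∀ {r} (ms : Vec ℕ r) → IsCyclicDecomposition G ms →
    let u = count (λ m → m <? p ^ c) ms in
    HasMeas p g F c G
    (1/∣Aut∣∣G∣ G finAut finG *ℚ (+ (p ^ (g * (g + 1))) / 1)
    *ℚ ∏[ 1 ⋯ g ] (1-p^- pr)
    *ℚ ∏[ g + 2 ∸ u ⋯ g + 1 ] (1-p^- pr)))
    ∧
    (∀ c' → c < c' →
    HasMeas p g F c' G
    (1/∣Aut∣∣G∣ G finAut finG *ℚ (+ (p ^ (g * (g + 1))) / 1)
    *ℚ ∏[ 1 ⋯ g ] (1-p^- pr)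
    *ℚ ∏[ 2 ⋯ g + 1 ] (1-p^- pr))))
theorem2p19 p g c pr _ 1≤g F free A finG p-power class rank = M.finAut , at-class c torsion , beyond
  where
  open AbelianGroup A
  module M = MeasureOfGroup p pr g F free A finG p-power rank
  EG = enumFinite finG

  torsion : ∀ x → Multiples._×_ A (p ^ c) x ≈ ε
  torsion x = HasPClass.trivial class (power∈P p (discrete group) c x)

  μ : ℕ → ℚ
  μ lo = 1/∣Aut∣∣G∣ group M.finAut finG *ℚ (+ (p ^ (g * (g + 1))) / 1)
           *ℚ ∏[ 1 ⋯ g ] (1-p^- pr) *ℚ ∏[ lo ⋯ g + 1 ] (1-p^- pr)

  at-class : ∀ c → (∀ x → Multiples._×_ A (p ^ c) x ≈ ε) → ∀ {r} (ms : Vec ℕ r) → IsCyclicDecomposition group ms →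
             HasMeas p g F c group (μ (g + 2 ∸ count (λ m → m <? p ^ c) ms))
  at-class zero    torsion ms dec = contradiction (≤-trans 1≤g (HasRank.minimal rank (λ ()) generates)) λ ()
    where
    -- For c = 0 the exponent is p^0 = 1, so G is trivial and the empty tuple generates it, which
    -- contradicts g ≥ 1.
    generates : Generates group {0} (λ ())
    generates x = gen-resp (trans (sym (torsion x)) (Multiples.×-homo-1 A x)) gen-ε
  at-class (suc e) torsion {r} ms dec = M.hasMeas e torsion (count (λ m → m <? p ^ suc e) ms)
    (subst (λ n → PG.card-sub (M.p^eG e torsion) * p ^ count (λ m → m <? p ^ suc e) ms ≡ p ^ n) r≡g D.card-p^cG)
    where
    module PG = PGroup p pr (suc e) A EG torsion
    module D = Decomposition p pr e A EG torsion ms dec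
    r≡g : r ≡ g
    r≡g = ^-injectiveʳ p PG.1<p (≡.trans (≡.sym D.card-p-torsion≡p^length)
      (card-p-torsion≡p^rank p pr (suc e) A EG torsion rank))

  -- For c' = e + 1 > c already p^e kills G, so |p^e G| = 1 forces w = g; the lower limit g + 2 - g
  -- becomes 2.
  beyond : ∀ c' → c < c' → HasMeas p g F c' group (μ 2)
  beyond (suc e) (s≤s c≤e) = subst (λ lo → HasMeas p g F (suc e) group (μ lo)) (m+n∸m≡n g 2)
    (M.hasMeas e torsion' g (≡.trans (cong (_* p ^ g) card-p^eG) (*-identityˡ (p ^ g))))
    where
    torsion' : ∀ x → Multiples._×_ A (p ^ suc e) x ≈ ε
    torsion' x = ×-torsion-≤ A p (m≤n⇒m≤1+n c≤e) x (torsion x)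
    module PG = PGroup p pr (suc e) A EG torsion'
    module I = PG.DecSubgroup (M.p^eG e torsion')
    card-p^eG : PG.card-sub (M.p^eG e torsion') ≡ 1
    card-p^eG = PG.count-unique I.resp I.mem? ε I.ε∈
      (λ (b , _ , eq) → trans (sym eq) (×-torsion-≤ A p c≤e b (torsion b)))
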